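{- Let $V$ be an affine variety in $\mathbb{G}_m^n$ defined over $\mathbb{Q}$, given by polynomial equations $$\sum_{\mathbf i} a_{\ell \mathbf i}\,\mathbf x^{\mathbf i}=0\qquad(\ell=1,\dots,L)$$ with rational coefficients $a_{\ell\mathbf i}$, of total degree $d$ (the maximum of the total degrees of the $L$ polynomials). Suppose that the set $$\mathcal N(V)=\{\mathbf i\in\mathbb{Z}^n \mid a_{\ell\mathbf i}\neq 0 \text{ for some } \ell\}$$ has diameter $D(V)$ (in the Euclidean metric). Let $N:=\#\mathcal N(V)$, so that $N\leq\binom{n+d}{d}$, and let $P_N$ be the product of all primes up to $N$. Then every $(n-k)$-dimensional maximal torsion coset on $V$ has an exponent $mP_N$ for some positive integer $m\leq D(V)^{2k}k^{k/2}$.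
   Context: $\mathbb{G}_m=\mathbb{C}^*$ is the multiplicative group of $\mathbb{C}$, and $\mathbb{G}_m^n=\{(x_1,\dots,x_n)\mid x_i\neq 0\}$; for $\mathbf i=(i_1,\dots,i_n)$, $\mathbf x^{\mathbf i}=x_1^{i_1}\cdots x_n^{i_n}$. Varieties are not assumed irreducible. An $r$-dimensional subtorus $H$ of $\mathbb{G}_m^n$ is a subgroup of the form $H=\{(x_1,\dots,x_n)\mid x_i=t_1^{e_{1i}}\cdots t_r^{e_{ri}},\ t_1,\dots,t_r\in\mathbb{G}_m\}$ for some $r\times n$ integer matrix $E=(e_{ji})$ of rank $r$. A torsion coset is a translate $\boldsymbol\omega H$ of a subtorus $H$ by a point $\boldsymbol\omega=(\omega_1,\dots,\omega_n)$ all of whose coordinates are roots of unity; its dimension is that of $H$. An exponent of $\boldsymbol\omega H$ is any (positive) multiple of the order of $\boldsymbol\omega H$ as an element of the group $\mathbb{G}_m^n/H$. A maximal torsion coset on (or of) a variety $V\subset\mathbb{G}_m^n$ is a torsion coset contained in $V$ and not properly contained in any other torsion coset contained in $V$. -}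

module Defs where

open import Algebra.Bundles using (AbelianGroup; CommutativeRing; Group)
open import Algebra.Structures using (IsCommutativeRing)
import Algebra.Construct.Pointwise as Pointwise
import Algebra.Definitions.RawMonoid as RawMonoidDefs
import Algebra.Properties.Group as GroupProperties
import Algebra.Properties.Ring as RingProperties
open import Data.Fin.Base using (Fin)
open import Data.Integer.Base as ℤ using (ℤ; +_; -[1+_]; 0ℤ)
open import Data.List.Base using (List; cartesianProductWith; filter; foldr; length; map; upTo)
open import Data.List.Extrema.Nat using (max)
open import Data.List.Membership.Propositional using (_∈_)
open import Data.List.Relation.Unary.Unique.Propositional using (Unique)
open import Data.Maybe.Base using (nothing)
open import Data.Nat.Base as ℕ using (ℕ; suc; ∣_-_∣)
open import Data.Nat.Divisibility using (_∣_)
open import Data.Nat.ListAction using (product)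
open import Data.Nat.Primality using (prime?)
import Data.Nat.Properties as ℕ
open import Data.Product.Base using (_×_; _,_; ∃-syntax; Σ-syntax; proj₁; proj₂; uncurry)
open import Data.Rational.Base as ℚ using (ℚ; 0ℚ; 1ℚ; ½)
import Data.Rational.Properties as ℚ
open import Data.Vec.Base as Vec using (Vec; lookup)
open import Function.Base using (id; _∘_)
open import Function.Bundles using (_⇔_)
open import Level using (0ℓ)
open import Relation.Binary.PropositionalEquality
  using (_≡_; _≢_; refl; sym; trans; cong; subst; subst₂)
open import Relation.Nullary.Negation using (¬_)
open import Relation.Unary using (Pred; _⊆_; _⊂_)
open import Tactic.RingSolver.Core.AlmostCommutativeRing using (fromCommutativeRing)
import Tactic.RingSolver.NonReflective as RingSolver

module _ {I : Set} (stage : I → ℕ) where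

  -- f i → 0 as stage i → ∞
  Vanishes : (I → ℚ) → Set
  Vanishes f = ∀ ε → 0ℚ ℚ.< ε → ∃[ N ] (∀ i → N ℕ.≤ stage i → ℚ.∣ f i ∣ ℚ.< ε)

  EventuallyBounded : (I → ℚ) → Set
  EventuallyBounded f =
    ∃[ B ] 0ℚ ℚ.< B × ∃[ N ] (∀ i → N ℕ.≤ stage i → ℚ.∣ f i ∣ ℚ.< B)

-- N ≤ m ⊓ n means that both N ≤ m and N ≤ n
Cauchy : (ℕ → ℚ) → Set
Cauchy x = Vanishes (uncurry ℕ._⊓_) λ (m , n) → x m ℚ.- x n

half+half : ∀ ε → ½ ℚ.* ε ℚ.+ ½ ℚ.* ε ≡ ε
half+half ε = trans (sym (ℚ.*-distribʳ-+ ε ½ ½)) (ℚ.*-identityˡ ε)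

module _ {I : Set} {stage : I → ℕ} where

  vanishes-cong : {f g : I → ℚ} → (∀ i → f i ≡ g i) → Vanishes stage f → Vanishes stage g
  vanishes-cong f≡g vf ε 0<ε with N , small ← vf ε 0<ε =
    N , λ i N≤i → subst (λ q → ℚ.∣ q ∣ ℚ.< ε) (f≡g i) (small i N≤i)

  vanishes-0 : Vanishes stage (λ _ → 0ℚ)
  vanishes-0 ε 0<ε = 0 , λ _ _ → 0<ε

  vanishes-neg : {f : I → ℚ} → Vanishes stage f → Vanishes stage (λ i → ℚ.- f i)
  vanishes-neg {f} vf ε 0<ε with N , small ← vf ε 0<ε =
    N , λ i N≤i → subst (ℚ._< ε) (sym (ℚ.∣-p∣≡∣p∣ (f i))) (small i N≤i)

  vanishes-+ : {f g : I → ℚ} → Vanishes stage f → Vanishes stage g →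
               Vanishes stage (λ i → f i ℚ.+ g i)
  vanishes-+ {f} {g} vf vg ε 0<ε
    with M , smallf ← vf (½ ℚ.* ε) (ℚ.*-monoʳ-<-pos ½ 0<ε)
       | N , smallg ← vg (½ ℚ.* ε) (ℚ.*-monoʳ-<-pos ½ 0<ε) =
    M ℕ.⊔ N , λ i b≤i → subst (ℚ.∣ f i ℚ.+ g i ∣ ℚ.<_) (half+half ε)
      (ℚ.≤-<-trans (ℚ.∣p+q∣≤∣p∣+∣q∣ (f i) (g i))
        (ℚ.+-mono-< (smallf i (ℕ.m⊔n≤o⇒m≤o M N b≤i))
                    (smallg i (ℕ.m⊔n≤o⇒n≤o M N b≤i))))

  vanishes-* : {f g : I → ℚ} → EventuallyBounded stage f → Vanishes stage g →
               Vanishes stage (λ i → f i ℚ.* g i)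
  vanishes-* {f} {g} (B , 0<B , M , bounded) vg ε 0<ε = result
    where
    instance
      posB = ℚ.positive 0<B
      B≢0 = ℚ.pos⇒nonZero B
      pos1/B = ℚ.1/pos⇒pos B

    δ : ℚ
    δ = ℚ.1/ B ℚ.* ε

    Bδ≡ε : B ℚ.* δ ≡ ε
    Bδ≡ε = trans (sym (ℚ.*-assoc B (ℚ.1/ B) ε))
                 (trans (cong (ℚ._* ε) (ℚ.*-inverseʳ B)) (ℚ.*-identityˡ ε))

    0<δ : 0ℚ ℚ.< δ
    0<δ = subst (ℚ._< δ) (ℚ.*-zeroʳ (ℚ.1/ B)) (ℚ.*-monoʳ-<-pos (ℚ.1/ B) 0<ε)

    result : ∃[ N ] (∀ i → N ℕ.≤ stage i → ℚ.∣ f i ℚ.* g i ∣ ℚ.< ε)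
    result with N , small ← vg δ 0<δ = M ℕ.⊔ N , λ i b≤i →
      subst₂ ℚ._<_ (sym (ℚ.∣p*q∣≡∣p∣*∣q∣ (f i) (g i))) Bδ≡ε
        (ℚ.≤-<-trans
          (ℚ.*-monoʳ-≤-nonNeg ℚ.∣ g i ∣ {{ℚ.nonNegative (ℚ.0≤∣p∣ (g i))}}
            (ℚ.<⇒≤ (bounded i (ℕ.m⊔n≤o⇒m≤o M N b≤i))))
          (ℚ.*-monoʳ-<-pos B (small i (ℕ.m⊔n≤o⇒n≤o M N b≤i))))

private module ℚ-Solver = RingSolver (fromCommutativeRing ℚ.+-*-commutativeRing λ _ → nothing)

product-difference : ∀ a b c d →
  a ℚ.* (b ℚ.- d) ℚ.+ d ℚ.* (a ℚ.- c) ≡ a ℚ.* b ℚ.- c ℚ.* d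
product-difference a b c d = begin
  a ℚ.* (b ℚ.- d) ℚ.+ d ℚ.* (a ℚ.- c)
    ≡⟨ solve 4 (λ a b c d → (a ⊗ (b ⊕ (⊝ d)) ⊕ d ⊗ (a ⊕ (⊝ c)))
                 ⊜ ((a ⊗ b ⊕ (⊝ (c ⊗ d))) ⊕ (a ⊗ d ⊕ (⊝ (a ⊗ d))))) refl a b c d ⟩
  (a ℚ.* b ℚ.- c ℚ.* d) ℚ.+ (a ℚ.* d ℚ.- a ℚ.* d)
    ≡⟨ cong ((a ℚ.* b ℚ.- c ℚ.* d) ℚ.+_) (ℚ.+-inverseʳ (a ℚ.* d)) ⟩
  (a ℚ.* b ℚ.- c ℚ.* d) ℚ.+ 0ℚ
    ≡⟨ ℚ.+-identityʳ _ ⟩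
  a ℚ.* b ℚ.- c ℚ.* d ∎
  where
  open ℚ-Solver
  open Relation.Binary.PropositionalEquality.≡-Reasoning

sum-difference : ∀ a b c d →
  (a ℚ.- c) ℚ.+ (b ℚ.- d) ≡ (a ℚ.+ b) ℚ.- (c ℚ.+ d)
sum-difference = solve 4 (λ a b c d →
  ((a ⊕ (⊝ c)) ⊕ (b ⊕ (⊝ d))) ⊜ ((a ⊕ b) ⊕ (⊝ (c ⊕ d)))) refl
  where open ℚ-Solver

neg-difference : ∀ a b → ℚ.- (a ℚ.- b) ≡ ℚ.- a ℚ.- ℚ.- b
neg-difference = solve 2 (λ a b → (⊝ (a ⊕ (⊝ b))) ⊜ ((⊝ a) ⊕ (⊝ (⊝ b)))) refl
  where open ℚ-Solver

telescope : ∀ a b c → (a ℚ.- b) ℚ.+ (b ℚ.- c) ≡ a ℚ.- c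
telescope a b c = trans (ℚ.+-assoc a (ℚ.- b) (b ℚ.- c))
  (cong (a ℚ.+_) (trans (sym (ℚ.+-assoc (ℚ.- b) b (ℚ.- c)))
    (trans (cong (ℚ._- c) (ℚ.+-inverseˡ b)) (ℚ.+-identityˡ (ℚ.- c)))))

swap-difference : ∀ a b → ℚ.- (a ℚ.- b) ≡ b ℚ.- a
swap-difference = GroupProperties.⁻¹-anti-homo-// ℚ.+-0-group

cauchy-bounded : ∀ {x} → Cauchy x → EventuallyBounded id x
cauchy-bounded {x} cx with N , near ← cx 1ℚ (ℚ.positive⁻¹ 1ℚ) =
  1ℚ ℚ.+ ℚ.∣ x N ∣ ,
  ℚ.+-mono-<-≤ (ℚ.positive⁻¹ 1ℚ) (ℚ.0≤∣p∣ (x N)) ,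
  N ,
  λ n N≤n → ℚ.≤-<-trans
    (subst (λ q → ℚ.∣ q ∣ ℚ.≤ ℚ.∣ x n ℚ.- x N ∣ ℚ.+ ℚ.∣ x N ∣) (trans (ℚ.+-assoc (x n) (ℚ.- x N) (x N))
        (trans (cong (x n ℚ.+_) (ℚ.+-inverseˡ (x N))) (ℚ.+-identityʳ (x n))))
      (ℚ.∣p+q∣≤∣p∣+∣q∣ (x n ℚ.- x N) (x N)))
    (ℚ.+-mono-<-≤ (near (n , N) (ℕ.⊓-glb N≤n ℕ.≤-refl)) ℚ.≤-refl)

bounded-proj₁ : ∀ {x : ℕ → ℚ} → EventuallyBounded id x →
                EventuallyBounded (uncurry ℕ._⊓_) (x ∘ proj₁)
bounded-proj₁ (B , 0<B , N , bounded) =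
  B , 0<B , N , λ (m , n) N≤ → bounded m (ℕ.m≤n⊓o⇒m≤n m n N≤)

bounded-proj₂ : ∀ {x : ℕ → ℚ} → EventuallyBounded id x →
                EventuallyBounded (uncurry ℕ._⊓_) (x ∘ proj₂)
bounded-proj₂ (B , 0<B , N , bounded) =
  B , 0<B , N , λ (m , n) N≤ → bounded n (ℕ.m≤n⊓o⇒m≤o m n N≤)

-- Cauchy sequences of rationals, with _≈ᴿ_ identifying those whose difference
-- is a null sequence.
record ℝ : Set where
  constructor mkℝ
  field
    seq    : ℕ → ℚ
    cauchy : Cauchy seq

open ℝ

infix 4 _≈ᴿ_
infixl 6 _+ᴿ_
infixl 7 _*ᴿ_

-- A record, so that the two reals can be inferred from a proof.
record _≈ᴿ_ (x y : ℝ) : Set where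
  constructor mk≈
  field
    difference-vanishes : Vanishes id λ n → seq x n ℚ.- seq y n

open _≈ᴿ_

-- The Cauchy conditions and ring laws are abstract only to keep normal forms
-- small: nothing depends on how they are proved.
abstract

  cauchy-const : ∀ q → Cauchy (λ _ → q)
  cauchy-const q = vanishes-cong (λ _ → sym (ℚ.+-inverseʳ q)) vanishes-0

  cauchy-+ : ∀ x y → Cauchy (λ n → seq x n ℚ.+ seq y n)
  cauchy-+ x y = vanishes-cong
    (λ (m , n) → sum-difference (seq x m) (seq y m) (seq x n) (seq y n))
    (vanishes-+ (cauchy x) (cauchy y))

  cauchy-neg : ∀ x → Cauchy (λ n → ℚ.- seq x n)
  cauchy-neg x = vanishes-cong
    (λ (m , n) → neg-difference (seq x m) (seq x n)) (vanishes-neg (cauchy x))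

  cauchy-* : ∀ x y → Cauchy (λ n → seq x n ℚ.* seq y n)
  cauchy-* x y = vanishes-cong
    (λ (m , n) → product-difference (seq x m) (seq y m) (seq x n) (seq y n))
    (vanishes-+
      (vanishes-* {f = seq x ∘ proj₁} {g = λ (m , n) → seq y m ℚ.- seq y n}
        (bounded-proj₁ (cauchy-bounded (cauchy x))) (cauchy y))
      (vanishes-* {f = seq y ∘ proj₂} {g = λ (m , n) → seq x m ℚ.- seq x n}
        (bounded-proj₂ (cauchy-bounded (cauchy y))) (cauchy x)))

fromℚᴿ : ℚ → ℝ
fromℚᴿ q = mkℝ (λ _ → q) (cauchy-const q)

_+ᴿ_ : ℝ → ℝ → ℝ
x +ᴿ y = mkℝ (λ n → seq x n ℚ.+ seq y n) (cauchy-+ x y)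

-ᴿ_ : ℝ → ℝ
-ᴿ x = mkℝ (λ n → ℚ.- seq x n) (cauchy-neg x)

_*ᴿ_ : ℝ → ℝ → ℝ
x *ᴿ y = mkℝ (λ n → seq x n ℚ.* seq y n) (cauchy-* x y)

pointwise : ∀ {x y} → (∀ n → seq x n ≡ seq y n) → x ≈ᴿ y
pointwise {x} {y} x≡y = mk≈ (vanishes-cong
  (λ n → sym (trans (cong (ℚ._- seq y n) (x≡y n)) (ℚ.+-inverseʳ (seq y n)))) vanishes-0)

abstract

  ℝ-isCommutativeRing : IsCommutativeRing _≈ᴿ_ _+ᴿ_ _*ᴿ_ -ᴿ_ (fromℚᴿ 0ℚ) (fromℚᴿ 1ℚ)
  ℝ-isCommutativeRing = record
    { isRing = record
      { +-isAbelianGroup = record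
        { isGroup = record
          { isMonoid = record
            { isSemigroup = record
              { isMagma = record
                { isEquivalence = record
                  { refl = pointwise λ _ → refl
                  ; sym = λ {x} {y} (mk≈ d) → mk≈
                      (vanishes-cong (λ n → swap-difference (seq x n) (seq y n)) (vanishes-neg d))
                  ; trans = λ {x} {y} {z} (mk≈ d) (mk≈ e) → mk≈
                      (vanishes-cong (λ n → telescope (seq x n) (seq y n) (seq z n))
                        (vanishes-+ d e))
                  }
                ; ∙-cong = λ {x} {y} {u} {v} (mk≈ d) (mk≈ e) → mk≈
                    (vanishes-cong
                      (λ n → sum-difference (seq x n) (seq u n) (seq y n) (seq v n))
                      (vanishes-+ d e))
                }
              ; assoc = λ x y z → pointwise λ n → ℚ.+-assoc (seq x n) (seq y n) (seq z n)
              }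
            ; identity = (λ x → pointwise λ n → ℚ.+-identityˡ (seq x n))
                       , (λ x → pointwise λ n → ℚ.+-identityʳ (seq x n))
            }
          ; inverse = (λ x → pointwise λ n → ℚ.+-inverseˡ (seq x n))
                    , (λ x → pointwise λ n → ℚ.+-inverseʳ (seq x n))
          ; ⁻¹-cong = λ {x} {y} (mk≈ d) → mk≈
              (vanishes-cong (λ n → neg-difference (seq x n) (seq y n)) (vanishes-neg d))
          }
        ; comm = λ x y → pointwise λ n → ℚ.+-comm (seq x n) (seq y n)
        }
      ; *-cong = λ {x} {y} {u} {v} (mk≈ d) (mk≈ e) → mk≈
          (vanishes-cong
            (λ n → product-difference (seq x n) (seq u n) (seq y n) (seq v n))
            (vanishes-+
              (vanishes-* {f = seq x} {g = λ n → seq u n ℚ.- seq v n}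
                (cauchy-bounded (cauchy x)) e)
              (vanishes-* {f = seq v} {g = λ n → seq x n ℚ.- seq y n}
                (cauchy-bounded (cauchy v)) d)))
      ; *-assoc = λ x y z → pointwise λ n → ℚ.*-assoc (seq x n) (seq y n) (seq z n)
      ; *-identity = (λ x → pointwise λ n → ℚ.*-identityˡ (seq x n))
                   , (λ x → pointwise λ n → ℚ.*-identityʳ (seq x n))
      ; distrib = (λ x y z → pointwise λ n → ℚ.*-distribˡ-+ (seq x n) (seq y n) (seq z n))
                , (λ x y z → pointwise λ n → ℚ.*-distribʳ-+ (seq x n) (seq y n) (seq z n))
      }
    ; *-comm = λ x y → pointwise λ n → ℚ.*-comm (seq x n) (seq y n)
    }

ℝ-commutativeRing : CommutativeRing 0ℓ 0ℓ
ℝ-commutativeRing = record { isCommutativeRing = ℝ-isCommutativeRing }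

module AdjoinI (R : CommutativeRing 0ℓ 0ℓ) where

  open CommutativeRing R renaming (refl to ≈-refl; sym to ≈-sym; trans to ≈-trans)

  open RingProperties ring using (-1*x≈-x)
  open import Algebra.Solver.Ring.NaturalCoefficients.Default commutativeSemiring
    using (solve; _:+_; _:*_; _:=_)

  infix 4 _≈ᵢ_
  infixl 6 _+ᵢ_
  infixl 7 _*ᵢ_

  record R[i] : Set where
    constructor _+i_
    field
      re im : Carrier

  open R[i] public

  record _≈ᵢ_ (z w : R[i]) : Set where
    constructor _,_
    field
      re-≈ : re z ≈ re w
      im-≈ : im z ≈ im w

  _+ᵢ_ _*ᵢ_ : R[i] → R[i] → R[i]
  (a +i b) +ᵢ (c +i d) = (a + c) +i (b + d)
  (a +i b) *ᵢ (c +i d) = (a * c - b * d) +i (a * d + b * c)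

  -ᵢ_ : R[i] → R[i]
  -ᵢ (a +i b) = (- a) +i (- b)

  fromBase : Carrier → R[i]
  fromBase a = a +i 0#

  abstract

    R[i]-isCommutativeRing : IsCommutativeRing _≈ᵢ_ _+ᵢ_ _*ᵢ_ -ᵢ_ (fromBase 0#) (fromBase 1#)
    R[i]-isCommutativeRing = record
      { isRing = record
        { +-isAbelianGroup = record
          { isGroup = record
            { isMonoid = record
              { isSemigroup = record
                { isMagma = record
                  { isEquivalence = record
                    { refl = ≈-refl , ≈-refl
                    ; sym = λ (p , q) → ≈-sym p , ≈-sym q
                    ; trans = λ (p , q) (r , s) → ≈-trans p r , ≈-trans q s
                    }
                  ; ∙-cong = λ (p , q) (r , s) → +-cong p r , +-cong q s
                  }
                ; assoc = λ (a +i b) (c +i d) (e +i f) → +-assoc a c e , +-assoc b d f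
                }
              ; identity = (λ (a +i b) → +-identityˡ a , +-identityˡ b)
                         , (λ (a +i b) → +-identityʳ a , +-identityʳ b)
              }
            ; inverse = (λ (a +i b) → -‿inverseˡ a , -‿inverseˡ b)
                      , (λ (a +i b) → -‿inverseʳ a , -‿inverseʳ b)
            ; ⁻¹-cong = λ (p , q) → -‿cong p , -‿cong q
            }
          ; comm = λ (a +i b) (c +i d) → +-comm a c , +-comm b d
          }
        ; *-cong = *ᵢ-cong
        ; *-assoc = *ᵢ-assoc
        ; *-identity = *ᵢ-identityˡ , λ z → ≈ᵢ-trans (*ᵢ-comm z (fromBase 1#)) (*ᵢ-identityˡ z)
        ; distrib = *ᵢ-distribˡ , λ x y z →
            ≈ᵢ-trans (*ᵢ-comm (y +ᵢ z) x) (≈ᵢ-trans (*ᵢ-distribˡ x y z)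
              (+ᵢ-cong (*ᵢ-comm x y) (*ᵢ-comm x z)))
        }
      ; *-comm = *ᵢ-comm
      }
      where
      ≈ᵢ-trans : ∀ {x y z} → x ≈ᵢ y → y ≈ᵢ z → x ≈ᵢ z
      ≈ᵢ-trans (p , q) (r , s) = ≈-trans p r , ≈-trans q s

      +ᵢ-cong : ∀ {x y u v} → x ≈ᵢ y → u ≈ᵢ v → x +ᵢ u ≈ᵢ y +ᵢ v
      +ᵢ-cong (p , q) (r , s) = +-cong p r , +-cong q s

      *ᵢ-cong : ∀ {x y u v} → x ≈ᵢ y → u ≈ᵢ v → x *ᵢ u ≈ᵢ y *ᵢ v
      *ᵢ-cong (p , q) (r , s) =
        +-cong (*-cong p r) (-‿cong (*-cong q s)) , +-cong (*-cong p s) (*-cong q r)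

      *ᵢ-comm : ∀ x y → x *ᵢ y ≈ᵢ y *ᵢ x
      *ᵢ-comm (a +i b) (c +i d) =
        +-cong (*-comm a c) (-‿cong (*-comm b d)) ,
        ≈-trans (+-comm (a * d) (b * c)) (+-cong (*-comm b c) (*-comm a d))

      -- Subtraction as an operation of the semiring, with m = - 1#
      m : Carrier
      m = - 1#

      minus : ∀ {x x′ y y′} → x ≈ x′ → y ≈ y′ → x - y ≈ x′ + m * y′
      minus {y′ = y′} p q = +-cong p (≈-trans (-‿cong q) (≈-sym (-1*x≈-x y′)))

      *ᵢ-assoc : ∀ x y z → (x *ᵢ y) *ᵢ z ≈ᵢ x *ᵢ (y *ᵢ z)
      *ᵢ-assoc (a +i b) (c +i d) (e +i f) =
        ≈-trans (minus (*-cong (minus ≈-refl ≈-refl) ≈-refl) ≈-refl)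
        (≈-trans (solve 7 (λ a b c d e f m →
            (a :* c :+ m :* (b :* d)) :* e :+ m :* ((a :* d :+ b :* c) :* f)
            := a :* (c :* e :+ m :* (d :* f)) :+ m :* (b :* (c :* f :+ d :* e)))
            ≈-refl a b c d e f m)
        (≈-sym (minus (*-cong ≈-refl (minus ≈-refl ≈-refl)) ≈-refl))) ,
        ≈-trans (+-cong (*-cong (minus ≈-refl ≈-refl) ≈-refl) ≈-refl)
        (≈-trans (solve 7 (λ a b c d e f m →
            (a :* c :+ m :* (b :* d)) :* f :+ (a :* d :+ b :* c) :* e
            := a :* (c :* f :+ d :* e) :+ b :* (c :* e :+ m :* (d :* f)))
            ≈-refl a b c d e f m)
        (≈-sym (+-cong ≈-refl (*-cong ≈-refl (minus ≈-refl ≈-refl)))))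

      *ᵢ-identityˡ : ∀ z → fromBase 1# *ᵢ z ≈ᵢ z
      *ᵢ-identityˡ (a +i b) =
        ≈-trans (+-cong (*-identityˡ a) (≈-trans (-‿cong (zeroˡ b)) -0≈0)) (+-identityʳ a) ,
        ≈-trans (+-cong (*-identityˡ b) (zeroˡ a)) (+-identityʳ b)
        where
        -0≈0 : - 0# ≈ 0#
        -0≈0 = ≈-trans (≈-sym (+-identityˡ (- 0#))) (-‿inverseʳ 0#)

      *ᵢ-distribˡ : ∀ x y z → x *ᵢ (y +ᵢ z) ≈ᵢ x *ᵢ y +ᵢ x *ᵢ z
      *ᵢ-distribˡ (a +i b) (c +i d) (e +i f) =
        ≈-trans (minus ≈-refl ≈-refl)
        (≈-trans (solve 7 (λ a b c d e f m →
            a :* (c :+ e) :+ m :* (b :* (d :+ f))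
            := (a :* c :+ m :* (b :* d)) :+ (a :* e :+ m :* (b :* f)))
            ≈-refl a b c d e f m)
        (≈-sym (+-cong (minus ≈-refl ≈-refl) (minus ≈-refl ≈-refl)))) ,
        solve 6 (λ a b c d e f →
          a :* (d :+ f) :+ b :* (c :+ e)
          := (a :* d :+ b :* c) :+ (a :* f :+ b :* e)) ≈-refl a b c d e f

  R[i]-commutativeRing : CommutativeRing 0ℓ 0ℓ
  R[i]-commutativeRing = record { isCommutativeRing = R[i]-isCommutativeRing }

ℂ-commutativeRing : CommutativeRing 0ℓ 0ℓ
ℂ-commutativeRing = AdjoinI.R[i]-commutativeRing ℝ-commutativeRing

module ℂ = CommutativeRing ℂ-commutativeRing

ℂ : Set
ℂ = ℂ.Carrier

fromℚ : ℚ → ℂ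
fromℚ q = AdjoinI.fromBase ℝ-commutativeRing (fromℚᴿ q)

module UnitGroup (R : CommutativeRing 0ℓ 0ℓ) where

  open CommutativeRing R renaming (refl to ≈-refl; sym to ≈-sym; trans to ≈-trans)
  open import Relation.Binary.Reasoning.Setoid setoid

  record Unit : Set where
    constructor unit
    field
      val       : Carrier
      inv       : Carrier
      val*inv≈1 : val * inv ≈ 1#

  open Unit public

  infix 4 _≈ᵘ_

  record _≈ᵘ_ (x y : Unit) : Set where
    constructor mk≈ᵘ
    field
      val-≈ : val x ≈ val y

  open _≈ᵘ_ public

  abstract

    interchange : ∀ a b c d → (a * b) * (c * d) ≈ (a * c) * (b * d)
    interchange a b c d = begin
      (a * b) * (c * d)  ≈⟨ *-assoc a b (c * d) ⟩
      a * (b * (c * d))  ≈⟨ *-cong ≈-refl (*-assoc b c d) ⟨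
      a * ((b * c) * d)  ≈⟨ *-cong ≈-refl (*-cong (*-comm b c) ≈-refl) ⟩
      a * ((c * b) * d)  ≈⟨ *-cong ≈-refl (*-assoc c b d) ⟩
      a * (c * (b * d))  ≈⟨ *-assoc a c (b * d) ⟨
      (a * c) * (b * d)  ∎

    inv*val≈1 : ∀ x → inv x * val x ≈ 1#
    inv*val≈1 x = ≈-trans (*-comm (inv x) (val x)) (val*inv≈1 x)

    inv-cong : ∀ x y → val x ≈ val y → inv x ≈ inv y
    inv-cong x y x≈y = begin
      inv x                    ≈⟨ *-identityʳ (inv x) ⟨
      inv x * 1#               ≈⟨ *-cong ≈-refl (val*inv≈1 y) ⟨
      inv x * (val y * inv y)  ≈⟨ *-assoc (inv x) (val y) (inv y) ⟨
      inv x * val y * inv y    ≈⟨ *-cong (*-cong ≈-refl x≈y) ≈-refl ⟨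
      inv x * val x * inv y    ≈⟨ *-cong (inv*val≈1 x) ≈-refl ⟩
      1# * inv y               ≈⟨ *-identityˡ (inv y) ⟩
      inv y                    ∎

    ∙-val*inv≈1 : ∀ x y → val x * val y * (inv x * inv y) ≈ 1#
    ∙-val*inv≈1 x y = begin
      val x * val y * (inv x * inv y)  ≈⟨ interchange (val x) (val y) (inv x) (inv y) ⟩
      val x * inv x * (val y * inv y)  ≈⟨ *-cong (val*inv≈1 x) (val*inv≈1 y) ⟩
      1# * 1#                          ≈⟨ *-identityˡ 1# ⟩
      1#                               ∎

  _∙_ : Unit → Unit → Unit
  x ∙ y = unit (val x * val y) (inv x * inv y) (∙-val*inv≈1 x y)

  abelianGroup : AbelianGroup 0ℓ 0ℓ
  abelianGroup = record
    { Carrier = Unit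
    ; _≈_ = _≈ᵘ_
    ; _∙_ = _∙_
    ; ε = unit 1# 1# (*-identityˡ 1#)
    ; _⁻¹ = λ x → unit (inv x) (val x) (inv*val≈1 x)
    ; isAbelianGroup = record
      { isGroup = record
        { isMonoid = record
          { isSemigroup = record
            { isMagma = record
              { isEquivalence = record
                { refl = mk≈ᵘ ≈-refl
                ; sym = λ (mk≈ᵘ p) → mk≈ᵘ (≈-sym p)
                ; trans = λ (mk≈ᵘ p) (mk≈ᵘ q) → mk≈ᵘ (≈-trans p q)
                }
              ; ∙-cong = λ (mk≈ᵘ p) (mk≈ᵘ q) → mk≈ᵘ (*-cong p q)
              }
            ; assoc = λ x y z → mk≈ᵘ (*-assoc (val x) (val y) (val z))
            }
          ; identity = (λ x → mk≈ᵘ (*-identityˡ (val x)))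
                     , (λ x → mk≈ᵘ (*-identityʳ (val x)))
          }
        ; inverse = (λ x → mk≈ᵘ (inv*val≈1 x)) , (λ x → mk≈ᵘ (val*inv≈1 x))
        ; ⁻¹-cong = λ {x} {y} (mk≈ᵘ p) → mk≈ᵘ (inv-cong x y p)
        }
      ; comm = λ x y → mk≈ᵘ (*-comm (val x) (val y))
      }
    }

-- Constructively a nonzero complex number need not come with an inverse,
-- so ℂ* is the group of invertible elements.
𝔾ₘ : AbelianGroup 0ℓ 0ℓ
𝔾ₘ = UnitGroup.abelianGroup ℂ-commutativeRing

module 𝔾ₘ where
  open AbelianGroup 𝔾ₘ public
  open RawMonoidDefs rawMonoid public using () renaming (sum to ∏)
  open UnitGroup ℂ-commutativeRing public using (val)

𝔾ₘ^ : ℕ → AbelianGroup 0ℓ 0ℓ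
𝔾ₘ^ n = Pointwise.abelianGroup (Fin n) 𝔾ₘ

module 𝔾ₘ^ (n : ℕ) = AbelianGroup (𝔾ₘ^ n)

Point : ℕ → Set
Point n = 𝔾ₘ^.Carrier n

module GroupPower (G : Group 0ℓ 0ℓ) where
  open Group G
  open RawMonoidDefs rawMonoid using () renaming (_×_ to _times_)

  infixr 8 _^_ _^ᶻ_

  _^_ : Carrier → ℕ → Carrier
  x ^ n = n times x

  _^ᶻ_ : Carrier → ℤ → Carrier
  x ^ᶻ (+ n)    = x ^ n
  x ^ᶻ -[1+ n ] = (x ^ suc n) ⁻¹

open GroupPower 𝔾ₘ.group using (_^ᶻ_) renaming (_^_ to _^ᵘ_)
open module PointPower {n} = GroupPower (𝔾ₘ^.group n) using () renaming (_^_ to _^ᵖ_)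

-- An r × n integer matrix has rank r when its rows are linearly
-- independent (over ℤ or, clearing denominators, over ℚ).
HasFullRowRank : ∀ {r n} → (Fin r → Fin n → ℤ) → Set
HasFullRowRank {r} {n} E =
  ∀ (c : Fin r → ℤ) → (∀ i → ∑ (λ j → c j ℤ.* E j i) ≡ 0ℤ) → ∀ j → c j ≡ 0ℤ
  where open RawMonoidDefs ℤ.+-0-rawMonoid using () renaming (sum to ∑)

record Subtorus (n r : ℕ) : Set where
  field
    E    : Fin r → Fin n → ℤ
    rank : HasFullRowRank E

  points : Pred (Point n) 0ℓ
  points x = Σ[ t ∈ Point r ] (∀ i → x i 𝔾ₘ.≈ 𝔾ₘ.∏ (λ j → t j ^ᶻ E j i))

IsRootOfUnity : 𝔾ₘ.Carrier → Set
IsRootOfUnity ζ = ∃[ q ] 0 ℕ.< q × ζ ^ᵘ q 𝔾ₘ.≈ 𝔾ₘ.ε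

record TorsionCoset (n r : ℕ) : Set where
  field
    H       : Subtorus n r
    ω       : Point n
    torsion : ∀ i → IsRootOfUnity (ω i)

  points : Pred (Point n) 0ℓ
  points x = Σ[ h ∈ Point n ] Subtorus.points H h × 𝔾ₘ^._≈_ n x (𝔾ₘ^._∙_ n ω h)

-- q is the order of the class of x in 𝔾ₘⁿ/H
IsOrderModulo : ∀ {n r} → Subtorus n r → Point n → ℕ → Set
IsOrderModulo H x q =
  0 ℕ.< q × Subtorus.points H (x ^ᵖ q) ×
  (∀ j → 0 ℕ.< j → Subtorus.points H (x ^ᵖ j) → q ℕ.≤ j)

IsExponent : ∀ {n r} → TorsionCoset n r → ℕ → Set
IsExponent C e = 0 ℕ.< e × ∃[ q ] IsOrderModulo H ω q × q ∣ e
  where open TorsionCoset C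

IsMaximalOn : ∀ {n r} → Pred (Point n) 0ℓ → TorsionCoset n r → Set
IsMaximalOn {n} V C = points C ⊆ V ×
  ¬ (∃[ s ] Σ[ C′ ∈ TorsionCoset n s ] points C′ ⊆ V × points C ⊂ points C′)
  where open TorsionCoset

-- L polynomials in n variables: a ℓ i is the coefficient of the monomial
-- xⁱ in the ℓ-th polynomial, and 𝒩 enumerates, without repetition, the
-- (finite) set of exponents occurring in at least one of them.
record System (n L : ℕ) : Set where
  field
    a        : Fin L → Vec ℕ n → ℚ
    𝒩        : List (Vec ℕ n)
    𝒩-unique : Unique 𝒩
    ∈𝒩⇔      : ∀ i → i ∈ 𝒩 ⇔ (∃[ ℓ ] a ℓ i ≢ 0ℚ)

monomial : ∀ {n} → Point n → Vec ℕ n → ℂ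
monomial x i = 𝔾ₘ.val (𝔾ₘ.∏ λ j → x j ^ᵘ lookup i j)

distance² : ∀ {n} → Vec ℕ n → Vec ℕ n → ℕ
distance² i j = Vec.sum (Vec.zipWith (λ p q → ∣ p - q ∣ ℕ.^ 2) i j)

module _ {n L : ℕ} (V : System n L) where

  open System V

  evaluate : Fin L → Point n → ℂ
  evaluate ℓ x = foldr ℂ._+_ ℂ.0# (map (λ i → fromℚ (a ℓ i) ℂ.* monomial x i) 𝒩)

  variety : Pred (Point n) 0ℓ
  variety x = ∀ ℓ → evaluate ℓ x ℂ.≈ ℂ.0#

  -- The maximum over ℓ of the total degree of the ℓ-th polynomial: 𝒩 is the
  -- union of the supports of the polynomials.
  totalDegree : ℕ
  totalDegree = max 0 (map Vec.sum 𝒩)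

  #𝒩 : ℕ
  #𝒩 = length 𝒩

  -- The square of the Euclidean diameter of 𝒩, which is a natural number
  diameter² : ℕ
  diameter² = max 0 (cartesianProductWith distance² 𝒩 𝒩)

primorial : ℕ → ℕ
primorial N = product (filter prime? (upTo (suc N)))

{-# OPTIONS --safe #-}

-- A torsion coset ω H on V, with H given by E, makes the Laurent polynomials
-- f(ω tᴱ) vanish identically, so for every class of exponents with the same
-- image under E the rational combination of the roots of unity ωⁱ vanishes.  By
-- Mann's theorem these classes split further, into classes on which ωⁱ is
-- constant up to Q′-th roots of unity for some Q′ ∣ P_N, still with vanishing
-- sums.  Let M ⊆ ker E be the lattice generated by the differences of
-- equivalent exponents.  A linear form v vanishing on M but not on ker E would
-- enlarge E to a bigger torsion coset on V; hence by maximality a maximal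
-- independent family μ of these differences spans ker E rationally.  A nonzero
-- maximal minor δ of μ satisfies δ (ker E) ⊆ M and |δ| ≤ ∏ |μ_l| by Hadamard,
-- so ω^(|δ| P_N) is annihilated by the characters trivial on H and therefore
-- lies in H.
--
-- Mann's theorem rests on Galois conjugation f(z) = 0 ⇒ f(zᵘ) = 0.  For a large
-- prime u = p, f(zᵖ) ≡ f(z)ᵖ = 0 modulo p ℤ[z], while the coordinates of f(zᵖ)
-- in ℤ[z] are bounded independently of p; any u coprime to Q is congruent modulo
-- Q to a product of large primes.
module Submission where

open import Defs

-- Equality and order in `ℂ` are undecidable, and no exponential function is at hand to produce
-- roots of unity; this shapes the proof more than the arithmetic does. The argument runs over an
-- abstract ring with stable equality, and noneffective choices (a basis of a rational span, the
-- generator of an ideal) are made under double negation. That is harmless where the goal is a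
-- negation or an equality, but an exponent must exhibit the order of ω modulo H, a genuine least
-- number, so membership of torsion points in H has to be decidable. It becomes so because a local
-- ring can decide whether a root of unity is 1, which reduces membership to a finite search.
-- Primitive roots come from bisecting for a slope t at which (1 + i t)^M becomes real. Points whose
-- coordinates are powers of 2, a unit of infinite order, tell characters apart. Since |μ_l|² ≤ D²,
-- Hadamard gives m² ≤ D^(2s) with s ≤ k, which is within the required bound as soon as D ≥ 1; only
-- D = 0, where 0⁰ = 1, needs an argument of its own.

-- Counting the exponents of bounded degree.

module Counting where

  open import Data.List.Base using (List; []; _∷_; _++_; length; lookup; map)
  open import Data.List.Properties using (length-++; length-map)
  open import Data.List.Membership.Propositional using (_∈_)
  open import Data.List.Membership.Propositional.Properties using (∈-map⁺; ∈-++⁺ˡ; ∈-++⁺ʳ; ∈-lookup)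
  open import Data.List.Relation.Unary.All as All using ()
  open import Data.List.Relation.Unary.Any using (here; index)
  open import Data.List.Relation.Unary.Any.Properties using (lookup-index)
  open import Data.List.Relation.Unary.Unique.Propositional using (Unique)
  open import Data.List.Relation.Unary.AllPairs.Core using ([]; _∷_)
  open import Data.Fin.Base using (Fin; zero; suc)
  open import Data.Fin.Properties using (injective⇒≤)
  open import Data.List.Extrema.Nat using (xs≤max)
  open import Data.Nat.Base using (ℕ; zero; suc; _+_; _≤_; s≤s)
  open import Data.Nat.Combinatorics using (_C_; nCk+nC[k+1]≡[n+1]C[k+1])
  import Data.Nat.Properties as ℕ
  open import Data.Vec.Base as Vec using (Vec; []; _∷_)
  open import Relation.Binary.PropositionalEquality
  open import Relation.Nullary using (contradiction)

  lookup-injective : ∀ {A : Set} {xs : List A} → Unique xs →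
                     ∀ i j → lookup xs i ≡ lookup xs j → i ≡ j
  lookup-injective (x∉ ∷ u) zero    zero    _ = refl
  lookup-injective (x∉ ∷ u) zero    (suc j) e = contradiction e (All.lookup x∉ (∈-lookup j))
  lookup-injective (x∉ ∷ u) (suc i) zero    e = contradiction (sym e) (All.lookup x∉ (∈-lookup i))
  lookup-injective (x∉ ∷ u) (suc i) (suc j) e = cong suc (lookup-injective u i j e)

  unique⊆⇒length≤ : ∀ {A : Set} {xs ys : List A} → Unique xs → (∀ {x} → x ∈ xs → x ∈ ys) →
                    length xs ≤ length ys
  unique⊆⇒length≤ {xs = xs} {ys} u xs⊆ys = injective⇒≤ {f = f} λ {i} {j} fi≡fj →
    lookup-injective u i j (trans (lookup-index (xs⊆ys (∈-lookup i)))
      (trans (cong (lookup ys) fi≡fj) (sym (lookup-index (xs⊆ys (∈-lookup j))))))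
    where
    f = λ i → index (xs⊆ys (∈-lookup {xs = xs} i))

  incrementHead : ∀ {n} → Vec ℕ (suc n) → Vec ℕ (suc n)
  incrementHead (x ∷ v) = suc x ∷ v

  -- The exponents of total degree at most `d`, split according to whether the first entry is 0; the
  -- two halves match the two terms of Pascal's rule.
  simplex : (n d : ℕ) → List (Vec ℕ n)
  simplex zero    d       = [] ∷ []
  simplex (suc n) zero    = map (0 ∷_) (simplex n zero)
  simplex (suc n) (suc d) = map (0 ∷_) (simplex n (suc d)) ++ map incrementHead (simplex (suc n) d)

  length-simplex : ∀ n d → length (simplex n d) ≡ (n + d) C d
  length-simplex zero    d       = sym (nCn≡1 d)
    where open import Data.Nat.Combinatorics using (nCn≡1)
  length-simplex (suc n) zero    = trans (length-map _ (simplex n zero)) (length-simplex n zero)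
  length-simplex (suc n) (suc d) = begin
    length (map (0 ∷_) (simplex n (suc d)) ++ map incrementHead (simplex (suc n) d))
      ≡⟨ length-++ (map (0 ∷_) (simplex n (suc d))) ⟩
    length (map (0 ∷_) (simplex n (suc d))) + length (map incrementHead (simplex (suc n) d))
      ≡⟨ cong₂ _+_ (trans (length-map _ (simplex n (suc d))) (length-simplex n (suc d)))
                   (trans (length-map _ (simplex (suc n) d)) (length-simplex (suc n) d)) ⟩
    (n + suc d) C suc d + (suc n + d) C d
      ≡⟨ cong (λ m → (n + suc d) C suc d + m C d) (sym (ℕ.+-suc n d)) ⟩
    (n + suc d) C suc d + (n + suc d) C d
      ≡⟨ ℕ.+-comm ((n + suc d) C suc d) _ ⟩
    (n + suc d) C d + (n + suc d) C suc d
      ≡⟨ nCk+nC[k+1]≡[n+1]C[k+1] (n + suc d) d ⟩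
    (suc n + suc d) C suc d ∎
    where open ≡-Reasoning

  ∈-simplex : ∀ {n} (v : Vec ℕ n) d → Vec.sum v ≤ d → v ∈ simplex n d
  ∈-simplex []          d       _       = here refl
  ∈-simplex (zero  ∷ v) zero    v≤d     = ∈-map⁺ (0 ∷_) (∈-simplex v zero v≤d)
  ∈-simplex (zero  ∷ v) (suc d) v≤d     = ∈-++⁺ˡ (∈-map⁺ (0 ∷_) (∈-simplex v (suc d) v≤d))
  ∈-simplex (suc x ∷ v) (suc d) (s≤s p) =
    ∈-++⁺ʳ (map (0 ∷_) (simplex _ (suc d))) (∈-map⁺ incrementHead (∈-simplex (x ∷ v) d p))

  #𝒩≤ : ∀ {n L} (V : System n L) → #𝒩 V ≤ (n + totalDegree V) C totalDegree V
  #𝒩≤ {n} V = subst (#𝒩 V ≤_) (length-simplex n (totalDegree V))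
    (unique⊆⇒length≤ 𝒩-unique λ {i} i∈𝒩 → ∈-simplex i (totalDegree V)
      (All.lookup (xs≤max 0 (map Vec.sum 𝒩)) (∈-map⁺ Vec.sum i∈𝒩)))
    where open System V

-- Elementary number theory: prime divisors, primorials and residues.

module NumberTheory where

  open import Data.List.Base using (List; []; _∷_; _++_; filter; upTo)
  open import Data.List.Properties using (filter-++; upTo-∷ʳ)
  open import Data.List.Membership.Propositional.Properties using (∈-filter⁺; ∈-filter⁻; ∈-upTo⁺)
  open import Data.List.Relation.Unary.All as All using (All; []; _∷_)
  open import Data.List.Relation.Unary.All.Properties using (all-filter)
  open import Data.Nat.Base
  open import Data.Nat.Properties
  open import Data.Nat.Combinatorics using (_C_; nCk≡n!/k![n-k]!; k![n∸k]!∣n!)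
  open import Data.Nat.Coprimality using (Coprime)
  open import Data.Nat.Divisibility
  open import Data.Nat.DivMod
  open import Data.Nat.ListAction using (product)
  open import Data.Nat.ListAction.Properties using (∈⇒∣product; product-++)
  open import Data.Nat.Primality
  open import Data.Nat.Primality.Factorisation using (factorise; factorisationHasAllPrimeFactors)
  open import Data.Product.Base using (_×_; _,_; ∃-syntax; proj₁; proj₂)
  open import Data.Sum.Base using (inj₁; inj₂)
  open import Function.Base using (_∘_; it)
  open import Relation.Binary.PropositionalEquality hiding ([_])
  open import Relation.Binary.Definitions using (tri<; tri≈; tri>)
  open import Relation.Nullary using (¬_; Dec; yes; no; contradiction)
  open import Relation.Nullary.Decidable using (_×-dec_; ¬?)

  prime>1 : ∀ {p} → Prime p → 1 < p
  prime>1 {p} pr = nonTrivial⇒n>1 p {{prime⇒nonTrivial pr}}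

  prime∤1 : ∀ {p} → Prime p → ¬ p ∣ 1
  prime∤1 pr p∣1 = <⇒≱ (prime>1 pr) (∣⇒≤ p∣1)

  prime∣prime : ∀ {p q} → Prime p → Prime q → p ∣ q → p ≡ q
  prime∣prime pr qr p∣q with prime⇒irreducible qr p∣q
  ... | inj₁ refl = contradiction ∣-refl (prime∤1 pr)
  ... | inj₂ p≡q = p≡q

  prime∤! : ∀ {p} → Prime p → ∀ k → k < p → ¬ p ∣ k !
  prime∤! pr zero    _   p∣ = prime∤1 pr p∣
  prime∤! pr (suc k) k<p p∣ with euclidsLemma (suc k) (k !) pr p∣
  ... | inj₁ p∣sk = <⇒≱ k<p (∣⇒≤ p∣sk)
  ... | inj₂ p∣k! = prime∤! pr k (<-trans (n<1+n k) k<p) p∣k!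

  prime∣! : ∀ {p} → Prime p → p ∣ p !
  prime∣! {zero}  pr = contradiction (prime>1 pr) λ ()
  prime∣! {suc p} pr = m∣m*n (p !)

  C*k![n∸k]!≡n! : ∀ {n k} → k ≤ n → (n C k) * (k ! * (n ∸ k) !) ≡ n !
  C*k![n∸k]!≡n! {n} {k} k≤n =
    trans (cong (_* (k ! * (n ∸ k) !)) (nCk≡n!/k![n-k]! k≤n)) (m/n*n≡m (k![n∸k]!∣n! k≤n))
    where instance _ = k !* (n ∸ k) !≢0

  -- `p` divides `p !` but neither factorial of the denominator, all of whose factors are smaller
  -- than `p`.
  prime∣C : ∀ {p} → Prime p → ∀ k → 0 < k → k < p → p ∣ p C k
  prime∣C {p} pr k 0<k k<p
    with euclidsLemma (p C k) (k ! * (p ∸ k) !) pr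
           (subst (p ∣_) (sym (C*k![n∸k]!≡n! (<⇒≤ k<p))) (prime∣! pr))
  ... | inj₁ p∣C  = p∣C
  ... | inj₂ p∣!! with euclidsLemma (k !) ((p ∸ k) !) pr p∣!!
  ...   | inj₁ p∣k! = contradiction p∣k! (prime∤! pr k k<p)
  ...   | inj₂ p∣!  = contradiction p∣! (prime∤! pr (p ∸ k) (∸-monoʳ-< 0<k (<⇒≤ k<p)))

  ∃-primeDivisor : ∀ n → 1 < n → ∃[ p ] Prime p × p ∣ n
  ∃-primeDivisor n 1<n with factorise n {{>-nonZero (<-trans z<s 1<n)}}
  ... | record { factors = []     ; isFactorisation = refl } = contradiction 1<n (<-irrefl refl)
  ... | record { factors = p ∷ ps ; isFactorisation = refl ; factorsPrime = pr ∷ _ } =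
    p , pr , m∣m*n (product ps)

  -- A common divisor greater than 1 would have a prime divisor, and `0 < n` rules out the common
  -- divisor 0.
  coprime-by-primes : ∀ {m n} → 0 < n → (∀ p → Prime p → p ∣ n → ¬ p ∣ m) → Coprime m n
  coprime-by-primes {m} {n} 0<n no-common {d} (d∣m , d∣n) with <-cmp d 1
  ... | tri< (s≤s z≤n) _ _ = contradiction (0∣⇒≡0 d∣n) (m<n⇒n≢0 0<n)
  ... | tri≈ _ d≡1 _ = d≡1
  ... | tri> _ _ 1<d with p , pr , p∣d ← ∃-primeDivisor d 1<d =
    contradiction (∣-trans p∣d d∣m) (no-common p pr (∣-trans p∣d d∣n))

  -- Shifting u by the product of the small primes not dividing u removes all
  -- small prime factors.
  coprime-shift : ∀ u Q B → Coprime u Q → ∃[ t ] (∀ p → Prime p → p ∣ u + Q * t → B < p)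
  coprime-shift u Q B u⊥Q = t , large
    where
    small? : ∀ p → Dec (Prime p × ¬ p ∣ u)
    small? p = prime? p ×-dec ¬? (p ∣? u)
    ps : List ℕ
    ps = filter small? (upTo (suc B))
    t : ℕ
    t = product ps
    primes : All Prime ps
    primes = All.map proj₁ (all-filter small? (upTo (suc B)))
    large : ∀ p → Prime p → p ∣ u + Q * t → B < p
    large p pr p∣ with p ≤? B
    ... | no p≰B = ≰⇒> p≰B
    -- A small prime divides exactly one of `u` and `t`; if it divides `u`, it does not divide `Q`
    -- either, by coprimality. So it never divides `u + Q * t`.
    ... | yes p≤B with p ∣? u
    ...   | no p∤u = contradiction (∣m+n∣n⇒∣m p∣ (∣n⇒∣m*n Q (∈⇒∣product
              (∈-filter⁺ small? (∈-upTo⁺ (s≤s p≤B)) (pr , p∤u))))) p∤u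
      where
      ∣m+n∣n⇒∣m : ∀ {p m n} → p ∣ m + n → p ∣ n → p ∣ m
      ∣m+n∣n⇒∣m {p} {m} {n} p∣m+n p∣n = ∣m+n∣m⇒∣n (subst (p ∣_) (+-comm m n) p∣m+n) p∣n
    ...   | yes p∣u with euclidsLemma Q t pr (∣m+n∣m⇒∣n p∣ p∣u)
    ...     | inj₁ p∣Q = contradiction (subst Prime (u⊥Q (p∣u , p∣Q)) pr) λ pr1 → prime∤1 pr1 ∣-refl
    ...     | inj₂ p∣t = contradiction p∣u (proj₂ (proj₂ (∈-filter⁻ small?
                {xs = upTo (suc B)} (factorisationHasAllPrimeFactors pr p∣t primes))))

  primorial-suc : ∀ N → primorial (suc N) ≡ primorial N * product (filter prime? (suc N ∷ []))
  primorial-suc N = begin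
    product (filter prime? (upTo (suc (suc N))))
      ≡⟨ cong (product ∘ filter prime?) (upTo-∷ʳ (suc N)) ⟨
    product (filter prime? (upTo (suc N) ++ suc N ∷ []))
      ≡⟨ cong product (filter-++ prime? (upTo (suc N)) (suc N ∷ [])) ⟩
    product (filter prime? (upTo (suc N)) ++ filter prime? (suc N ∷ []))
      ≡⟨ product-++ (filter prime? (upTo (suc N))) _ ⟩
    primorial N * product (filter prime? (suc N ∷ [])) ∎
    where open ≡-Reasoning

  -- Induction on `N`: when `suc N` is a prime dividing `Q`, it does so exactly once, so the
  -- cofactor has only primes up to `N`, while the primorial gains this same factor.
  squarefree-∣-primorial : ∀ N Q → 0 < Q → (∀ p → Prime p → p ∣ Q → p ≤ N) →
    (∀ p → Prime p → ¬ p * p ∣ Q) → Q ∣ primorial N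
  squarefree-∣-primorial zero (suc zero) _ _ _ = 1∣ _
  squarefree-∣-primorial zero Q@(suc (suc _)) _ small _
    with p , pr , p∣Q ← ∃-primeDivisor Q (s≤s (s≤s z≤n)) =
    contradiction (small p pr p∣Q) (<⇒≱ (<-trans z<s (prime>1 pr)))
  squarefree-∣-primorial (suc N) Q 0<Q small sqfree
    rewrite primorial-suc N with prime? (suc N)
  ... | no ¬pr = ∣m⇒∣m*n 1 (squarefree-∣-primorial N Q 0<Q small′ sqfree)
    where
    small′ : ∀ p → Prime p → p ∣ Q → p ≤ N
    small′ p pr p∣Q = s≤s⁻¹ (≤∧≢⇒< (small p pr p∣Q) λ where refl → ¬pr pr)
  ... | yes pr with suc N ∣? Q
  ...   | no ∤Q = ∣m⇒∣m*n (suc N * 1) (squarefree-∣-primorial N Q 0<Q small′ sqfree)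
    where
    small′ : ∀ p → Prime p → p ∣ Q → p ≤ N
    small′ p pr p∣Q = s≤s⁻¹ (≤∧≢⇒< (small p pr p∣Q) λ where refl → ∤Q p∣Q)
  ...   | yes (divides Q₁ refl) = *-pres-∣ (squarefree-∣-primorial N Q₁ 0<Q₁ small′ sqfree′)
            (∣-reflexive (sym (*-identityʳ (suc N))))
    where
    0<Q₁ : 0 < Q₁
    0<Q₁ = n≢0⇒n>0 λ where refl → <-irrefl refl 0<Q
    small′ : ∀ p → Prime p → p ∣ Q₁ → p ≤ N
    small′ p pr p∣Q₁ = s≤s⁻¹ (≤∧≢⇒< (small p pr (∣m⇒∣m*n (suc N) p∣Q₁))
      λ where refl → sqfree (suc N) pr (*-pres-∣ p∣Q₁ ∣-refl))
    sqfree′ : ∀ p → Prime p → ¬ p * p ∣ Q₁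
    sqfree′ p pr pp∣ = sqfree p pr (∣m⇒∣m*n (suc N) pp∣)

  -- A residue modulo `g * p` has two digits, `s % p` and `s / p` modulo `g`. The modulus in Mann's
  -- theorem is assembled from primes in this way.
  %-*-split : ∀ s c g p .{{_ : NonZero g}} .{{_ : NonZero p}} .{{_ : NonZero (g * p)}} →
    s % p ≡ c % p → (s / p) % g ≡ (c / p) % g → s % (g * p) ≡ c % (g * p)
  %-*-split s c g p sp cp = begin
    s % (g * p)                                      ≡⟨ expand s ⟩
    s % p + (s / p) % g * p                          ≡⟨ cong₂ (λ a b → a + b * p) sp cp ⟩
    c % p + (c / p) % g * p                          ≡⟨ expand c ⟨
    c % (g * p)                                      ∎
    where
    open ≡-Reasoning
    expand : ∀ s → s % (g * p) ≡ s % p + (s / p) % g * p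
    expand s = trans (m≡m%n+[m/n]*n (s % (g * p)) p)
      (cong₂ (λ a b → a + b * p) (m∣n⇒o%n%m≡o%m p (g * p) s (n∣m*n g))
          (m%[n*o]/o≡m/o%n s g p {{it}} {{it}} {{m*n≢0 g p}}))

  %-*-projˡ : ∀ s c g p .{{_ : NonZero p}} .{{_ : NonZero (g * p)}} →
    s % (g * p) ≡ c % (g * p) → s % p ≡ c % p
  %-*-projˡ s c g p e = trans (sym (m∣n⇒o%n%m≡o%m p (g * p) s (n∣m*n g)))
    (trans (cong (_% p) e) (m∣n⇒o%n%m≡o%m p (g * p) c (n∣m*n g)))

  %-*-projʳ : ∀ s c g p .{{_ : NonZero g}} .{{_ : NonZero p}} .{{_ : NonZero (g * p)}} →
    s % (g * p) ≡ c % (g * p) → (s / p) % g ≡ (c / p) % g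
  %-*-projʳ s c g p e = trans (sym (m%[n*o]/o≡m/o%n s g p {{it}} {{it}} {{m*n≢0 g p}}))
    (trans (cong (_/ p) e) (m%[n*o]/o≡m/o%n c g p {{it}} {{it}} {{m*n≢0 g p}}))

-- Integer lattices: rational spans, exterior algebra and Hadamard's inequality.

module IntegerLattices where

  open import Algebra.Bundles using (CommutativeRing)
  open import Data.Bool.Base using (Bool; true; false)
  open import Data.Fin.Base using (Fin; zero; suc; punchIn; punchOut)
  open import Data.Fin.Properties using (any?; punchIn-punchOut)
  open import Data.Integer.Base using (ℤ; -[1+_]; 0ℤ; 1ℤ; -1ℤ; _+_; _*_; _-_; -_; _≤_; ∣_∣; +≤+; nonNegative; ≢-nonZero)
    renaming (+_ to pos)
  import Data.Integer.Properties as ℤ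
  open import Data.Integer.Tactic.RingSolver using (solve-∀)
  open import Data.List.Base as List using (List; []; _∷_)
  open import Data.List.Membership.Propositional using (_∈_)
  open import Data.List.Relation.Unary.Any using (here; there)
  open import Data.Nat.Base as ℕ using (ℕ; zero; suc; z≤n; s≤s)
  import Data.Nat.Properties as ℕ
  open import Data.Product.Base using (_×_; _,_; ∃-syntax; Σ-syntax; proj₁; proj₂)
  open import Data.Sum.Base using (_⊎_; inj₁; inj₂)
  open import Data.Vec.Base using (Vec; []; _∷_; replicate)
  open import Data.Vec.Functional using (insertAt; removeAt)
  open import Data.Vec.Functional.Properties using (insertAt-lookup; insertAt-punchIn)
  open import Function.Base using (_∘_)
  open import Relation.Binary.PropositionalEquality
  open import Relation.Nullary using (¬_; yes; no; contradiction)
  open import Relation.Nullary.Decidable using (decidable-stable; ¬?)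

  open import Algebra.Properties.Semiring.Sum (CommutativeRing.semiring ℤ.+-*-commutativeRing)
    public
    using (sum; *-distribˡ-sum; ∑-distrib-+; ∑-comm; sum-cong-≗; sum-remove)

  open ≡-Reasoning

  sum-0 : ∀ {n} (f : Fin n → ℤ) → (∀ i → f i ≡ 0ℤ) → sum f ≡ 0ℤ
  sum-0 {zero}  f f≡0 = refl
  sum-0 {suc n} f f≡0 = cong₂ _+_ (f≡0 zero) (sum-0 (f ∘ suc) (f≡0 ∘ suc))

  sum-at : ∀ {n} (f : Fin n → ℤ) l → (∀ i → i ≢ l → f i ≡ 0ℤ) → sum f ≡ f l
  sum-at {suc n} f zero f≡0 =
    trans (cong (f zero +_) (sum-0 (f ∘ suc) λ i → f≡0 (suc i) λ ())) (ℤ.+-identityʳ _)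
  sum-at {suc n} f (suc l) f≡0 = trans (cong₂ _+_ (f≡0 zero λ ())
    (sum-at (f ∘ suc) l λ i i≢l → f≡0 (suc i) λ where refl → i≢l refl)) (ℤ.+-identityˡ _)

  *-cancel-0 : ∀ {a b} → a ≢ 0ℤ → a * b ≡ 0ℤ → b ≡ 0ℤ
  *-cancel-0 {a} a≢0 ab≡0 with ℤ.i*j≡0⇒i≡0∨j≡0 a ab≡0
  ... | inj₁ a≡0 = contradiction a≡0 a≢0
  ... | inj₂ b≡0 = b≡0

  *-≢0 : ∀ {a b} → a ≢ 0ℤ → b ≢ 0ℤ → a * b ≢ 0ℤ
  *-≢0 a≢0 b≢0 ab≡0 = b≢0 (*-cancel-0 a≢0 ab≡0)

  Vecᶻ : ℕ → Set
  Vecᶻ n = Fin n → ℤ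

  dot : ∀ {n} → Vecᶻ n → Vecᶻ n → ℤ
  dot u v = sum λ i → u i * v i

  comb : ∀ {s n} → (Fin s → ℤ) → (Fin s → Vecᶻ n) → Vecᶻ n
  comb c μ i = sum λ l → c l * μ l i

  dot-comm : ∀ {n} (u v : Vecᶻ n) → dot u v ≡ dot v u
  dot-comm u v = sum-cong-≗ λ i → ℤ.*-comm (u i) (v i)

  dot-congʳ : ∀ {n} (u : Vecᶻ n) {v w : Vecᶻ n} → (∀ i → v i ≡ w i) → dot u v ≡ dot u w
  dot-congʳ u v≡w = sum-cong-≗ λ i → cong (u i *_) (v≡w i)

  dot-comb : ∀ {s n} (u : Vecᶻ n) (c : Fin s → ℤ) (μ : Fin s → Vecᶻ n) →
             dot u (comb c μ) ≡ sum λ l → c l * dot u (μ l)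
  dot-comb u c μ = begin
    sum (λ i → u i * sum (λ l → c l * μ l i))
      ≡⟨ sum-cong-≗ (λ i → *-distribˡ-sum (u i) (λ l → c l * μ l i)) ⟩
    sum (λ i → sum (λ l → u i * (c l * μ l i)))
      ≡⟨ ∑-comm (λ i l → u i * (c l * μ l i)) ⟩
    sum (λ l → sum (λ i → u i * (c l * μ l i)))
      ≡⟨ sum-cong-≗ (λ l → sum-cong-≗ (λ i → swap (u i) (c l) (μ l i))) ⟩
    sum (λ l → sum (λ i → c l * (u i * μ l i)))
      ≡⟨ sum-cong-≗ (λ l → *-distribˡ-sum (c l) (λ i → u i * μ l i)) ⟨
    sum (λ l → c l * dot u (μ l)) ∎
    where
    swap : ∀ a b c → a * (b * c) ≡ b * (a * c)
    swap = solve-∀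

  dot-lin : ∀ {n} (u : Vecᶻ n) a v b w →
            dot u (λ i → a * v i + b * w i) ≡ a * dot u v + b * dot u w
  dot-lin u a v b w = begin
    sum (λ i → u i * (a * v i + b * w i))
      ≡⟨ sum-cong-≗ (λ i → lemma (u i) a (v i) b (w i)) ⟩
    sum (λ i → a * (u i * v i) + b * (u i * w i))
      ≡⟨ ∑-distrib-+ (λ i → a * (u i * v i)) (λ i → b * (u i * w i)) ⟩
    sum (λ i → a * (u i * v i)) + sum (λ i → b * (u i * w i))
      ≡⟨ cong₂ _+_ (*-distribˡ-sum a (λ i → u i * v i)) (*-distribˡ-sum b (λ i → u i * w i)) ⟨
    a * dot u v + b * dot u w ∎
    where
    lemma : ∀ u a v b w → u * (a * v + b * w) ≡ a * (u * v) + b * (u * w)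
    lemma = solve-∀

  dot-* : ∀ {n} (u : Vecᶻ n) a v → dot u (λ i → a * v i) ≡ a * dot u v
  dot-* u a v = trans (sum-cong-≗ λ i → swap (u i) a (v i))
      (sym (*-distribˡ-sum a (λ i → u i * v i)))
    where
    swap : ∀ a b c → a * (b * c) ≡ b * (a * c)
    swap = solve-∀

  dot-linˡ : ∀ {n} a (v : Vecᶻ n) b w u →
             dot (λ i → a * v i + b * w i) u ≡ a * dot v u + b * dot w u
  dot-linˡ a v b w u = trans (dot-comm _ u) (trans (dot-lin u a v b w)
    (cong₂ (λ x y → a * x + b * y) (dot-comm u v) (dot-comm u w)))

  square-nonNeg : ∀ a → 0ℤ ≤ a * a
  square-nonNeg (pos n)    = subst (0ℤ ≤_) (ℤ.pos-* n n) (+≤+ z≤n)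
  square-nonNeg -[1+ n ] = +≤+ z≤n

  sum-nonNeg : ∀ {n} (f : Fin n → ℤ) → (∀ i → 0ℤ ≤ f i) → 0ℤ ≤ sum f
  sum-nonNeg {zero}  f f≥0 = ℤ.≤-refl
  sum-nonNeg {suc n} f f≥0 = ℤ.+-mono-≤ (f≥0 zero) (sum-nonNeg (f ∘ suc) (f≥0 ∘ suc))

  +-nonNeg-0 : ∀ {a b} → 0ℤ ≤ a → 0ℤ ≤ b → a + b ≡ 0ℤ → a ≡ 0ℤ × b ≡ 0ℤ
  +-nonNeg-0 {pos m} {pos n} _ _ e = cong pos (ℕ.m+n≡0⇒m≡0 m (ℤ.+-injective e)) ,
                                 cong pos (ℕ.m+n≡0⇒n≡0 m (ℤ.+-injective e))

  sum-nonNeg-0 : ∀ {n} (f : Fin n → ℤ) → (∀ i → 0ℤ ≤ f i) → sum f ≡ 0ℤ → ∀ i → f i ≡ 0ℤ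
  sum-nonNeg-0 f f≥0 e zero    =
    proj₁ (+-nonNeg-0 (f≥0 zero) (sum-nonNeg (f ∘ suc) (f≥0 ∘ suc)) e)
  sum-nonNeg-0 f f≥0 e (suc j) = sum-nonNeg-0 (f ∘ suc) (f≥0 ∘ suc)
    (proj₂ (+-nonNeg-0 (f≥0 zero) (sum-nonNeg (f ∘ suc) (f≥0 ∘ suc)) e)) j

  square-0 : ∀ {a} → a * a ≡ 0ℤ → a ≡ 0ℤ
  square-0 {a} e with ℤ.i*j≡0⇒i≡0∨j≡0 a e
  ... | inj₁ p = p
  ... | inj₂ p = p

  dot-self-0 : ∀ {n} (v : Vecᶻ n) → dot v v ≡ 0ℤ → ∀ i → v i ≡ 0ℤ
  dot-self-0 v e i = square-0 (sum-nonNeg-0 _ (λ j → square-nonNeg (v j)) e i)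

  -- The denominator `b` stays on the left, so that all linear algebra remains over the integers.
  InRationalSpan : ∀ {s n} → (Fin s → Vecᶻ n) → Vecᶻ n → Set
  InRationalSpan μ x = ∃[ b ] b ≢ 0ℤ × ∃[ c ] (∀ i → b * x i ≡ comb c μ i)

  Separable : ∀ {s n} → (Fin s → Vecᶻ n) → Vecᶻ n → Set
  Separable μ x = ∃[ v ] (∀ l → dot v (μ l) ≡ 0ℤ) × dot v x ≢ 0ℤ

  infixr 5 _◂_

  _◂_ : ∀ {s} {A : Set} → A → (Fin s → A) → Fin (suc s) → A
  (a ◂ f) zero    = a
  (a ◂ f) (suc l) = f l

  kills-span : ∀ {s n} (v : Vecᶻ n) (μ : Fin s → Vecᶻ n) → (∀ l → dot v (μ l) ≡ 0ℤ) →
               ∀ {x} → InRationalSpan μ x → dot v x ≡ 0ℤ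
  kills-span v μ k {x} (b , b≢0 , c , e) = *-cancel-0 b≢0 (begin
    b * dot v x                    ≡⟨ dot-* v b x ⟨
    dot v (λ i → b * x i)          ≡⟨ dot-congʳ v e ⟩
    dot v (comb c μ)               ≡⟨ dot-comb v c μ ⟩
    sum (λ l → c l * dot v (μ l))  ≡⟨ sum-0 _ (λ l → trans (cong (c l *_) (k l))
        (ℤ.*-zeroʳ (c l))) ⟩
    0ℤ                             ∎)

  -- The Fredholm alternative, by orthogonalising against the first vector.
  separate : ∀ {s n} (μ : Fin s → Vecᶻ n) x → InRationalSpan μ x ⊎ Separable μ x
  separate {zero} μ x with dot x x ℤ.≟ 0ℤ
  ... | yes e = inj₁ (1ℤ , (λ ()) , (λ ()) , λ i → trans (ℤ.*-identityˡ _) (dot-self-0 x e i))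
  ... | no ne = inj₂ (x , (λ ()) , ne)
  separate {suc s} μ x with separate (μ ∘ suc) (μ zero)
  ... | inj₁ μ₀∈ with separate (μ ∘ suc) x
  ...   | inj₁ (b , b≢0 , c , e) = inj₁ (b , b≢0 , 0ℤ ◂ c , λ i →
            trans (e i) (sym (ℤ.+-identityˡ _)))
  ...   | inj₂ (v , k , ne) = inj₂ (v , (λ where
            zero    → kills-span v (μ ∘ suc) k μ₀∈
            (suc l) → k l) , ne)
  separate {suc s} μ x | inj₂ (v₀ , k₀ , s≢0) = result
    where
    a t : ℤ
    a = dot v₀ (μ zero)
    t = dot v₀ x
    result : _
    -- The form `v₀` kills all vectors but `μ zero`. The vector `a x - t μ₀` is the projection of
    -- `x` along `μ zero` to the kernel of `v₀`, cleared of denominators.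
    result with separate (μ ∘ suc) (λ i → a * x i + - t * μ zero i)
    ... | inj₁ (b , b≢0 , c , e) = inj₁ (b * a , *-≢0 b≢0 s≢0 , b * t ◂ c , λ i →
            trans (lemma b a (x i) t (μ zero i)) (cong (λ y → b * t * μ zero i + y) (e i)))
      where
      lemma : ∀ b a x t m → b * a * x ≡ b * t * m + b * (a * x + - t * m)
      lemma = solve-∀
    ... | inj₂ (v , k , ne) = inj₂ (w , kills , λ e → ne (trans v-dot (trans (sym (w-dot x)) e)))
      where
      -- Correcting `v` by a multiple of `v₀` makes it kill `μ zero` as well, and its value at `x`
      -- becomes that of `v` at the projected vector.
      w : Vecᶻ _
      w i = a * v i + - dot v (μ zero) * v₀ i
      w-dot : ∀ y → dot w y ≡ a * dot v y + - dot v (μ zero) * dot v₀ y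
      w-dot y = dot-linˡ a v (- dot v (μ zero)) v₀ y
      v-dot : dot v (λ i → a * x i + - t * μ zero i) ≡ a * dot v x + - dot v (μ zero) * t
      v-dot = trans (dot-lin v a x (- t) (μ zero)) (lemma a (dot v x) t (dot v (μ zero)))
        where
        lemma : ∀ a d t m → a * d + - t * m ≡ a * d + - m * t
        lemma = solve-∀
      kills : ∀ l → dot w (μ l) ≡ 0ℤ
      kills zero    = trans (w-dot (μ zero)) (lemma a (dot v (μ zero)))
        where
        lemma : ∀ a m → a * m + - m * a ≡ 0ℤ
        lemma = solve-∀
      kills (suc l) = trans (w-dot (μ (suc l)))
        (trans (cong₂ (λ p q → a * p + - dot v (μ zero) * q) (k l) (k₀ l))
          (lemma a (dot v (μ zero))))
        where
        lemma : ∀ a m → a * 0ℤ + - m * 0ℤ ≡ 0ℤ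
        lemma = solve-∀

  Dependence : ∀ {s n} → (Fin s → Vecᶻ n) → Set
  Dependence μ = ∃[ c ] (∃[ l ] c l ≢ 0ℤ) × (∀ i → comb c μ i ≡ 0ℤ)

  -- Gaussian elimination without division: a vector `μ p` with nonzero head serves as pivot, every
  -- other vector is multiplied by that head and cleared of its own. A dependence of the shortened
  -- vectors lifts by solving for the coefficient of the pivot.
  ∃-dependence : ∀ {n m} → n ℕ.< m → (μ : Fin m → Vecᶻ n) → Dependence μ
  ∃-dependence {zero}  {suc m} _ μ = (λ _ → 1ℤ) , (zero , λ ()) , λ ()
  ∃-dependence {suc n} {suc m} (s≤s n<m) μ with any? (λ l → ¬? (μ l zero ℤ.≟ 0ℤ))
  ... | no none with c , (l , cl≢0) , e ← ∃-dependence n<m (λ l i → μ (suc l) (suc i)) =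
    0ℤ ◂ c , (suc l , cl≢0) , λ where
      zero    → sum-0 _ λ l′ → trans (cong ((0ℤ ◂ c) l′ *_) (head≡0 l′)) (ℤ.*-zeroʳ ((0ℤ ◂ c) l′))
      (suc i) → trans (ℤ.+-identityˡ _) (e i)
    where
    head≡0 : ∀ l → μ l zero ≡ 0ℤ
    head≡0 l = decidable-stable (μ l zero ℤ.≟ 0ℤ) λ ne → none (l , ne)
  ... | yes (p , a≢0)
    with c , (l , cl≢0) , e ← ∃-dependence n<m
      (λ l i → μ p zero * μ (punchIn p l) (suc i) + - μ (punchIn p l) zero * μ p (suc i)) =
    c′ , (punchIn p l , λ e → *-≢0 a≢0 cl≢0 (trans (sym (insertAt-punchIn _ p _ l)) e)) , dep
    where
    a : ℤ
    a = μ p zero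
    ν : Fin m → Vecᶻ (suc n)
    ν = removeAt μ p
    c′ : Fin (suc m) → ℤ
    c′ = insertAt (λ l → a * c l) p (- sum (λ l → c l * ν l zero))
    expand : ∀ i → comb c′ μ i ≡ sum (λ l → c l * (a * ν l i + - ν l zero * μ p i))
    expand i = begin
      comb c′ μ i
        ≡⟨ sum-remove {i = p} (λ l → c′ l * μ l i) ⟩
      c′ p * μ p i + sum (λ l → c′ (punchIn p l) * ν l i)
        ≡⟨ cong₂ _+_ (cong (_* μ p i) (insertAt-lookup _ p _))
             (sum-cong-≗ λ l → cong (_* ν l i) (insertAt-punchIn _ p _ l)) ⟩
      - sum (λ l → c l * ν l zero) * μ p i + sum (λ l → a * c l * ν l i)
        ≡⟨ cong (_+ sum (λ l → a * c l * ν l i))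
             (trans (flip (sum (λ l → c l * ν l zero)) (μ p i))
                 (*-distribˡ-sum (- μ p i) (λ l → c l * ν l zero))) ⟩
      sum (λ l → - μ p i * (c l * ν l zero)) + sum (λ l → a * c l * ν l i)
        ≡⟨ ∑-distrib-+ (λ l → - μ p i * (c l * ν l zero)) (λ l → a * c l * ν l i) ⟨
      sum (λ l → - μ p i * (c l * ν l zero) + a * c l * ν l i)
        ≡⟨ sum-cong-≗ (λ l → regroup (μ p i) (c l) (ν l zero) a (ν l i)) ⟩
      sum (λ l → c l * (a * ν l i + - ν l zero * μ p i)) ∎
      where
      flip : ∀ s m → - s * m ≡ - m * s
      flip = solve-∀
      regroup : ∀ m c z a y → - m * (c * z) + a * c * y ≡ c * (a * y + - z * m)
      regroup = solve-∀
    dep : ∀ i → comb c′ μ i ≡ 0ℤ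
    dep zero    = trans (expand zero) (sum-0 _ λ l → cancel (c l) a (ν l zero))
      where
      cancel : ∀ c a z → c * (a * z + - z * a) ≡ 0ℤ
      cancel = solve-∀
    dep (suc i) = trans (expand (suc i)) (e i)

  -- A kernel vector is a dependence among the `n` columns of `E`, which have only `r` entries each.
  ∃-kernel : ∀ {r n} → r ℕ.< n → (E : Fin r → Vecᶻ n) →
             ∃[ x ] (∀ j → dot (E j) x ≡ 0ℤ) × ∃[ i ] x i ≢ 0ℤ
  ∃-kernel r<n E with c , nz , e ← ∃-dependence r<n (λ i j → E j i) =
    c , (λ j → trans (dot-comm (E j) c) (e j)) , nz

  -- The spans of `E` and `μ` are orthogonal and the dot product is definite, so the stacked family
  -- of `r + s` vectors is independent: in a relation `u + w = 0` with parts in the two spans,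
  -- `w · w = - w · u = 0`.
  independent-kernel-bound : ∀ {r s n} (E : Fin r → Vecᶻ n) (μ : Fin s → Vecᶻ n) →
    HasFullRowRank E → HasFullRowRank μ → (∀ l j → dot (E j) (μ l) ≡ 0ℤ) → s ℕ.≤ n ℕ.∸ r
  independent-kernel-bound {r} {s} {n} E μ rankE rankμ E⊥μ with s ℕ.≤? n ℕ.∸ r
  ... | yes s≤ = s≤
  ... | no  s≰ = contradiction (∃-dependence n<r+s stacked) λ (c , (l , cl≢0) , e) →
      cl≢0 (independent c e l)
    where
    open import Data.Fin.Base using (_↑ˡ_; _↑ʳ_)
    n<r+s : n ℕ.< r ℕ.+ s
    n<r+s = ℕ.≤-<-trans (ℕ.m≤n+m∸n n r) (ℕ.+-monoʳ-< r (ℕ.≰⇒> s≰))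

    append : ∀ {r} {A : Set} → (Fin r → A) → (Fin s → A) → Fin (r ℕ.+ s) → A
    append {zero}  f g i       = g i
    append {suc r} f g zero    = f zero
    append {suc r} f g (suc i) = append (f ∘ suc) g i

    stacked : Fin (r ℕ.+ s) → Vecᶻ n
    stacked = append E μ

    sum-append : ∀ {r} (c : Fin (r ℕ.+ s) → ℤ) (F : Fin r → Vecᶻ n) i →
      sum (λ l → c l * append F μ l i) ≡
      sum (λ l → c (l ↑ˡ s) * F l i) + sum (λ l → c (r ↑ʳ l) * μ l i)
    sum-append {zero}  c F i = sym (ℤ.+-identityˡ _)
    sum-append {suc r} c F i =
      trans (cong (c zero * F zero i +_) (sum-append (c ∘ suc) (F ∘ suc) i))
        (sym (ℤ.+-assoc (c zero * F zero i) _ _))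

    on-blocks : ∀ {r} (c : Fin (r ℕ.+ s) → ℤ) → (∀ l → c (l ↑ˡ s) ≡ 0ℤ) →
                (∀ l → c (r ↑ʳ l) ≡ 0ℤ) → ∀ l → c l ≡ 0ℤ
    on-blocks {zero}  c p q l       = q l
    on-blocks {suc r} c p q zero    = p zero
    on-blocks {suc r} c p q (suc l) = on-blocks (c ∘ suc) (p ∘ suc) q l

    independent : ∀ c → (∀ i → comb c stacked i ≡ 0ℤ) → ∀ l → c l ≡ 0ℤ
    independent c e = on-blocks c (rankE cᴱ u≡0) (rankμ cᵘ w≡0)
      where
      cᴱ = λ l → c (l ↑ˡ s)
      cᵘ = λ l → c (r ↑ʳ l)
      u w : Vecᶻ n
      u = comb cᴱ E
      w = comb cᵘ μ
      u+w : ∀ i → u i + w i ≡ 0ℤ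
      u+w i = trans (sym (sum-append c E i)) (e i)
      w⊥u : dot w u ≡ 0ℤ
      w⊥u = trans (dot-comb w cᴱ E) (sum-0 _ λ j → trans (cong (cᴱ j *_)
        (trans (dot-comm w (E j)) (trans (dot-comb (E j) cᵘ μ)
          (sum-0 _ λ l → trans (cong (cᵘ l *_) (E⊥μ l j)) (ℤ.*-zeroʳ (cᵘ l))))))
        (ℤ.*-zeroʳ (cᴱ j)))
      w≡-u : ∀ i → w i ≡ - u i
      w≡-u i = trans (sym (lemma (u i) (w i))) (trans (cong (_+ - u i) (u+w i)) (ℤ.+-identityˡ _))
        where
        lemma : ∀ u w → (u + w) + - u ≡ w
        lemma = solve-∀
      w≡0 : ∀ i → w i ≡ 0ℤ
      w≡0 = dot-self-0 w (begin
        dot w w                  ≡⟨ dot-congʳ w (λ i → trans (w≡-u i) (sym (ℤ.-1*i≡-i (u i)))) ⟩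
        dot w (λ i → -1ℤ * u i)  ≡⟨ dot-* w -1ℤ u ⟩
        -1ℤ * dot w u            ≡⟨ cong (-1ℤ *_) w⊥u ⟩
        0ℤ                       ∎)
      u≡0 : ∀ i → u i ≡ 0ℤ
      u≡0 i = trans (sym (ℤ.+-identityʳ (u i))) (trans (cong (u i +_) (sym (w≡0 i))) (u+w i))

  -- The exterior algebra of ℤⁿ, with S : Vec Bool n standing for the product of
  -- the basis vectors selected by S.
  Ext : ℕ → Set
  Ext n = Vec Bool n → ℤ

  -- Left exterior multiplication by `v`. On a set containing the first basis vector, the rest of
  -- `v` has to pass that vector, whence the minus sign.
  wedge : ∀ {n} → Vecᶻ n → Ext n → Ext n
  wedge v y []          = 0ℤ
  wedge v y (false ∷ S) = wedge (v ∘ suc) (y ∘ (false ∷_)) S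
  wedge v y (true ∷ S)  = v zero * y (false ∷ S) - wedge (v ∘ suc) (y ∘ (true ∷_)) S

  -- The interior product with the linear form `f`, an antiderivation lowering the degree by one.
  contract : ∀ {n} → Vecᶻ n → Ext n → Ext n
  contract f y []          = 0ℤ
  contract f y (false ∷ S) = contract (f ∘ suc) (y ∘ (false ∷_)) S + f zero * y (true ∷ S)
  contract f y (true ∷ S)  = - contract (f ∘ suc) (y ∘ (true ∷_)) S

  wedge-cong : ∀ {n} (v : Vecᶻ n) {y z} → y ≗ z → wedge v y ≗ wedge v z
  wedge-cong v y≗z []          = refl
  wedge-cong v y≗z (false ∷ S) = wedge-cong (v ∘ suc) (y≗z ∘ (false ∷_)) S
  wedge-cong v y≗z (true ∷ S)  =
    cong₂ (λ p q → v zero * p - q) (y≗z (false ∷ S)) (wedge-cong (v ∘ suc) (y≗z ∘ (true ∷_)) S)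

  wedge-lin : ∀ {n} (v : Vecᶻ n) a y b z S →
              wedge v (λ S → a * y S + b * z S) S ≡ a * wedge v y S + b * wedge v z S
  wedge-lin v a y b z []          = lemma a b
    where
    lemma : ∀ a b → 0ℤ ≡ a * 0ℤ + b * 0ℤ
    lemma = solve-∀
  wedge-lin v a y b z (false ∷ S) = wedge-lin (v ∘ suc) a (y ∘ (false ∷_)) b (z ∘ (false ∷_)) S
  wedge-lin v a y b z (true ∷ S)  =
    trans (cong (λ w → v zero * (a * y (false ∷ S) + b * z (false ∷ S)) - w)
                (wedge-lin (v ∘ suc) a (y ∘ (true ∷_)) b (z ∘ (true ∷_)) S))
          (lemma (v zero) a (y (false ∷ S)) b (z (false ∷ S)) _ _)
    where
    lemma : ∀ v a y b z p q →
            v * (a * y + b * z) - (a * p + b * q) ≡ a * (v * y - p) + b * (v * z - q)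
    lemma = solve-∀

  wedge-sub : ∀ {n} (v : Vecᶻ n) a y z S →
              wedge v (λ S → a * y S - z S) S ≡ a * wedge v y S - wedge v z S
  wedge-sub v a y z S = trans (wedge-cong v (λ S → lemma (a * y S) (z S)) S)
    (trans (wedge-lin v a y -1ℤ z S) (sym (lemma (a * wedge v y S) (wedge v z S))))
    where
    lemma : ∀ y z → y - z ≡ y + -1ℤ * z
    lemma = solve-∀

  wedge-* : ∀ {n} (v : Vecᶻ n) a y S → wedge v (λ S → a * y S) S ≡ a * wedge v y S
  wedge-* v a y S = trans (wedge-cong v (λ S → lemma (a * y S) (y S)) S)
    (trans (wedge-lin v a y 0ℤ y S) (sym (lemma (a * wedge v y S) (wedge v y S))))
    where
    lemma : ∀ y z → y ≡ y + 0ℤ * z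
    lemma = solve-∀

  wedge-0 : ∀ {n} (v : Vecᶻ n) {y} → (∀ S → y S ≡ 0ℤ) → ∀ S → wedge v y S ≡ 0ℤ
  wedge-0 v {y} y≡0 S = trans (wedge-cong v (λ S → y≡0 S) S) (wedge-* v 0ℤ (λ _ → 0ℤ) S)

  wedge-linˡ : ∀ {n} a (u : Vecᶻ n) b v y S →
               wedge (λ i → a * u i + b * v i) y S ≡ a * wedge u y S + b * wedge v y S
  wedge-linˡ a u b v y []          = lemma a b
    where
    lemma : ∀ a b → 0ℤ ≡ a * 0ℤ + b * 0ℤ
    lemma = solve-∀
  wedge-linˡ a u b v y (false ∷ S) = wedge-linˡ a (u ∘ suc) b (v ∘ suc) (y ∘ (false ∷_)) S
  wedge-linˡ a u b v y (true ∷ S)  =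
    trans (cong (λ w → (a * u zero + b * v zero) * y (false ∷ S) - w)
                (wedge-linˡ a (u ∘ suc) b (v ∘ suc) (y ∘ (true ∷_)) S))
          (lemma a (u zero) b (v zero) (y (false ∷ S)) _ _)
    where
    lemma : ∀ a u b v y p q →
            (a * u + b * v) * y - (a * p + b * q) ≡ a * (u * y - p) + b * (v * y - q)
    lemma = solve-∀

  wedge-congˡ : ∀ {n} {u v : Vecᶻ n} → (∀ i → u i ≡ v i) → ∀ y S → wedge u y S ≡ wedge v y S
  wedge-congˡ u≡v y []          = refl
  wedge-congˡ u≡v y (false ∷ S) = wedge-congˡ (u≡v ∘ suc) (y ∘ (false ∷_)) S
  wedge-congˡ u≡v y (true ∷ S)  =
    cong₂ (λ p q → p * y (false ∷ S) - q) (u≡v zero) (wedge-congˡ (u≡v ∘ suc) (y ∘ (true ∷_)) S)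

  wedge-*ˡ : ∀ {n} a (u : Vecᶻ n) y S → wedge (λ i → a * u i) y S ≡ a * wedge u y S
  wedge-*ˡ a u y S = trans (wedge-congˡ (λ i → lemma (a * u i) (u i)) y S)
    (trans (wedge-linˡ a u 0ℤ u y S) (sym (lemma (a * wedge u y S) (wedge u y S))))
    where
    lemma : ∀ y z → y ≡ y + 0ℤ * z
    lemma = solve-∀

  wedge-comb : ∀ {s n} (c : Fin s → ℤ) (μ : Fin s → Vecᶻ n) y S →
               wedge (comb c μ) y S ≡ sum λ l → c l * wedge (μ l) y S
  wedge-comb {zero} c μ y S = wedge-*ˡ 0ℤ (λ _ → 0ℤ) y S
  wedge-comb {suc s} c μ y S =
    trans (wedge-congˡ (λ i → cong (c zero * μ zero i +_) (sym (ℤ.*-identityˡ _))) y S)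
    (trans (wedge-linˡ (c zero) (μ zero) 1ℤ (comb (c ∘ suc) (μ ∘ suc)) y S)
    (cong (c zero * wedge (μ zero) y S +_)
      (trans (ℤ.*-identityˡ _) (wedge-comb (c ∘ suc) (μ ∘ suc) y S))))

  wedge-anticomm : ∀ {n} (u v : Vecᶻ n) y S → wedge u (wedge v y) S ≡ - wedge v (wedge u y) S
  wedge-anticomm u v y []          = refl
  wedge-anticomm u v y (false ∷ S) = wedge-anticomm (u ∘ suc) (v ∘ suc) (y ∘ (false ∷_)) S
  wedge-anticomm u v y (true ∷ S)  = begin
    u₀ * V - wedge u′ (λ S → v₀ * yᶠ S - wedge v′ yᵗ S) S
      ≡⟨ cong (λ w → u₀ * V - w) (wedge-sub u′ v₀ yᶠ (wedge v′ yᵗ) S) ⟩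
    u₀ * V - (v₀ * U - wedge u′ (wedge v′ yᵗ) S)
      ≡⟨ cong (λ w → u₀ * V - (v₀ * U - w)) (wedge-anticomm u′ v′ yᵗ S) ⟩
    u₀ * V - (v₀ * U - - wedge v′ (wedge u′ yᵗ) S)
      ≡⟨ lemma u₀ V v₀ U _ ⟩
    - (v₀ * U - (u₀ * V - wedge v′ (wedge u′ yᵗ) S))
      ≡⟨ cong (λ w → - (v₀ * U - w)) (wedge-sub v′ u₀ yᶠ (wedge u′ yᵗ) S) ⟨
    - (v₀ * U - wedge v′ (λ S → u₀ * yᶠ S - wedge u′ yᵗ S) S) ∎
    where
    u₀ = u zero
    v₀ = v zero
    u′ = u ∘ suc
    v′ = v ∘ suc
    yᶠ = y ∘ (false ∷_)
    yᵗ = y ∘ (true ∷_)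
    U = wedge u′ yᶠ S
    V = wedge v′ yᶠ S
    lemma : ∀ u V v U w → u * V - (v * U - - w) ≡ - (v * U - (u * V - w))
    lemma = solve-∀

  wedge-self : ∀ {n} (v : Vecᶻ n) y S → wedge v (wedge v y) S ≡ 0ℤ
  wedge-self v y S = halve (wedge-anticomm v v y S)
    where
    halve : ∀ {a} → a ≡ - a → a ≡ 0ℤ
    halve {pos zero} _ = refl

  contract-0 : ∀ {n} (f : Vecᶻ n) {y} → (∀ S → y S ≡ 0ℤ) → ∀ S → contract f y S ≡ 0ℤ
  contract-0 f y≡0 []          = refl
  contract-0 f y≡0 (false ∷ S) =
    cong₂ _+_ (contract-0 (f ∘ suc) (y≡0 ∘ (false ∷_)) S)
      (trans (cong (f zero *_) (y≡0 (true ∷ S))) (ℤ.*-zeroʳ (f zero)))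
  contract-0 f y≡0 (true ∷ S)  = cong -_ (contract-0 (f ∘ suc) (y≡0 ∘ (true ∷_)) S)

  contract-sub : ∀ {n} (f : Vecᶻ n) a y z S →
                 contract f (λ S → a * y S - z S) S ≡ a * contract f y S - contract f z S
  contract-sub f a y z []          = lemma a
    where
    lemma : ∀ a → 0ℤ ≡ a * 0ℤ - 0ℤ
    lemma = solve-∀
  contract-sub f a y z (false ∷ S) =
    trans (cong (_+ f zero * (a * y (true ∷ S) - z (true ∷ S)))
                (contract-sub (f ∘ suc) a (y ∘ (false ∷_)) (z ∘ (false ∷_)) S))
          (lemma (f zero) a (y (true ∷ S)) (z (true ∷ S)) _ _)
    where
    lemma : ∀ f a y z p q → (a * p - q) + f * (a * y - z) ≡ a * (p + f * y) - (q + f * z)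
    lemma = solve-∀
  contract-sub f a y z (true ∷ S)  =
    trans (cong -_ (contract-sub (f ∘ suc) a (y ∘ (true ∷_)) (z ∘ (true ∷_)) S)) (lemma a _ _)
    where
    lemma : ∀ a p q → - (a * p - q) ≡ a * - p - - q
    lemma = solve-∀

  -- The Leibniz rule of the antiderivation `contract f`. Both Hadamard's inequality and the
  -- nonvanishing of `wedges` on independent families rest on it.
  contract-wedge : ∀ {n} (f v : Vecᶻ n) y S →
                   contract f (wedge v y) S ≡ dot f v * y S - wedge v (contract f y) S
  contract-wedge f v y []          = sym (lemma (y []))
    where
    lemma : ∀ y → 0ℤ * y - 0ℤ ≡ 0ℤ
    lemma = solve-∀
  contract-wedge f v y (false ∷ S) = begin
    contract f′ (wedge v′ yᶠ) S + f₀ * (v₀ * yᶠ S - wedge v′ yᵗ S)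
      ≡⟨ cong (_+ f₀ * (v₀ * yᶠ S - wedge v′ yᵗ S)) (contract-wedge f′ v′ yᶠ S) ⟩
    (dot f′ v′ * yᶠ S - wedge v′ (contract f′ yᶠ) S) + f₀ * (v₀ * yᶠ S - wedge v′ yᵗ S)
      ≡⟨ lemma (dot f′ v′) (yᶠ S) _ f₀ v₀ _ ⟩
    (f₀ * v₀ + dot f′ v′) * yᶠ S - (1ℤ * wedge v′ (contract f′ yᶠ) S + f₀ * wedge v′ yᵗ S)
      ≡⟨ cong (λ w → (f₀ * v₀ + dot f′ v′) * yᶠ S - w) (wedge-lin v′ 1ℤ (contract f′ yᶠ) f₀ yᵗ S) ⟨
    (f₀ * v₀ + dot f′ v′) * yᶠ S - wedge v′ (λ S → 1ℤ * contract f′ yᶠ S + f₀ * yᵗ S) S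
      ≡⟨ cong (λ w → (f₀ * v₀ + dot f′ v′) * yᶠ S - w)
           (wedge-cong v′ (λ S → cong (_+ f₀ * yᵗ S) (ℤ.*-identityˡ (contract f′ yᶠ S))) S) ⟩
    (f₀ * v₀ + dot f′ v′) * yᶠ S - wedge v′ (λ S → contract f′ yᶠ S + f₀ * yᵗ S) S ∎
    where
    f₀ = f zero
    v₀ = v zero
    f′ = f ∘ suc
    v′ = v ∘ suc
    yᶠ = y ∘ (false ∷_)
    yᵗ = y ∘ (true ∷_)
    lemma : ∀ d y w f v p → (d * y - w) + f * (v * y - p) ≡ (f * v + d) * y - (1ℤ * w + f * p)
    lemma = solve-∀
  contract-wedge f v y (true ∷ S)  = begin
    - contract f′ (λ S → v₀ * yᶠ S - wedge v′ yᵗ S) S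
      ≡⟨ cong -_ (contract-sub f′ v₀ yᶠ (wedge v′ yᵗ) S) ⟩
    - (v₀ * contract f′ yᶠ S - contract f′ (wedge v′ yᵗ) S)
      ≡⟨ cong (λ w → - (v₀ * contract f′ yᶠ S - w)) (contract-wedge f′ v′ yᵗ S) ⟩
    - (v₀ * contract f′ yᶠ S - (dot f′ v′ * yᵗ S - wedge v′ (contract f′ yᵗ) S))
      ≡⟨ lemma v₀ (contract f′ yᶠ S) (dot f′ v′) (yᵗ S) _ f₀ ⟩
    (f₀ * v₀ + dot f′ v′) * yᵗ S -
      (v₀ * (contract f′ yᶠ S + f₀ * yᵗ S) - -1ℤ * wedge v′ (contract f′ yᵗ) S)
      ≡⟨ cong (λ w → (f₀ * v₀ + dot f′ v′) * yᵗ S - (v₀ * (contract f′ yᶠ S + f₀ * yᵗ S) - w))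
           (trans (sym (wedge-* v′ -1ℤ (contract f′ yᵗ) S))
                  (wedge-cong v′ (λ S → ℤ.-1*i≡-i (contract f′ yᵗ S)) S)) ⟩
    (f₀ * v₀ + dot f′ v′) * yᵗ S -
      (v₀ * (contract f′ yᶠ S + f₀ * yᵗ S) - wedge v′ (λ S → - contract f′ yᵗ S) S) ∎
    where
    f₀ = f zero
    v₀ = v zero
    f′ = f ∘ suc
    v′ = v ∘ suc
    yᶠ = y ∘ (false ∷_)
    yᵗ = y ∘ (true ∷_)
    lemma : ∀ v c d y w f → - (v * c - (d * y - w)) ≡ (f * v + d) * y - (v * (c + f * y) - -1ℤ * w)
    lemma = solve-∀

  inner : ∀ {n} → Ext n → Ext n → ℤ
  inner {zero}  y z = y [] * z []
  inner {suc n} y z = inner (y ∘ (false ∷_)) (z ∘ (false ∷_)) + inner (y ∘ (true ∷_))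
      (z ∘ (true ∷_))

  inner-comm : ∀ {n} (y z : Ext n) → inner y z ≡ inner z y
  inner-comm {zero}  y z = ℤ.*-comm (y []) (z [])
  inner-comm {suc n} y z = cong₂ _+_ (inner-comm (y ∘ (false ∷_)) _) (inner-comm (y ∘ (true ∷_)) _)

  inner-congˡ : ∀ {n} {y y′ : Ext n} → y ≗ y′ → ∀ z → inner y z ≡ inner y′ z
  inner-congˡ {zero}  e z = cong (_* z []) (e [])
  inner-congˡ {suc n} e z =
    cong₂ _+_ (inner-congˡ (e ∘ (false ∷_)) _) (inner-congˡ (e ∘ (true ∷_)) _)

  inner-lin : ∀ {n} a (x : Ext n) b y z →
              inner (λ S → a * x S + b * y S) z ≡ a * inner x z + b * inner y z
  inner-lin {zero} a x b y z = lemma a (x []) b (y []) (z [])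
    where
    lemma : ∀ a x b y z → (a * x + b * y) * z ≡ a * (x * z) + b * (y * z)
    lemma = solve-∀
  inner-lin {suc n} a x b y z =
    trans (cong₂ _+_ (inner-lin a (x ∘ (false ∷_)) b (y ∘ (false ∷_)) (z ∘ (false ∷_)))
                     (inner-lin a (x ∘ (true ∷_)) b (y ∘ (true ∷_)) (z ∘ (true ∷_))))
          (lemma a _ b _ _ _)
    where
    lemma : ∀ a p b q r s → (a * p + b * q) + (a * r + b * s) ≡ a * (p + r) + b * (q + s)
    lemma = solve-∀

  inner-* : ∀ {n} a (x : Ext n) z → inner (λ S → a * x S) z ≡ a * inner x z
  inner-* a x z = trans (inner-congˡ (λ S → lemma (a * x S) (x S)) z)
    (trans (inner-lin a x 0ℤ x z) (sym (lemma (a * inner x z) (inner x z))))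
    where
    lemma : ∀ y z → y ≡ y + 0ℤ * z
    lemma = solve-∀

  inner-self-nonNeg : ∀ {n} (y : Ext n) → 0ℤ ≤ inner y y
  inner-self-nonNeg {zero}  y = square-nonNeg (y [])
  inner-self-nonNeg {suc n} y =
    ℤ.+-mono-≤ (inner-self-nonNeg (y ∘ (false ∷_))) (inner-self-nonNeg (y ∘ (true ∷_)))

  coordinate-≤ : ∀ {n} (y : Ext n) S → y S * y S ≤ inner y y
  coordinate-≤ {zero}  y []          = ℤ.≤-refl
  coordinate-≤ {suc n} y (false ∷ S) = ℤ.≤-trans (coordinate-≤ (y ∘ (false ∷_)) S)
    (subst (_≤ inner y y) (ℤ.+-identityʳ _)
      (ℤ.+-monoʳ-≤ (inner (y ∘ (false ∷_)) _) (inner-self-nonNeg (y ∘ (true ∷_)))))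
  coordinate-≤ {suc n} y (true ∷ S)  = ℤ.≤-trans (coordinate-≤ (y ∘ (true ∷_)) S)
    (subst (_≤ inner y y) (ℤ.+-identityˡ _)
      (ℤ.+-monoˡ-≤ (inner (y ∘ (true ∷_)) _) (inner-self-nonNeg (y ∘ (false ∷_)))))

  -- Removing a basis vector and multiplying by it carry the same sign, and the basis products are
  -- orthonormal for `inner`.
  adjoint : ∀ {n} (f : Vecᶻ n) y z → inner (contract f y) z ≡ inner y (wedge f z)
  adjoint {zero} f y z = sym (ℤ.*-zeroʳ (y []))
  adjoint {suc n} f y z = begin
    inner (λ S → contract f′ yᶠ S + f₀ * yᵗ S) zᶠ + inner (λ S → - contract f′ yᵗ S) zᵗ
      ≡⟨ cong₂ _+_
          (trans (inner-congˡ (λ S → cong (_+ f₀ * yᵗ S) (sym (ℤ.*-identityˡ (contract f′ yᶠ S))))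
              zᶠ)
            (inner-lin 1ℤ (contract f′ yᶠ) f₀ yᵗ zᶠ))
          (trans (inner-congˡ (λ S → sym (ℤ.-1*i≡-i (contract f′ yᵗ S))) zᵗ)
            (inner-* -1ℤ (contract f′ yᵗ) zᵗ)) ⟩
    (1ℤ * inner (contract f′ yᶠ) zᶠ + f₀ * inner yᵗ zᶠ) + -1ℤ * inner (contract f′ yᵗ) zᵗ
      ≡⟨ cong₂ (λ p q → (1ℤ * p + f₀ * inner yᵗ zᶠ) + -1ℤ * q) (adjoint f′ yᶠ zᶠ)
          (adjoint f′ yᵗ zᵗ) ⟩
    (1ℤ * inner yᶠ (wedge f′ zᶠ) + f₀ * inner yᵗ zᶠ) + -1ℤ * inner yᵗ (wedge f′ zᵗ)
      ≡⟨ lemma (inner yᶠ (wedge f′ zᶠ)) f₀ _ _ ⟩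
    inner yᶠ (wedge f′ zᶠ) + (f₀ * inner yᵗ zᶠ + -1ℤ * inner yᵗ (wedge f′ zᵗ))
      ≡⟨ cong (inner yᶠ (wedge f′ zᶠ) +_) (begin
           f₀ * inner yᵗ zᶠ + -1ℤ * inner yᵗ (wedge f′ zᵗ)
             ≡⟨ cong₂ (λ p q → f₀ * p + -1ℤ * q) (inner-comm yᵗ zᶠ) (inner-comm yᵗ _) ⟩
           f₀ * inner zᶠ yᵗ + -1ℤ * inner (wedge f′ zᵗ) yᵗ
             ≡⟨ inner-lin f₀ zᶠ -1ℤ (wedge f′ zᵗ) yᵗ ⟨
           inner (λ S → f₀ * zᶠ S + -1ℤ * wedge f′ zᵗ S) yᵗ
             ≡⟨ inner-congˡ (λ S → cong (f₀ * zᶠ S +_) (ℤ.-1*i≡-i (wedge f′ zᵗ S))) yᵗ ⟩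
           inner (λ S → f₀ * zᶠ S - wedge f′ zᵗ S) yᵗ
             ≡⟨ inner-comm _ yᵗ ⟩
           inner yᵗ (λ S → f₀ * zᶠ S - wedge f′ zᵗ S) ∎) ⟩
    inner yᶠ (wedge f′ zᶠ) + inner yᵗ (λ S → f₀ * zᶠ S - wedge f′ zᵗ S) ∎
    where
    f₀ = f zero
    f′ = f ∘ suc
    yᶠ = y ∘ (false ∷_)
    yᵗ = y ∘ (true ∷_)
    zᶠ = z ∘ (false ∷_)
    zᵗ = z ∘ (true ∷_)
    lemma : ∀ p f q r → (1ℤ * p + f * q) + -1ℤ * r ≡ p + (f * q + -1ℤ * r)
    lemma = solve-∀

  -- |v ∧ y|² + |ι_v y|² = |v|² |y|²
  hadamard-step : ∀ {n} (v : Vecᶻ n) y → inner (wedge v y) (wedge v y) ≤ dot v v * inner y y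
  hadamard-step v y = subst (_≤ dot v v * inner y y) (sym eq)
    (subst (dot v v * inner y y - inner (contract v y) (contract v y) ≤_) (ℤ.+-identityʳ _)
      (ℤ.+-monoʳ-≤ (dot v v * inner y y) (ℤ.neg-mono-≤ (inner-self-nonNeg (contract v y)))))
    where
    eq : inner (wedge v y) (wedge v y) ≡ dot v v * inner y y - inner (contract v y) (contract v y)
    eq = begin
      inner (wedge v y) (wedge v y)
        ≡⟨ adjoint v (wedge v y) y ⟨
      inner (contract v (wedge v y)) y
        ≡⟨ inner-congˡ (λ S → trans (contract-wedge v v y S)
             (cong (dot v v * y S +_) (sym (ℤ.-1*i≡-i _)))) y ⟩
      inner (λ S → dot v v * y S + -1ℤ * wedge v (contract v y) S) y
        ≡⟨ inner-lin (dot v v) y -1ℤ (wedge v (contract v y)) y ⟩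
      dot v v * inner y y + -1ℤ * inner (wedge v (contract v y)) y
        ≡⟨ cong (dot v v * inner y y +_) (trans (ℤ.-1*i≡-i _) (cong -_
             (trans (inner-comm _ y) (sym (adjoint v y (contract v y)))))) ⟩
      dot v v * inner y y - inner (contract v y) (contract v y) ∎

  1ₑ : ∀ {n} → Ext n
  1ₑ []          = 1ℤ
  1ₑ (false ∷ S) = 1ₑ S
  1ₑ (true ∷ S)  = 0ℤ

  -- The coordinates of this product at the sets of size `s` are the maximal minors of `μ`; it takes
  -- the place of determinants.
  wedges : ∀ {s n} → (Fin s → Vecᶻ n) → Ext n
  wedges {zero}  μ = 1ₑ
  wedges {suc s} μ = wedge (μ zero) (wedges (μ ∘ suc))

  inner-1ₑ : ∀ {n} → inner (1ₑ {n}) 1ₑ ≡ 1ℤ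
  inner-1ₑ {zero}  = refl
  inner-1ₑ {suc n} = cong₂ _+_ (inner-1ₑ {n}) (inner-0 n)
    where
    inner-0 : ∀ n → inner {n} (λ _ → 0ℤ) (λ _ → 0ℤ) ≡ 0ℤ
    inner-0 n = inner-* {n} 0ℤ (λ _ → 0ℤ) (λ _ → 0ℤ)

  hadamard : ∀ {s n} (μ : Fin s → Vecᶻ n) K → (∀ l → dot (μ l) (μ l) ≤ pos K) →
             inner (wedges μ) (wedges μ) ≤ pos (K ℕ.^ s)
  hadamard {zero}  {n} μ K _ = ℤ.≤-reflexive (inner-1ₑ {n})
  hadamard {suc s} μ K dot≤K = ℤ.≤-trans (hadamard-step (μ zero) y)
    (ℤ.≤-trans (ℤ.*-monoʳ-≤-nonNeg (inner y y) {{nonNegative (inner-self-nonNeg y)}} (dot≤K zero))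
    (subst (pos K * inner y y ≤_) (sym (ℤ.pos-* K (K ℕ.^ s)))
      (ℤ.*-monoˡ-≤-nonNeg (pos K) (hadamard (μ ∘ suc) K (dot≤K ∘ suc)))))
    where
    y = wedges (μ ∘ suc)

  wedge-member : ∀ {s n} (μ : Fin s → Vecᶻ n) l S → wedge (μ l) (wedges μ) S ≡ 0ℤ
  wedge-member μ zero    S = wedge-self (μ zero) _ S
  wedge-member μ (suc l) S = trans (wedge-anticomm (μ (suc l)) (μ zero) _ S)
    (cong -_ (wedge-0 (μ zero) (wedge-member (μ ∘ suc) l) S))

  -- Moving `μ l` to the front costs one sign for each vector passed. The relation `ε * ε ≡ 1ℤ` is
  -- all that is kept of it, and it suffices to cancel the sign in `cramer`.
  wedge-remove : ∀ {s n} (μ : Fin (suc s) → Vecᶻ n) l → ∃[ ε ] ε * ε ≡ 1ℤ ×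
                 (∀ S → wedge (μ l) (wedges (removeAt μ l)) S ≡ ε * wedges μ S)
  wedge-remove μ zero = 1ℤ , refl , λ S → sym (ℤ.*-identityˡ _)
  wedge-remove {suc s} μ (suc l) with ε , ε² , e ← wedge-remove (μ ∘ suc) l =
    - ε , trans (lemma ε) ε² , λ S →
      trans (wedge-anticomm (μ (suc l)) (μ zero) _ S)
      (trans (cong -_ (trans (wedge-cong (μ zero) e S) (wedge-* (μ zero) ε (wedges (μ ∘ suc)) S)))
        (ℤ.neg-distribˡ-* ε _))
    where
    lemma : ∀ ε → - ε * - ε ≡ ε * ε
    lemma = solve-∀

  -- Cramer's rule: wedging both sides of `b x = Σ c μ` with all vectors except `μ l` kills every
  -- other summand, because a vector repeats, and leaves `c l` times the minor up to sign.
  cramer : ∀ {s n} (μ : Fin s → Vecᶻ n) S b (x : Vecᶻ n) (c : Fin s → ℤ) →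
      (∀ i → b * x i ≡ comb c μ i) →
           ∀ l → ∃[ d ] b * d ≡ c l * wedges μ S
  cramer {suc s} μ S b x c bx≡ l with ε , ε² , e ← wedge-remove μ l =
    ε * wedge x Y S , (begin
      b * (ε * wedge x Y S)                     ≡⟨ swap b ε _ ⟩
      ε * (b * wedge x Y S)                     ≡⟨ cong (ε *_) (wedge-*ˡ b x Y S) ⟨
      ε * wedge (λ i → b * x i) Y S             ≡⟨ cong (ε *_) (wedge-congˡ bx≡ Y S) ⟩
      ε * wedge (comb c μ) Y S                  ≡⟨ cong (ε *_) (wedge-comb c μ Y S) ⟩
      ε * sum (λ a → c a * wedge (μ a) Y S)     ≡⟨ cong (ε *_) (sum-at _ l λ a a≢l →
                                                     trans (cong (c a *_) (vanish a a≢l))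
                                                         (ℤ.*-zeroʳ (c a))) ⟩
      ε * (c l * wedge (μ l) Y S)               ≡⟨ cong (λ w → ε * (c l * w)) (e S) ⟩
      ε * (c l * (ε * wedges μ S))              ≡⟨ pull ε (c l) (wedges μ S) ⟩
      ε * ε * (c l * wedges μ S)                ≡⟨ cong (_* (c l * wedges μ S)) ε² ⟩
      1ℤ * (c l * wedges μ S)                   ≡⟨ ℤ.*-identityˡ _ ⟩
      c l * wedges μ S                          ∎)
    where
    Y = wedges (removeAt μ l)
    vanish : ∀ a → a ≢ l → wedge (μ a) Y S ≡ 0ℤ
    vanish a a≢l = subst (λ a → wedge (μ a) Y S ≡ 0ℤ) (punchIn-punchOut (a≢l ∘ sym))
      (wedge-member (removeAt μ l) (punchOut (a≢l ∘ sym)) S)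
    swap : ∀ b e w → b * (e * w) ≡ e * (b * w)
    swap = solve-∀
    pull : ∀ e c w → e * (c * (e * w)) ≡ e * e * (c * w)
    pull = solve-∀

  1ₑ-false : ∀ n → 1ₑ (replicate n false) ≡ 1ℤ
  1ₑ-false zero    = refl
  1ₑ-false (suc n) = 1ₑ-false n

  -- By independence some form `f` kills the later vectors but not the first. Contracting with `f`
  -- strips the first factor and returns a nonzero multiple of the shorter product, so induction
  -- applies.
  wedges-≢0 : ∀ {s n} (μ : Fin s → Vecᶻ n) → HasFullRowRank μ → ¬ (∀ S → wedges μ S ≡ 0ℤ)
  wedges-≢0 {zero} {n} μ rank y≡0 with () ← trans (sym (1ₑ-false n)) (y≡0 (replicate n false))
  wedges-≢0 {suc s} {n} μ rank y≡0 with separate (μ ∘ suc) (μ zero)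
  ... | inj₁ (b , b≢0 , c , e) = b≢0 (trans (sym (ℤ.neg-involutive b))
      (cong -_ (rank (- b ◂ c) zeros zero)))
    where
    zeros : ∀ i → comb (- b ◂ c) μ i ≡ 0ℤ
    zeros i = trans (cong (- b * μ zero i +_) (sym (e i))) (lemma b (μ zero i))
      where
      lemma : ∀ b m → - b * m + b * m ≡ 0ℤ
      lemma = solve-∀
  ... | inj₂ (f , f⊥ , f≢0) = wedges-≢0 (μ ∘ suc) rank′ λ S →
      *-cancel-0 f≢0 (begin
        dot f (μ zero) * Y S
          ≡⟨ lemma _ (wedge (μ zero) (contract f Y) S) ⟩
        (dot f (μ zero) * Y S - wedge (μ zero) (contract f Y) S) + wedge (μ zero) (contract f Y) S
          ≡⟨ cong₂ _+_ (trans (sym (contract-wedge f (μ zero) Y S)) (contract-0 f y≡0 S))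
                       (wedge-0 (μ zero) (contract-kills (μ ∘ suc) f⊥) S) ⟩
        0ℤ ∎)
    where
    Y = wedges (μ ∘ suc)
    lemma : ∀ p q → p ≡ (p - q) + q
    lemma = solve-∀
    rank′ : HasFullRowRank (μ ∘ suc)
    rank′ c e j = rank (0ℤ ◂ c) (λ i → trans (ℤ.+-identityˡ _) (e i)) (suc j)
    contract-1ₑ : ∀ {n} (f : Vecᶻ n) S → contract f 1ₑ S ≡ 0ℤ
    contract-1ₑ f []          = refl
    contract-1ₑ f (false ∷ S) = cong₂ _+_ (contract-1ₑ (f ∘ suc) S) (ℤ.*-zeroʳ (f zero))
    contract-1ₑ f (true ∷ S)  = cong -_ (contract-0 (f ∘ suc) (λ _ → refl) S)
    contract-kills : ∀ {s} (ν : Fin s → Vecᶻ n) → (∀ l → dot f (ν l) ≡ 0ℤ) →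
                     ∀ S → contract f (wedges ν) S ≡ 0ℤ
    contract-kills {zero}  ν _  S = contract-1ₑ f S
    contract-kills {suc s} ν f⊥ S = trans (contract-wedge f (ν zero) _ S)
      (cong₂ (λ p q → p * wedges (ν ∘ suc) S - q) (f⊥ zero)
        (wedge-0 (ν zero) (contract-kills (ν ∘ suc) (f⊥ ∘ suc)) S))

  nonzero-coordinate? : ∀ {n} (z : Ext n) → (∀ S → z S ≡ 0ℤ) ⊎ ∃[ S ] z S ≢ 0ℤ
  nonzero-coordinate? {zero} z with z [] ℤ.≟ 0ℤ
  ... | yes e = inj₁ λ where [] → e
  ... | no ne = inj₂ ([] , ne)
  nonzero-coordinate? {suc n} z
    with nonzero-coordinate? (z ∘ (false ∷_)) | nonzero-coordinate? (z ∘ (true ∷_))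
  ... | inj₁ p        | inj₁ q        = inj₁ λ where
    (false ∷ S) → p S
    (true ∷ S)  → q S
  ... | inj₂ (S , ne) | _             = inj₂ (false ∷ S , ne)
  ... | inj₁ _        | inj₂ (S , ne) = inj₂ (true ∷ S , ne)

  ∃-coordinate : ∀ {n} (y : Ext n) → ¬ (∀ S → y S ≡ 0ℤ) → ∃[ S ] y S ≢ 0ℤ
  ∃-coordinate y y≢0 with nonzero-coordinate? y
  ... | inj₁ y≡0 = contradiction y≡0 y≢0
  ... | inj₂ nz  = nz

  -- δ is a nonzero minor of μ, bounded by Hadamard's inequality.
  common-denominator : ∀ {s n} (μ : Fin s → Vecᶻ n) → HasFullRowRank μ →
    ∀ K → (∀ l → dot (μ l) (μ l) ≤ pos K) →
    ∃[ δ ] δ ≢ 0ℤ × ∣ δ ∣ ℕ.^ 2 ℕ.≤ K ℕ.^ s ×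
    (∀ x → InRationalSpan μ x → ∃[ d ] (∀ i → δ * x i ≡ comb d μ i))
  common-denominator {s} μ rank K dot≤K with S , δ≢0 ← ∃-coordinate (wedges μ) (wedges-≢0 μ rank) =
    δ , δ≢0 , δ²≤ , clear
    where
    δ = wedges μ S
    δ²≤ : ∣ δ ∣ ℕ.^ 2 ℕ.≤ K ℕ.^ s
    δ²≤ = subst (ℕ._≤ K ℕ.^ s) (cong (∣ δ ∣ ℕ.*_) (sym (ℕ.*-identityʳ ∣ δ ∣)))
      (ℤ.drop‿+≤+ (ℤ.≤-trans (ℤ.≤-reflexive (square δ))
        (ℤ.≤-trans (coordinate-≤ (wedges μ) S) (hadamard μ K dot≤K))))
      where
      square : ∀ a → pos (∣ a ∣ ℕ.* ∣ a ∣) ≡ a * a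
      square (pos n)    = ℤ.pos-* n n
      square -[1+ n ] = refl
    clear : ∀ x → InRationalSpan μ x → ∃[ d ] (∀ i → δ * x i ≡ comb d μ i)
    -- By Cramer's rule `b` divides each `c l * δ`, so the unknown denominator `b` cancels and `δ`
    -- serves for all `x` at once.
    clear x (b , b≢0 , c , bx≡) = d , λ i → ℤ.*-cancelˡ-≡ b (δ * x i) (comb d μ i)
        {{≢-nonZero b≢0}} (begin
      b * (δ * x i)                       ≡⟨ swap b δ (x i) ⟩
      δ * (b * x i)                       ≡⟨ cong (δ *_) (bx≡ i) ⟩
      δ * comb c μ i                      ≡⟨ *-distribˡ-sum δ (λ l → c l * μ l i) ⟩
      sum (λ l → δ * (c l * μ l i))       ≡⟨ sum-cong-≗ (λ l → trans (assoc δ (c l) (μ l i))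
                                               (cong (_* μ l i) (sym (bd≡ l)))) ⟩
      sum (λ l → b * d l * μ l i)         ≡⟨ sum-cong-≗ (λ l → ℤ.*-assoc b (d l) (μ l i)) ⟩
      sum (λ l → b * (d l * μ l i))       ≡⟨ *-distribˡ-sum b (λ l → d l * μ l i) ⟨
      b * comb d μ i                      ∎)
      where
      d = λ l → proj₁ (cramer μ S b x c bx≡ l)
      bd≡ : ∀ l → b * d l ≡ c l * δ
      bd≡ l = proj₂ (cramer μ S b x c bx≡ l)
      swap : ∀ b d x → b * (d * x) ≡ d * (b * x)
      swap = solve-∀
      assoc : ∀ d c m → d * (c * m) ≡ c * d * m
      assoc = solve-∀

  -- Applied to a relation, the separating form leaves only the coefficient of `x`, which must
  -- therefore be zero.
  extend-independent : ∀ {s n} {μ : Fin s → Vecᶻ n} {x} → HasFullRowRank μ → Separable μ x →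
                       HasFullRowRank (x ◂ μ)
  extend-independent {μ = μ} {x} rank (v , v⊥μ , v·x≢0) c e = λ where
      zero    → c₀≡0
      (suc j) → rank (c ∘ suc) (λ i → trans (sym (ℤ.+-identityˡ _))
        (trans (cong (λ a → a * x i + comb (c ∘ suc) μ i) (sym c₀≡0)) (e i))) j
    where
    c₀≡0 : c zero ≡ 0ℤ
    c₀≡0 = *-cancel-0 v·x≢0 (begin
      dot v x * c zero
        ≡⟨ ℤ.*-comm (dot v x) (c zero) ⟩
      c zero * dot v x
        ≡⟨ sum-at (λ l → c l * dot v ((x ◂ μ) l)) zero (λ where
             zero z≢z    → contradiction refl z≢z
             (suc l) _ → trans (cong (c (suc l) *_) (v⊥μ l)) (ℤ.*-zeroʳ (c (suc l)))) ⟨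
      sum (λ l → c l * dot v ((x ◂ μ) l))
        ≡⟨ dot-comb v c (x ◂ μ) ⟨
      dot v (comb c (x ◂ μ))
        ≡⟨ dot-congʳ v e ⟩
      dot v (λ _ → 0ℤ)
        ≡⟨ sum-0 _ (λ i → ℤ.*-zeroʳ (v i)) ⟩
      0ℤ ∎)

  -- Greedy selection: a vector is kept exactly when some form separates it from those already kept.
  extract-basis : ∀ {n} (D : List (Vecᶻ n)) → ∃[ s ] Σ[ μ ∈ (Fin s → Vecᶻ n) ]
    HasFullRowRank μ × (∀ l → μ l ∈ D) × (∀ x → x ∈ D → InRationalSpan μ x)
  extract-basis []      = 0 , (λ ()) , (λ c e ()) , (λ ()) , λ x ()
  extract-basis (x ∷ D) with s , μ , rank , ⊆D , span ← extract-basis D | separate μ x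
  ... | inj₁ x∈ = s , μ , rank , there ∘ ⊆D , λ where
    y (here refl) → x∈
    y (there y∈D) → span y y∈D
  ... | inj₂ sep = suc s , x ◂ μ , extend-independent rank sep , (λ where
      zero    → here refl
      (suc l) → there (⊆D l)) , λ where
    y (here refl) → 1ℤ , (λ ()) , 1ℤ ◂ (λ _ → 0ℤ) , λ i → sym (trans
      (cong (1ℤ * x i +_) (sum-0 (λ l → 0ℤ * μ l i) λ l → refl)) (ℤ.+-identityʳ _))
    y (there y∈D) → let (b , b≢0 , c , e) = span y y∈D in
      b , b≢0 , 0ℤ ◂ c , λ i → trans (e i) (sym (ℤ.+-identityˡ _))

-- Vanishing sums of roots of unity and torsion points, over an abstract ring.

module VanishingSums where

  open import Algebra.Bundles using (AbelianGroup; CommutativeRing)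
  open import Data.Fin.Base
    using (Fin; zero; suc; toℕ; inject₁; fromℕ; fromℕ<; punchIn; punchOut; finToFun; funToFin)
  open import Data.Fin.Properties
    using ( toℕ-fromℕ; toℕ-inject₁; toℕ<n; toℕ-fromℕ<; toℕ-injective; any?; all?; pigeonhole
          ; finToFun-funToFin; punchIn-punchOut; ¬∀⟶∃¬)
  open import Data.Integer.Base as ℤ using (ℤ; -[1+_]; _⊖_; 0ℤ; 1ℤ; -1ℤ) renaming (+_ to pos; ∣_∣ to abs)
  import Data.Integer.DivMod as ℤ
  import Data.Integer.Properties as ℤ
  import Data.Integer.Tactic.RingSolver as ℤ-Solver
  open import Data.List.Base as List
    using (List; []; _∷_; _++_; cartesianProduct; filter; foldr; length; map)
  open import Data.List.Membership.Propositional using (_∈_)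
  open import Data.List.Membership.Propositional.Properties
    using (∈-map⁺; ∈-map⁻; ∈-filter⁺; ∈-filter⁻; ∈-cartesianProduct⁺; ∈-cartesianProduct⁻)
  open import Data.List.Relation.Unary.All as All using (All; []; _∷_)
  open import Data.List.Relation.Unary.All.Properties using (¬Any⇒All¬)
  open import Data.List.Relation.Unary.Any as Any using (Any; here; there)
  open import Data.List.Relation.Unary.Any.Properties using (lookup-index)
  open import Data.Nat.Base as ℕ
    using (ℕ; zero; suc; NonZero; _<_; _≤_; _%_; _/_; _∸_; s≤s; z≤n)
  open import Data.Nat.Coprimality using (Coprime)
  open import Data.Nat.Divisibility
    using ( _∣_; _∣?_; divides; ∣-trans; m∣m*n; ∣m+n∣m⇒∣n; ∣n⇒∣m*n; *-cancelˡ-∣; *-monoʳ-∣; ∣⇒≤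
          ; m%n≡0⇒n∣m)
  open import Data.Nat.DivMod
    using (_mod_; m≡m%n+[m/n]*n; m%n<n; m/n*n≡m; n%1≡0; %-remove-+ˡ; [m+n]%n≡m%n; m<n⇒m%n≡m)
  open import Data.Nat.Induction using (<-wellFounded)
  open import Data.Nat.ListAction using (product)
  open import Data.Nat.ListAction.Properties using (∈⇒∣product; product≢0)
  open import Data.Nat.Primality using (Prime; prime?; prime⇒nonZero; euclidsLemma)
  open import Data.Nat.Primality.Factorisation using (factorise; PrimeFactorisation)
  import Data.Nat.Properties as ℕ
  import Data.Nat.Tactic.RingSolver as ℕ-Solver
  open import Data.Product.Base using (_×_; _,_; ∃-syntax; Σ-syntax; proj₁; proj₂; uncurry)
  open import Data.Sum.Base as Sum using (_⊎_; inj₁; inj₂)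
  open import Data.Unit.Base using (⊤; tt)
  open import Data.Vec.Base using (Vec; []; _∷_; lookup)
  open import Data.Vec.Functional using (insertAt; removeAt)
  open import Data.Vec.Functional.Properties using (insertAt-lookup; insertAt-punchIn)
  open import Function.Base using (_∘_)
  open import Induction.WellFounded using (Acc; acc)
  open import Level using (0ℓ)
  open import Relation.Binary.Definitions using (tri<; tri≈; tri>)
  open import Relation.Binary.PropositionalEquality as ≡ using (_≡_; _≢_; _≗_)
  open import Relation.Nullary using (¬_; Dec; yes; no; contradiction)
  open import Relation.Nullary.Decidable
    using (map′; decidable-stable; ¬?; _×-dec_; _⊎-dec_)

  open NumberTheory
  open IntegerLattices hiding (sum; *-distribˡ-sum; ∑-distrib-+; ∑-comm)

  -- Integer powers, characters and monomial maps in an abelian group.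

  module IntegerPower (G : AbelianGroup 0ℓ 0ℓ) where

    open AbelianGroup G
    open GroupPower group public
    open import Algebra.Properties.AbelianGroup G
      using (⁻¹-∙-comm; ε⁻¹≈ε; inverseˡ-unique; identityʳ-unique; ⁻¹-involutive)
    open import Algebra.Properties.CommutativeMonoid.Mult commutativeMonoid
      using (×-congʳ; ×-homo-+; ×-distrib-+; ×-assocˡ)
    open import Algebra.Properties.CommutativeMonoid.Sum commutativeMonoid public
      using () renaming (sum to ∏; ∑-distrib-+ to ∏-distrib-∙; ∑-comm to ∏-comm; sum-cong-≋ to
          ∏-cong)
    open import Algebra.Properties.CommutativeSemigroup commutativeSemigroup using (interchange)
    open import Relation.Binary.Reasoning.Setoid setoid

    ^-cong : ∀ n {x y} → x ≈ y → x ^ n ≈ y ^ n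
    ^-cong n = ×-congʳ n

    ^-+ : ∀ x m n → x ^ (m ℕ.+ n) ≈ x ^ m ∙ x ^ n
    ^-+ = ×-homo-+

    ^-∙ : ∀ x y n → (x ∙ y) ^ n ≈ x ^ n ∙ y ^ n
    ^-∙ = ×-distrib-+

    ^-* : ∀ x m n → (x ^ m) ^ n ≈ x ^ (m ℕ.* n)
    ^-* x m n = trans (×-assocˡ x n m) (reflexive (≡.cong (x ^_) (ℕ.*-comm n m)))

    ^-1 : ∀ x → x ^ 1 ≈ x
    ^-1 x = identityʳ x

    ε^ : ∀ n → ε ^ n ≈ ε
    ε^ zero    = refl
    ε^ (suc n) = trans (identityˡ _) (ε^ n)

    ^ᶻ-cong : ∀ a {x y} → x ≈ y → x ^ᶻ a ≈ y ^ᶻ a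
    ^ᶻ-cong (pos n)  x≈y = ^-cong n x≈y
    ^ᶻ-cong -[1+ n ] x≈y = ⁻¹-cong (^-cong (suc n) x≈y)

    ^ᶻ-⊖ : ∀ x m n → x ^ᶻ (m ⊖ n) ≈ x ^ m ∙ (x ^ n) ⁻¹
    ^ᶻ-⊖ x m       zero    = sym (trans (∙-congˡ ε⁻¹≈ε) (identityʳ _))
    ^ᶻ-⊖ x zero    (suc n) = sym (identityˡ _)
    ^ᶻ-⊖ x (suc m) (suc n) = begin
      x ^ᶻ (suc m ⊖ suc n)              ≡⟨ ≡.cong (x ^ᶻ_) (ℤ.[1+m]⊖[1+n]≡m⊖n m n) ⟩
      x ^ᶻ (m ⊖ n)                      ≈⟨ ^ᶻ-⊖ x m n ⟩
      x ^ m ∙ (x ^ n) ⁻¹                ≈⟨ identityˡ _ ⟨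
      ε ∙ (x ^ m ∙ (x ^ n) ⁻¹)          ≈⟨ ∙-congʳ (inverseʳ x) ⟨
      x ∙ x ⁻¹ ∙ (x ^ m ∙ (x ^ n) ⁻¹)   ≈⟨ interchange x (x ⁻¹) (x ^ m) ((x ^ n) ⁻¹) ⟩
      x ^ suc m ∙ (x ⁻¹ ∙ (x ^ n) ⁻¹)   ≈⟨ ∙-congˡ (⁻¹-∙-comm x (x ^ n)) ⟩
      x ^ suc m ∙ (x ^ suc n) ⁻¹        ∎

    ^ᶻ-+ : ∀ x a b → x ^ᶻ (a ℤ.+ b) ≈ x ^ᶻ a ∙ x ^ᶻ b
    ^ᶻ-+ x (pos m)  (pos n)  = ^-+ x m n
    ^ᶻ-+ x (pos m)  -[1+ n ] = ^ᶻ-⊖ x m (suc n)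
    ^ᶻ-+ x -[1+ m ] (pos n)  = trans (^ᶻ-⊖ x n (suc m)) (comm _ _)
    ^ᶻ-+ x -[1+ m ] -[1+ n ] = begin
      (x ^ suc (suc (m ℕ.+ n))) ⁻¹    ≡⟨ ≡.cong (λ k → (x ^ suc k) ⁻¹) (ℕ.+-suc m n) ⟨
      (x ^ (suc m ℕ.+ suc n)) ⁻¹      ≈⟨ ⁻¹-cong (^-+ x (suc m) (suc n)) ⟩
      (x ^ suc m ∙ x ^ suc n) ⁻¹      ≈⟨ ⁻¹-∙-comm _ _ ⟨
      (x ^ suc m) ⁻¹ ∙ (x ^ suc n) ⁻¹ ∎

    -- The integers are free on 1. The multiplicative laws of powers follow by recognising both
    -- sides as homomorphisms that agree at 1, which avoids splitting on signs.
    hom-unique : ∀ (f : ℤ → Carrier) → (∀ a b → f (a ℤ.+ b) ≈ f a ∙ f b) →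
                 ∀ a → f a ≈ f 1ℤ ^ᶻ a
    hom-unique f hom = go
      where
      f0≈ε : f 0ℤ ≈ ε
      f0≈ε = identityʳ-unique (f 0ℤ) (f 0ℤ) (sym (hom 0ℤ 0ℤ))
      nat : ∀ n → f (pos n) ≈ f 1ℤ ^ n
      nat zero    = f0≈ε
      nat (suc n) = trans (hom 1ℤ (pos n)) (∙-congˡ (nat n))
      go : ∀ a → f a ≈ f 1ℤ ^ᶻ a
      go (pos n)  = nat n
      go -[1+ n ] = inverseˡ-unique _ _ (begin
        f -[1+ n ] ∙ f 1ℤ ^ suc n      ≈⟨ ∙-congˡ (nat (suc n)) ⟨
        f -[1+ n ] ∙ f (pos (suc n))   ≈⟨ hom -[1+ n ] (pos (suc n)) ⟨
        f (-[1+ n ] ℤ.+ pos (suc n))   ≡⟨ ≡.cong f (ℤ.+-inverseˡ (pos (suc n))) ⟩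
        f 0ℤ                           ≈⟨ f0≈ε ⟩
        ε                              ∎)

    ^ᶻ-1 : ∀ x → x ^ᶻ 1ℤ ≈ x
    ^ᶻ-1 x = identityʳ x

    ^ᶻ-* : ∀ x a b → x ^ᶻ (a ℤ.* b) ≈ (x ^ᶻ a) ^ᶻ b
    ^ᶻ-* x a b = trans (hom-unique (λ b → x ^ᶻ (a ℤ.* b)) hom b)
      (^ᶻ-cong b (reflexive (≡.cong (x ^ᶻ_) (ℤ.*-identityʳ a))))
      where
      hom : ∀ b c → x ^ᶻ (a ℤ.* (b ℤ.+ c)) ≈ x ^ᶻ (a ℤ.* b) ∙ x ^ᶻ (a ℤ.* c)
      hom b c = trans (reflexive (≡.cong (x ^ᶻ_) (ℤ.*-distribˡ-+ a b c)))
          (^ᶻ-+ x (a ℤ.* b) (a ℤ.* c))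

    ^ᶻ-∙ : ∀ x y a → (x ∙ y) ^ᶻ a ≈ x ^ᶻ a ∙ y ^ᶻ a
    ^ᶻ-∙ x y a = sym (trans (hom-unique (λ a → x ^ᶻ a ∙ y ^ᶻ a) hom a)
      (^ᶻ-cong a (∙-cong (identityʳ x) (identityʳ y))))
      where
      hom : ∀ b c → x ^ᶻ (b ℤ.+ c) ∙ y ^ᶻ (b ℤ.+ c) ≈ (x ^ᶻ b ∙ y ^ᶻ b) ∙ (x ^ᶻ c ∙ y ^ᶻ c)
      hom b c = trans (∙-cong (^ᶻ-+ x b c) (^ᶻ-+ y b c)) (interchange _ _ _ _)

    ε^ᶻ : ∀ a → ε ^ᶻ a ≈ ε
    ε^ᶻ (pos n)  = ε^ n
    ε^ᶻ -[1+ n ] = trans (⁻¹-cong (ε^ (suc n))) ε⁻¹≈ε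

    ∏-ε : ∀ {n} {f : Fin n → Carrier} → (∀ i → f i ≈ ε) → ∏ f ≈ ε
    ∏-ε {zero}  f≈ε = refl
    ∏-ε {suc n} f≈ε = trans (∙-cong (f≈ε zero) (∏-ε (f≈ε ∘ suc))) (identityˡ ε)

    ^ᶻ-sum : ∀ {n} x (f : Fin n → ℤ) → x ^ᶻ IntegerLattices.sum f ≈ ∏ (λ i → x ^ᶻ f i)
    ^ᶻ-sum {zero}  x f = refl
    ^ᶻ-sum {suc n} x f = trans (^ᶻ-+ x (f zero) _) (∙-congˡ (^ᶻ-sum x (f ∘ suc)))

    ∏-^ᶻ : ∀ {n} (f : Fin n → Carrier) a → ∏ f ^ᶻ a ≈ ∏ (λ i → f i ^ᶻ a)
    ∏-^ᶻ {zero}  f a = ε^ᶻ a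
    ∏-^ᶻ {suc n} f a = trans (^ᶻ-∙ (f zero) _ a) (∙-congˡ (∏-^ᶻ (f ∘ suc) a))

    character : ∀ {n} → (Fin n → Carrier) → Vecᶻ n → Carrier
    character x v = ∏ λ i → x i ^ᶻ v i

    character-cong : ∀ {n} {x y : Fin n → Carrier} v → (∀ i → x i ≈ y i) →
                     character x v ≈ character y v
    character-cong v x≈y = ∏-cong λ i → ^ᶻ-cong (v i) (x≈y i)

    character-congʳ : ∀ {n} (x : Fin n → Carrier) {v w : Vecᶻ n} → (∀ i → v i ≡ w i) →
                      character x v ≈ character x w
    character-congʳ x v≡w = ∏-cong λ i → reflexive (≡.cong (x i ^ᶻ_) (v≡w i))

    character-∙ : ∀ {n} (x y : Fin n → Carrier) v →
                  character (λ i → x i ∙ y i) v ≈ character x v ∙ character y v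
    character-∙ x y v = trans (∏-cong λ i → ^ᶻ-∙ (x i) (y i) (v i))
      (∏-distrib-∙ (λ i → x i ^ᶻ v i) (λ i → y i ^ᶻ v i))

    character-+ : ∀ {n} (x : Fin n → Carrier) v w →
                  character x (λ i → v i ℤ.+ w i) ≈ character x v ∙ character x w
    character-+ x v w = trans (∏-cong λ i → ^ᶻ-+ (x i) (v i) (w i))
      (∏-distrib-∙ (λ i → x i ^ᶻ v i) (λ i → x i ^ᶻ w i))

    character-* : ∀ {n} (x : Fin n → Carrier) a v →
                  character x (λ i → a ℤ.* v i) ≈ character x v ^ᶻ a
    character-* x a v = trans (∏-cong λ i →
      trans (reflexive (≡.cong (x i ^ᶻ_) (ℤ.*-comm a (v i)))) (^ᶻ-* (x i) (v i) a))
          (sym (∏-^ᶻ (λ i → x i ^ᶻ v i) a))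

    character-^ᶻ : ∀ {n} (x : Fin n → Carrier) a v →
                   character (λ i → x i ^ᶻ a) v ≈ character x v ^ᶻ a
    character-^ᶻ x a v = trans (∏-cong λ i → trans (sym (^ᶻ-* (x i) a (v i)))
      (trans (reflexive (≡.cong (x i ^ᶻ_) (ℤ.*-comm a (v i)))) (^ᶻ-* (x i) (v i) a)))
          (sym (∏-^ᶻ (λ i → x i ^ᶻ v i) a))

    character-comb : ∀ {s n} (x : Fin n → Carrier) c (μ : Fin s → Vecᶻ n) →
                     character x (comb c μ) ≈ ∏ (λ l → character x (μ l) ^ᶻ c l)
    character-comb x c μ = begin
      ∏ (λ i → x i ^ᶻ comb c μ i)
        ≈⟨ ∏-cong (λ i → ^ᶻ-sum (x i) (λ l → c l ℤ.* μ l i)) ⟩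
      ∏ (λ i → ∏ (λ l → x i ^ᶻ (c l ℤ.* μ l i)))
        ≈⟨ ∏-comm (λ i l → x i ^ᶻ (c l ℤ.* μ l i)) ⟩
      ∏ (λ l → character x (λ i → c l ℤ.* μ l i))
        ≈⟨ ∏-cong (λ l → character-* x (c l) (μ l)) ⟩
      ∏ (λ l → character x (μ l) ^ᶻ c l) ∎

    monomialMap : ∀ {r n} → (Fin r → Vecᶻ n) → (Fin r → Carrier) → Fin n → Carrier
    monomialMap E t i = ∏ λ j → t j ^ᶻ E j i

    -- The monomial map `t ↦ tᴱ` is dual to the linear map `E` on exponents; in particular the
    -- characters in the kernel of `E` are trivial on the torus.
    character-monomialMap : ∀ {r n} (E : Fin r → Vecᶻ n) t v →
      character (monomialMap E t) v ≈ character t (λ j → dot (E j) v)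
    character-monomialMap E t v = begin
      ∏ (λ i → ∏ (λ j → t j ^ᶻ E j i) ^ᶻ v i)
        ≈⟨ ∏-cong (λ i → ∏-^ᶻ (λ j → t j ^ᶻ E j i) (v i)) ⟩
      ∏ (λ i → ∏ (λ j → (t j ^ᶻ E j i) ^ᶻ v i))
        ≈⟨ ∏-comm (λ i j → (t j ^ᶻ E j i) ^ᶻ v i) ⟩
      ∏ (λ j → ∏ (λ i → (t j ^ᶻ E j i) ^ᶻ v i))
        ≈⟨ ∏-cong (λ j → trans (∏-cong λ i → sym (^ᶻ-* (t j) (E j i) (v i)))
             (sym (^ᶻ-sum (t j) (λ i → E j i ℤ.* v i)))) ⟩
      ∏ (λ j → t j ^ᶻ dot (E j) v) ∎

  -- Classical reasoning under double negation.

  excluded-middle : ∀ {P : Set} → ¬ ¬ Dec P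
  excluded-middle k = k (no λ p → k (yes p))

  -- Finitely many double negations can be opened one after the other, and monotonicity lets the
  -- largest of the bounds serve every index.
  ¬¬-bound : ∀ n (P : Fin n → ℕ → Set) → (∀ {i b c} → b ≤ c → P i b → P i c) →
             (∀ i → ¬ ¬ (∃[ b ] P i b)) → ¬ ¬ (∃[ b ] (∀ i → P i b))
  ¬¬-bound zero    P mono h k = k (0 , λ ())
  ¬¬-bound (suc n) P mono h k = h zero λ (b , p) →
    ¬¬-bound n (P ∘ suc) mono (h ∘ suc) λ (c , q) → k (b ℕ.⊔ c , λ where
      zero    → mono (ℕ.m≤m⊔n b c) p
      (suc i) → mono (ℕ.m≤n⊔m b c) (q i))

  bounded-family : ∀ {n} (f : Fin n → ℕ) → ∃[ b ] (∀ i → f i ≤ b)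
  bounded-family {zero}  f = 0 , λ ()
  bounded-family {suc n} f with b , h ← bounded-family (f ∘ suc) = f zero ℕ.⊔ b , λ where
    zero    → ℕ.m≤m⊔n (f zero) b
    (suc i) → ℕ.≤-trans (h i) (ℕ.m≤n⊔m (f zero) b)

  -- Sums, powers and integer multiples in a commutative ring.

  module RingSums (R : CommutativeRing 0ℓ 0ℓ) where

    open CommutativeRing R public hiding (zero)
    open import Algebra.Properties.Semiring.Exp semiring public
      using (_^_; ^-congˡ; ^-homo-*; ^-assocʳ)
    open import Algebra.Properties.CommutativeSemiring.Exp commutativeSemiring public
      using (^-distrib-*)
    open import Algebra.Properties.Semiring.Mult semiring public
      using (×-assocˡ) renaming (_×_ to _×#_)
    open import Algebra.Properties.Semiring.Sum semiring public
      using (sum; sum-init-last; *-distribˡ-sum; ∑-distrib-+; ∑-comm; sum-cong-≋)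
    open import Algebra.Properties.Ring ring public using (-‿distribˡ-*)
    open import Algebra.Properties.AbelianGroup +-abelianGroup public
      using () renaming (⁻¹-∙-comm to -‿+-comm; inverseˡ-unique to -‿unique)
    open import Relation.Binary.Reasoning.Setoid setoid public
    open import Algebra.Properties.CommutativeSemigroup +-commutativeSemigroup public
      using () renaming (interchange to +-interchange)
    open import Algebra.Properties.CommutativeSemigroup *-commutativeSemigroup public
      using () renaming (x∙yz≈y∙xz to x*yz≈y*xz)

    module ℤMod = IntegerPower +-abelianGroup

    Invertible : Carrier → Set
    Invertible x = ∃[ y ] x * y ≈ 1#

    infixr 8 _·_

    _·_ : ℤ → Carrier → Carrier
    a · x = x ℤMod.^ᶻ a

    ·-congʳ : ∀ a {x y} → x ≈ y → a · x ≈ a · y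
    ·-congʳ = ℤMod.^ᶻ-cong

    ·-congˡ : ∀ {a b} x → a ≡ b → a · x ≈ b · x
    ·-congˡ x a≡b = reflexive (≡.cong (_· x) a≡b)

    ·-+ : ∀ a b x → (a ℤ.+ b) · x ≈ a · x + b · x
    ·-+ a b x = ℤMod.^ᶻ-+ x a b

    ·-* : ∀ a b x → (a ℤ.* b) · x ≈ a · b · x
    ·-* a b x = trans (·-congˡ x (ℤ.*-comm a b)) (ℤMod.^ᶻ-* x b a)

    ·-distrib : ∀ a x y → a · (x + y) ≈ a · x + a · y
    ·-distrib a x y = ℤMod.^ᶻ-∙ x y a

    ·-0# : ∀ a → a · 0# ≈ 0#
    ·-0# = ℤMod.ε^ᶻ

    1·x≈x : ∀ x → 1ℤ · x ≈ x
    1·x≈x = ℤMod.^ᶻ-1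

    ·-assoc : ∀ a x y → (a · x) * y ≈ a · (x * y)
    ·-assoc a x y = trans (ℤMod.hom-unique (λ a → (a · x) * y)
      (λ a b → trans (*-congʳ (·-+ a b x)) (distribʳ y (a · x) (b · x))) a)
      (·-congʳ a (*-congʳ (1·x≈x x)))

    ·-comm : ∀ a x y → x * (a · y) ≈ a · (x * y)
    ·-comm a x y = trans (*-comm x (a · y)) (trans (·-assoc a y x) (·-congʳ a (*-comm y x)))

    ·-as-* : ∀ a x → a · x ≈ (a · 1#) * x
    ·-as-* a x = sym (trans (·-assoc a 1# x) (·-congʳ a (*-identityˡ x)))

    neg-· : ∀ a x → (ℤ.- a) · x ≈ - (a · x)
    neg-· a x = -‿unique ((ℤ.- a) · x) (a · x)
      (trans (sym (·-+ (ℤ.- a) a x)) (·-congˡ x (ℤ.+-inverseˡ a)))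

    1^ : ∀ n → 1# ^ n ≈ 1#
    1^ zero    = refl
    1^ (suc n) = trans (*-identityˡ _) (1^ n)

    ^-multiple : ∀ {x Q} → x ^ Q ≈ 1# → ∀ k → x ^ (Q ℕ.* k) ≈ 1#
    ^-multiple {x} {Q} e k = trans (sym (^-assocʳ x Q k)) (trans (^-congˡ k e) (1^ k))

    ^-% : ∀ {x Q} .{{_ : NonZero Q}} → x ^ Q ≈ 1# → ∀ m → x ^ m ≈ x ^ (m % Q)
    ^-% {x} {Q} e m = begin
      x ^ m                              ≡⟨ ≡.cong (x ^_) (m≡m%n+[m/n]*n m Q) ⟩
      x ^ (m % Q ℕ.+ (m / Q) ℕ.* Q)      ≈⟨ ^-homo-* x (m % Q) _ ⟩
      x ^ (m % Q) * x ^ ((m / Q) ℕ.* Q)  ≡⟨ ≡.cong (λ k → x ^ (m % Q) * x ^ k)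
          (ℕ.*-comm (m / Q) Q) ⟩
      x ^ (m % Q) * x ^ (Q ℕ.* (m / Q))  ≈⟨ *-congˡ (^-multiple {x} {Q} e (m / Q)) ⟩
      x ^ (m % Q) * 1#                   ≈⟨ *-identityʳ _ ⟩
      x ^ (m % Q)                        ∎

    0^ : ∀ n .{{_ : NonZero n}} → 0# ^ n ≈ 0#
    0^ (suc n) = zeroˡ _

    sum-0# : ∀ {n} (f : Fin n → Carrier) → (∀ i → f i ≈ 0#) → sum f ≈ 0#
    sum-0# {zero}  f h = refl
    sum-0# {suc n} f h = trans (+-cong (h zero) (sum-0# (f ∘ suc) (h ∘ suc))) (+-identityˡ 0#)

    sum-at# : ∀ {n} (f : Fin n → Carrier) l → (∀ i → i ≢ l → f i ≈ 0#) → sum f ≈ f l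
    sum-at# {suc n} f zero    h =
      trans (+-congˡ (sum-0# (f ∘ suc) λ i → h (suc i) λ ())) (+-identityʳ _)
    sum-at# {suc n} f (suc l) h = trans (+-cong (h zero λ ())
      (sum-at# (f ∘ suc) l λ i i≢l → h (suc i) λ where ≡.refl → i≢l ≡.refl)) (+-identityˡ _)

    module _ {I : Set} where

      ∑ : List I → (I → Carrier) → Carrier
      ∑ is f = foldr _+_ 0# (map f is)

      ∑-cong : ∀ is {f g} → (∀ i → f i ≈ g i) → ∑ is f ≈ ∑ is g
      ∑-cong []       h = refl
      ∑-cong (i ∷ is) h = +-cong (h i) (∑-cong is h)

      ∑-congᴬ : ∀ {is f g} → All (λ i → f i ≈ g i) is → ∑ is f ≈ ∑ is g
      ∑-congᴬ []       = refl
      ∑-congᴬ (p ∷ ps) = +-cong p (∑-congᴬ ps)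

      ∑-0 : ∀ is {f} → (∀ i → f i ≈ 0#) → ∑ is f ≈ 0#
      ∑-0 []       h = refl
      ∑-0 (i ∷ is) h = trans (+-cong (h i) (∑-0 is h)) (+-identityˡ 0#)

      ∑-+ : ∀ is f g → ∑ is (λ i → f i + g i) ≈ ∑ is f + ∑ is g
      ∑-+ []       f g = sym (+-identityˡ 0#)
      ∑-+ (i ∷ is) f g = trans (+-congˡ (∑-+ is f g)) (+-interchange (f i) (g i) _ _)

      ∑-*ˡ : ∀ is x f → x * ∑ is f ≈ ∑ is (λ i → x * f i)
      ∑-*ˡ []       x f = zeroʳ x
      ∑-*ˡ (i ∷ is) x f = trans (distribˡ x (f i) _) (+-congˡ (∑-*ˡ is x f))

      ∑-· : ∀ is a f → a · ∑ is f ≈ ∑ is (λ i → a · f i)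
      ∑-· []       a f = ·-0# a
      ∑-· (i ∷ is) a f = trans (·-distrib a (f i) _) (+-congˡ (∑-· is a f))

      ∑-swap : ∀ {n} is (f : Fin n → I → Carrier) →
               sum (λ j → ∑ is (f j)) ≈ ∑ is (λ i → sum (λ j → f j i))
      ∑-swap {n} []   f = sum-0# {n} (λ _ → 0#) λ _ → refl
      ∑-swap (i ∷ is) f =
        trans (∑-distrib-+ (λ j → f j i) (λ j → ∑ is (f j))) (+-congˡ (∑-swap is f))

    -- A list of (coefficient, exponent) pairs stands for a polynomial.
    eval : Carrier → List (ℤ × ℕ) → Carrier
    eval z []            = 0#
    eval z ((a , e) ∷ l) = a · z ^ e + eval z l

    ∑-eval : ∀ {I : Set} z (is : List I) (a : I → ℤ) (s : I → ℕ) →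
             ∑ is (λ i → a i · z ^ s i) ≈ eval z (map (λ i → a i , s i) is)
    ∑-eval z []       a s = refl
    ∑-eval z (i ∷ is) a s = +-congˡ (∑-eval z is a s)

    eval-cong : ∀ {z w} → z ≈ w → ∀ l → eval z l ≈ eval w l
    eval-cong z≈w []            = refl
    eval-cong z≈w ((a , e) ∷ l) = +-cong (·-congʳ a (^-congˡ e z≈w)) (eval-cong z≈w l)

    eval-++ : ∀ z l m → eval z (l ++ m) ≈ eval z l + eval z m
    eval-++ z []            m = sym (+-identityˡ _)
    eval-++ z ((a , e) ∷ l) m = trans (+-congˡ (eval-++ z l m)) (sym (+-assoc _ _ _))

  -- Frobenius congruences in the ring generated by one element.

  module Conjugation (R : CommutativeRing 0ℓ 0ℓ) where

    open RingSums R

    module Adjoin (z : Carrier) where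

      -- Membership carries a polynomial, so that a congruence modulo `p` can later be read off as
      -- divisibility of integer coordinates.
      ℤ[z] : Carrier → Set
      ℤ[z] x = ∃[ l ] x ≈ eval z l

      ∈-0# : ℤ[z] 0#
      ∈-0# = [] , refl

      ∈-· : ∀ {x} a → ℤ[z] x → ℤ[z] (a · x)
      ∈-· {x} a (l , e) = map (λ (b , f) → a ℤ.* b , f) l , trans (·-congʳ a e) (go l)
        where
        go : ∀ l → a · eval z l ≈ eval z (map (λ (b , f) → a ℤ.* b , f) l)
        go []            = ·-0# a
        go ((b , f) ∷ l) = trans (·-distrib a _ _) (+-cong (sym (·-* a b _)) (go l))

      ∈-z^ : ∀ e → ℤ[z] (z ^ e)
      ∈-z^ e = (1ℤ , e) ∷ [] , sym (trans (+-identityʳ _) (1·x≈x _))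

      ∈-1# : ℤ[z] 1#
      ∈-1# = ∈-z^ 0

      ∈-≈ : ∀ {x y} → x ≈ y → ℤ[z] y → ℤ[z] x
      ∈-≈ x≈y (l , e) = l , trans x≈y e

      ∈-+ : ∀ {x y} → ℤ[z] x → ℤ[z] y → ℤ[z] (x + y)
      ∈-+ (l , e) (m , f) = l ++ m , trans (+-cong e f) (sym (eval-++ z l m))

      ∈-z^* : ∀ {x} e → ℤ[z] x → ℤ[z] (z ^ e * x)
      ∈-z^* {x} e (l , eq) = ∈-≈ (*-congˡ eq) (map (λ (b , f) → b , e ℕ.+ f) l , go l)
        where
        go : ∀ l → z ^ e * eval z l ≈ eval z (map (λ (b , f) → b , e ℕ.+ f) l)
        go []            = zeroʳ _
        go ((b , f) ∷ l) = trans (distribˡ _ _ _) (+-cong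
          (trans (·-comm b (z ^ e) (z ^ f)) (·-congʳ b (sym (^-homo-* z e f)))) (go l))

      ∈-* : ∀ {x y} → ℤ[z] x → ℤ[z] y → ℤ[z] (x * y)
      ∈-* {x} {y} (l , e) y∈ = ∈-≈ (*-congʳ e) (go l)
        where
        go : ∀ l → ℤ[z] (eval z l * y)
        go []            = ∈-≈ (zeroˡ y) ∈-0#
        go ((a , e) ∷ l) = ∈-≈ (distribʳ y _ _)
          (∈-+ (∈-≈ (·-assoc a (z ^ e) y) (∈-· a (∈-z^* e y∈))) (go l))

      ∈-^ : ∀ {x} n → ℤ[z] x → ℤ[z] (x ^ n)
      ∈-^ zero    x∈ = ∈-1#
      ∈-^ (suc n) x∈ = ∈-* x∈ (∈-^ n x∈)

      ∈-sum : ∀ {n} {f : Fin n → Carrier} → (∀ i → ℤ[z] (f i)) → ℤ[z] (sum f)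
      ∈-sum {zero}  f∈ = ∈-0#
      ∈-sum {suc n} f∈ = ∈-+ (f∈ zero) (∈-sum (f∈ ∘ suc))

      module Congruence (p : ℕ) where

        infix 4 _≡ₚ_

        record _≡ₚ_ (x y : Carrier) : Set where
          constructor cong-mod
          field
            h  : Carrier
            h∈ : ℤ[z] h
            eq : x ≈ y + pos p · h

        ≈⇒≡ₚ : ∀ {x y} → x ≈ y → x ≡ₚ y
        ≈⇒≡ₚ {x} {y} x≈y = cong-mod 0# ∈-0# (trans x≈y
            (sym (trans (+-congˡ (·-0# (pos p))) (+-identityʳ y))))

        ≡ₚ-trans : ∀ {x y w} → x ≡ₚ y → y ≡ₚ w → x ≡ₚ w
        ≡ₚ-trans {x} {y} {w} (cong-mod h h∈ e) (cong-mod k k∈ f) = cong-mod (k + h) (∈-+ k∈ h∈)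
          (trans e (trans (+-congʳ f) (trans (+-assoc w _ _)
            (+-congˡ (sym (·-distrib (pos p) k h))))))

        ≡ₚ-+ : ∀ {x y v w} → x ≡ₚ y → v ≡ₚ w → x + v ≡ₚ y + w
        ≡ₚ-+ (cong-mod h h∈ e) (cong-mod k k∈ f) = cong-mod (h + k) (∈-+ h∈ k∈)
          (trans (+-cong e f) (trans (+-interchange _ _ _ _)
              (+-congˡ (sym (·-distrib (pos p) h k)))))

        ≡ₚ-neg : ∀ {x y} → x ≡ₚ y → - x ≡ₚ - y
        ≡ₚ-neg {x} {y} (cong-mod h h∈ e) = cong-mod (-1ℤ · h) (∈-· -1ℤ h∈) (begin
          - x                          ≈⟨ -‿cong e ⟩
          - (y + pos p · h)            ≈⟨ -‿+-comm y (pos p · h) ⟨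
          - y + - (pos p · h)          ≈⟨ +-congˡ (neg-· (pos p) h) ⟨
          - y + (ℤ.- pos p) · h        ≈⟨ +-congˡ (·-congˡ h (≡.sym (≡.trans
                                            (ℤ.*-comm (pos p) -1ℤ) (ℤ.-1*i≡-i (pos p))))) ⟩
          - y + (pos p ℤ.* -1ℤ) · h    ≈⟨ +-congˡ (·-* (pos p) -1ℤ h) ⟩
          - y + pos p · -1ℤ · h        ∎)

        ≡ₚ-*ʳ : ∀ {x y w} → ℤ[z] w → x ≡ₚ y → x * w ≡ₚ y * w
        ≡ₚ-*ʳ {x} {y} {w} w∈ (cong-mod h h∈ e) = cong-mod (h * w) (∈-* h∈ w∈)
          (trans (*-congʳ e) (trans (distribʳ w y _) (+-congˡ (·-assoc (pos p) h w))))

        sum-≡ₚ-0 : ∀ {n} {f : Fin n → Carrier} → (∀ i → f i ≡ₚ 0#) → sum f ≡ₚ 0#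
        sum-≡ₚ-0 {zero}  h = ≈⇒≡ₚ refl
        sum-≡ₚ-0 {suc n} h = ≡ₚ-trans (≡ₚ-+ (h zero) (sum-≡ₚ-0 (h ∘ suc))) (≈⇒≡ₚ (+-identityˡ 0#))

      module Freshman {p′ : ℕ} (pr : Prime (suc p′)) where

        open import Data.Nat.Combinatorics using (_C_; nCn≡1)

        p : ℕ
        p = suc p′

        open Congruence p

        -- Once the two extreme terms of the binomial expansion are split off, all remaining
        -- coefficients are divisible by `p`.
        freshman : ∀ {x y} → ℤ[z] x → ℤ[z] y → (x + y) ^ p ≡ₚ x ^ p + y ^ p
        freshman {x} {y} x∈ y∈ = ≡ₚ-trans (≈⇒≡ₚ expand)
          (≡ₚ-trans (≡ₚ-+ (≈⇒≡ₚ first) (≡ₚ-+ (sum-≡ₚ-0 middle) (≈⇒≡ₚ final)))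
          (≈⇒≡ₚ (trans (+-congˡ (+-identityˡ _)) (+-comm _ _))))
          where
          open import Algebra.Properties.CommutativeSemiring.Binomial commutativeSemiring
            using (binomialTerm) renaming (theorem to binomial-theorem)
          term : Fin (suc p) → Carrier
          term = binomialTerm x y p
          expand : (x + y) ^ p ≈ term zero + (sum (λ i → term (suc (inject₁ i))) + term
              (suc (fromℕ p′)))
          expand = trans (binomial-theorem p x y) (+-congˡ (sum-init-last (term ∘ suc)))
          first : term zero ≈ y ^ p
          first = trans (+-identityʳ _) (*-identityˡ _)
          final : term (suc (fromℕ p′)) ≈ x ^ p
          final = begin
            (p C suc (toℕ (fromℕ p′))) ×# (x ^ suc (toℕ (fromℕ p′)) * y ^ (p′ ∸ toℕ (fromℕ p′)))
              ≡⟨ ≡.cong (λ k → (p C suc k) ×# (x ^ suc k * y ^ (p′ ∸ k))) (toℕ-fromℕ p′) ⟩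
            (p C p) ×# (x ^ p * y ^ (p′ ∸ p′))
              ≡⟨ ≡.cong₂ (λ c k → c ×# (x ^ p * y ^ k)) (nCn≡1 p) (ℕ.n∸n≡0 p′) ⟩
            1 ×# (x ^ p * 1#)  ≈⟨ trans (+-identityʳ _) (*-identityʳ _) ⟩
            x ^ p              ∎
          middle : ∀ i → term (suc (inject₁ i)) ≡ₚ 0#
          middle i with prime∣C pr (suc (toℕ (inject₁ i))) ℕ.z<s
            (ℕ.s<s (≡.subst (_< p′) (≡.sym (toℕ-inject₁ i)) (toℕ<n i)))
          ... | divides q eq = cong-mod (pos q · m)
              (∈-· (pos q) (∈-* (∈-^ (suc k) x∈) (∈-^ (p ∸ suc k) y∈))) (begin
              (p C suc k) ×# m       ≡⟨ ≡.cong (_×# m) (≡.trans eq (ℕ.*-comm q p)) ⟩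
              (p ℕ.* q) ×# m         ≈⟨ ×-assocˡ m p q ⟨
              pos p · pos q · m      ≈⟨ +-identityˡ _ ⟨
              0# + pos p · pos q · m ∎)
            where
            k = toℕ (inject₁ i)
            m = x ^ suc k * y ^ (p ∸ suc k)

      module Frobenius {p : ℕ} (pr : Prime p) where

        open Congruence p

        instance _ = prime⇒nonZero pr

        freshman : ∀ {x y} → ℤ[z] x → ℤ[z] y → (x + y) ^ p ≡ₚ x ^ p + y ^ p
        freshman = go pr
          where
          go : ∀ {p} → Prime p → ∀ {x y} → ℤ[z] x → ℤ[z] y →
               Congruence._≡ₚ_ p ((x + y) ^ p) (x ^ p + y ^ p)
          go {zero}   pr = contradiction (prime>1 pr) λ ()
          go {suc p′} pr = Freshman.freshman pr

        fermat-nat : ∀ n → (pos n · 1#) ^ p ≡ₚ pos n · 1#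
        fermat-nat zero    = ≈⇒≡ₚ (0^ p)
        fermat-nat (suc n) = ≡ₚ-trans (freshman ∈-1# (∈-· (pos n) ∈-1#))
          (≡ₚ-+ (≈⇒≡ₚ (1^ p)) (fermat-nat n))

        -- `x ^ p + (- x) ^ p` is congruent to `(x + - x) ^ p`, which is 0; this treats `p = 2` and
        -- odd primes alike.
        negate-^ : ∀ {x} → ℤ[z] x → (- x) ^ p ≡ₚ - (x ^ p)
        negate-^ {x} x∈ = ≡ₚ-trans (≈⇒≡ₚ (sym cancelled))
          (≡ₚ-trans (≡ₚ-+ (≈⇒≡ₚ refl) sum≡0) (≈⇒≡ₚ (+-identityʳ _)))
          where
          -x∈ : ℤ[z] (- x)
          -x∈ = ∈-≈ (trans (sym (-‿cong (1·x≈x x))) (sym (neg-· 1ℤ x))) (∈-· ℤ.-1ℤ x∈)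
          cancelled : - (x ^ p) + (x ^ p + (- x) ^ p) ≈ (- x) ^ p
          cancelled = trans (sym (+-assoc _ _ _)) (trans (+-congʳ (-‿inverseˡ _)) (+-identityˡ _))
          sum≡0 : x ^ p + (- x) ^ p ≡ₚ 0#
          sum≡0 with cong-mod h h∈ e ← freshman x∈ -x∈ = cong-mod (-1ℤ · h) (∈-· -1ℤ h∈) (begin
            s                                   ≈⟨ +-identityʳ s ⟨
            s + 0#                              ≈⟨ +-congˡ (-‿inverseʳ (pos p · h)) ⟨
            s + (pos p · h + - (pos p · h))     ≈⟨ +-assoc _ _ _ ⟨
            s + pos p · h + - (pos p · h)       ≈⟨ +-congʳ e ⟨
            (x + - x) ^ p + - (pos p · h)       ≈⟨ +-cong (trans (^-congˡ p (-‿inverseʳ x)) (0^ p))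
                                                     (sym (neg-· (pos p) h)) ⟩
            0# + (ℤ.- pos p) · h                ≈⟨ +-congˡ (·-congˡ h (≡.sym (≡.trans
                                                     (ℤ.*-comm (pos p) -1ℤ) (ℤ.-1*i≡-i (pos p))))) ⟩
            0# + (pos p ℤ.* -1ℤ) · h            ≈⟨ +-congˡ (·-* (pos p) -1ℤ h) ⟩
            0# + pos p · -1ℤ · h                ∎)
            where
            s = x ^ p + (- x) ^ p

        fermat : ∀ a → (a · 1#) ^ p ≡ₚ a · 1#
        fermat (pos n)  = fermat-nat n
        fermat -[1+ n ] = ≡ₚ-trans (negate-^ (∈-· (pos (suc n)) ∈-1#)) (≡ₚ-neg (fermat-nat (suc n)))

        -- Additivity is `freshman`, and the integer coefficients are fixed by Fermat's little
        -- theorem.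
        frobenius : ∀ l → eval z l ^ p ≡ₚ eval (z ^ p) l
        frobenius []            = ≈⇒≡ₚ (0^ p)
        frobenius ((a , e) ∷ l) = ≡ₚ-trans (freshman (∈-· a (∈-z^ e)) (l , refl))
          (≡ₚ-+ (≡ₚ-trans (≈⇒≡ₚ split)
                   (≡ₚ-trans (≡ₚ-*ʳ (∈-^ p (∈-z^ e)) (fermat a)) (≈⇒≡ₚ join)))
                (frobenius l))
          where
          split : (a · z ^ e) ^ p ≈ (a · 1#) ^ p * (z ^ e) ^ p
          split = trans (^-congˡ p (·-as-* a (z ^ e))) (^-distrib-* _ _ p)
          join : a · 1# * (z ^ e) ^ p ≈ a · (z ^ p) ^ e
          join = trans (sym (·-as-* a _)) (·-congʳ a (trans (^-assocʳ z e p)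
            (trans (reflexive (≡.cong (z ^_) (ℕ.*-comm e p))) (sym (^-assocʳ z p e)))))

  -- The substitute for a field of characteristic 0 with decidable equality: equations may be proved
  -- by contradiction, and a factor can be cancelled as soon as it is not zero, without an inverse
  -- for it.
  record StableDomain (R : CommutativeRing 0ℓ 0ℓ) : Set where
    open RingSums R
    field
      stable : ∀ {x y} → ¬ ¬ x ≈ y → x ≈ y
      cancel : ∀ {x y} → x * y ≈ 0# → ¬ x ≈ 0# → y ≈ 0#
      char-0 : ∀ n → ¬ pos (suc n) · 1# ≈ 0#

  -- Galois conjugation by large primes.

  module Galois (R : CommutativeRing 0ℓ 0ℓ) (dom : StableDomain R) where

    open RingSums R public
    open StableDomain dom public

    1≉0 : ¬ 1# ≈ 0#
    1≉0 e = char-0 0 (trans (1·x≈x 1#) e)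

    char-0ℤ : ∀ {a} → a ≢ 0ℤ → ¬ a · 1# ≈ 0#
    char-0ℤ {pos zero}    a≢0 e = a≢0 ≡.refl
    char-0ℤ {pos (suc n)} a≢0 e = char-0 n e
    char-0ℤ { -[1+ n ]}   a≢0 e = char-0 n (begin
      pos (suc n) · 1#    ≈⟨ neg-· -[1+ n ] 1# ⟩
      - (-[1+ n ] · 1#)   ≈⟨ -‿cong e ⟩
      - 0#                ≈⟨ -‿unique 0# 0# (+-identityˡ 0#) ⟨
      0#                  ∎)

    ·-cancel : ∀ {a x} → a ≢ 0ℤ → a · x ≈ 0# → x ≈ 0#
    ·-cancel {a} {x} a≢0 e = cancel (trans (sym (·-as-* a x)) e) (char-0ℤ a≢0)

    lincomb : ∀ {s} → (Fin s → ℤ) → (Fin s → Carrier) → Carrier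
    lincomb c w = sum λ l → c l · w l

    lincomb-+ : ∀ {s} (c d : Fin s → ℤ) w → lincomb (λ l → c l ℤ.+ d l) w ≈ lincomb c w + lincomb
        d w
    lincomb-+ c d w = trans (sum-cong-≋ λ l → ·-+ (c l) (d l) (w l))
      (∑-distrib-+ (λ l → c l · w l) (λ l → d l · w l))

    lincomb-· : ∀ {s} a (c : Fin s → ℤ) w → lincomb (λ l → a ℤ.* c l) w ≈ a · lincomb c w
    lincomb-· {zero}  a c w = sym (·-0# a)
    lincomb-· {suc s} a c w = trans (+-cong (·-* a (c zero) (w zero))
        (lincomb-· a (c ∘ suc) (w ∘ suc)))
      (sym (·-distrib a _ _))

    Independent : ∀ {s} → (Fin s → Carrier) → Set
    Independent w = ∀ c → lincomb c w ≈ 0# → ∀ l → c l ≡ 0ℤ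

    -- An independent family in which all `z e` have integer coordinates after multiplication by the
    -- common denominator `scale`. It does the work of a power basis, without cyclotomic polynomials
    -- and their irreducibility.
    record Coordinates {n} (z : Fin n → Carrier) : Set where
      field
        {size}      : ℕ
        basis       : Fin size → Carrier
        independent : Independent basis
        scale       : ℤ
        scale≢0     : scale ≢ 0ℤ
        coeff       : Fin n → Fin size → ℤ
        expand      : ∀ e → scale · z e ≈ lincomb (coeff e) basis

    -- The elements are added one by one. Whether a new one already lies in the rational span of the
    -- family is undecidable, hence the double negation.
    coordinates : ∀ {n} (z : Fin n → Carrier) → ¬ ¬ Coordinates z
    coordinates {zero}  z k = k record
      { size = 0 ; basis = λ () ; independent = λ c e () ; scale = 1ℤ ; scale≢0 = λ ()
      ; coeff = λ () ; expand = λ () }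
    coordinates {suc n} z k = coordinates (z ∘ suc) λ C → excluded-middle λ where
        (yes d) → k (dependent C d)
        (no ¬d) → k (extended C ¬d)
      where
      open Coordinates
      InSpan : Coordinates (z ∘ suc) → Set
      InSpan C = ∃[ b ] b ≢ 0ℤ × ∃[ c ] b · z zero ≈ lincomb c (basis C)
      dependent : ∀ C → InSpan C → Coordinates z
      dependent C (b , b≢0 , c , e) = record
        { basis = basis C ; independent = independent C
        ; scale = scale C ℤ.* b ; scale≢0 = *-≢0 (scale≢0 C) b≢0
        ; coeff = (λ l → scale C ℤ.* c l) ◂ λ e l → b ℤ.* coeff C e l
        ; expand = λ where
            zero    → trans (·-* (scale C) b _) (trans (·-congʳ (scale C) e)
              (sym (lincomb-· (scale C) c (basis C))))
            (suc i) → trans (·-congˡ _ (ℤ.*-comm (scale C) b)) (trans (·-* b (scale C) _)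
              (trans (·-congʳ b (expand C i)) (sym (lincomb-· b (coeff C i) (basis C)))))
        }
      extended : ∀ C → ¬ InSpan C → Coordinates z
      extended C ¬d = record
        { basis = z zero ◂ basis C ; independent = indep
        ; scale = scale C ; scale≢0 = scale≢0 C
        ; coeff = (scale C ◂ λ _ → 0ℤ) ◂ λ e → 0ℤ ◂ coeff C e
        ; expand = λ where
            zero    → sym (trans (+-congˡ (sum-0# {size C} (λ _ → 0#) λ _ → refl)) (+-identityʳ _))
            (suc i) → trans (expand C i) (sym (+-identityˡ _))
        }
        where
        indep : Independent (z zero ◂ basis C)
        indep c e with c zero ℤ.≟ 0ℤ
        ... | yes c₀≡0 = λ where
          zero    → c₀≡0
          (suc l) → independent C (c ∘ suc) (trans (sym (+-identityˡ _))
            (trans (+-congʳ (sym (·-congˡ (z zero) c₀≡0))) e)) l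
        ... | no c₀≢0 = contradiction (c zero , c₀≢0 , (λ l → -1ℤ ℤ.* c (suc l)) , (begin
          c zero · z zero             ≈⟨ -‿unique _ _ e ⟩
          - rest                      ≈⟨ -‿cong (1·x≈x rest) ⟨
          - (1ℤ · rest)               ≈⟨ neg-· 1ℤ rest ⟨
          -1ℤ · rest                  ≈⟨ lincomb-· -1ℤ (c ∘ suc) (basis C) ⟨
          lincomb (λ l → -1ℤ ℤ.* c (suc l)) (basis C) ∎)) ¬d
          where
          rest = lincomb (c ∘ suc) (basis C)

    norm₁ : List (ℤ × ℕ) → ℕ
    norm₁ []            = 0
    norm₁ ((a , e) ∷ l) = abs a ℕ.+ norm₁ l

    module Reduction {Q : ℕ} .{{_ : NonZero Q}} {z : Carrier} (z^Q≈1 : z ^ Q ≈ 1#)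
                     (C : Coordinates {Q} (λ e → z ^ toℕ e)) where

      open Coordinates C

      coordinate : List (ℤ × ℕ) → Fin size → ℤ
      coordinate []            l = 0ℤ
      coordinate ((a , e) ∷ f) l = a ℤ.* coeff (e mod Q) l ℤ.+ coordinate f l

      expand-^ : ∀ e → scale · z ^ e ≈ lincomb (coeff (e mod Q)) basis
      expand-^ e = trans (·-congʳ scale (trans (^-% z^Q≈1 e)
        (reflexive (≡.cong (z ^_) (≡.sym (toℕ-fromℕ< (m%n<n e Q))))))) (expand (e mod Q))

      expand-eval : ∀ f → scale · eval z f ≈ lincomb (coordinate f) basis
      expand-eval []            = trans (·-0# scale) (sym (sum-0# {size} (λ _ → 0#) λ _ → refl))
      expand-eval ((a , e) ∷ f) = begin
        scale · (a · z ^ e + eval z f)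
          ≈⟨ ·-distrib scale _ _ ⟩
        scale · a · z ^ e + scale · eval z f
          ≈⟨ +-cong (trans (sym (·-* scale a _)) (trans (·-congˡ _ (ℤ.*-comm scale a))
              (·-* a scale _)))
                    (expand-eval f) ⟩
        a · scale · z ^ e + lincomb (coordinate f) basis
          ≈⟨ +-congʳ (trans (·-congʳ a (expand-^ e)) (sym (lincomb-· a (coeff (e mod Q)) basis))) ⟩
        lincomb (λ l → a ℤ.* coeff (e mod Q) l) basis + lincomb (coordinate f) basis
          ≈⟨ lincomb-+ (λ l → a ℤ.* coeff (e mod Q) l) (coordinate f) basis ⟨
        lincomb (coordinate ((a , e) ∷ f)) basis ∎

      coefficient-bound : ∃[ K ] (∀ e l → abs (coeff e l) ≤ K)
      coefficient-bound
        with K , h ← bounded-family (λ e → proj₁ (bounded-family (λ l → abs (coeff e l)))) =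
        K , λ e l → ℕ.≤-trans (proj₂ (bounded-family (λ l → abs (coeff e l))) l) (h e)

      -- Exponents enter only modulo `Q`, so the bound depends on the coefficients alone and is the
      -- same for every dilation of `f`.
      coordinate-bound : ∀ {K} → (∀ e l → abs (coeff e l) ≤ K) →
                         ∀ f l → abs (coordinate f l) ≤ norm₁ f ℕ.* K
      coordinate-bound         h []            l = z≤n
      coordinate-bound {K} h ((a , e) ∷ f) l = ℕ.≤-trans
          (ℤ.∣i+j∣≤∣i∣+∣j∣ (a ℤ.* coeff (e mod Q) l) _)
        (≡.subst₂ _≤_ (≡.cong (ℕ._+ abs (coordinate f l)) (≡.sym (ℤ.abs-* a _)))
          (≡.sym (ℕ.*-distribʳ-+ K (abs a) (norm₁ f)))
          (ℕ.+-mono-≤ (ℕ.*-monoʳ-≤ (abs a) (h (e mod Q) l)) (coordinate-bound h f l)))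

      dilate : ℕ → List (ℤ × ℕ) → List (ℤ × ℕ)
      dilate p = map λ (a , e) → a , p ℕ.* e

      norm₁-dilate : ∀ p f → norm₁ (dilate p f) ≡ norm₁ f
      norm₁-dilate p []            = ≡.refl
      norm₁-dilate p ((a , e) ∷ f) = ≡.cong (abs a ℕ.+_) (norm₁-dilate p f)

      eval-dilate : ∀ p f → eval (z ^ p) f ≈ eval z (dilate p f)
      eval-dilate p []            = refl
      eval-dilate p ((a , e) ∷ f) = +-cong (·-congʳ a (^-assocʳ z p e)) (eval-dilate p f)

      -- If f(z) = 0 then f(zᵖ) ∈ p ℤ[z] by Frobenius, while its coordinates are
      -- bounded independently of p.
      large-prime : ∀ f → ∃[ B ] (∀ p → Prime p → B < p → eval z f ≈ 0# → eval (z ^ p) f ≈ 0#)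
      large-prime f with K , bound ← coefficient-bound = norm₁ f ℕ.* K , vanish
        where
        vanish : ∀ p → Prime p → norm₁ f ℕ.* K < p → eval z f ≈ 0# → eval (z ^ p) f ≈ 0#
        vanish p pr B<p e =
          ·-cancel scale≢0 (begin
            scale · eval (z ^ p) f
              ≈⟨ ·-congʳ scale (eval-dilate p f) ⟩
            scale · eval z (dilate p f)
              ≈⟨ expand-eval (dilate p f) ⟩
            lincomb (coordinate (dilate p f)) basis
              ≈⟨ sum-0# (λ l → coordinate (dilate p f) l · basis l)
                  (λ l → ·-congˡ (basis l) (coordinate≡0 l)) ⟩
            0# ∎)
          where
          open Conjugation R
          open Adjoin z
          open import Algebra.Properties.AbelianGroup (CommutativeRing.+-abelianGroup ℤ.+-*-commutativeRing)
            using () renaming (inverseˡ-unique to ℤ-inverse-unique)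
          instance _ = prime⇒nonZero pr
          open Congruence._≡ₚ_ (Frobenius.frobenius pr f) using () renaming (h∈ to h₀∈; eq to fz^p)
          m = proj₁ h₀∈
          h≈ = proj₂ h₀∈
          minus-h : eval (z ^ p) f + pos p · eval z m ≈ 0#
          minus-h = trans (+-congˡ (·-congʳ (pos p) (sym h≈))) (trans (sym fz^p)
            (trans (^-congˡ p e) (0^ p)))
          -- Frobenius gives `f(z)ᵖ = f(zᵖ) + p m(z)` with left side zero; independence of the basis
          -- turns this into an equation between integer coordinates.
          relation : ∀ l → coordinate (dilate p f) l ℤ.+ pos p ℤ.* coordinate m l ≡ 0ℤ
          relation = independent _ (begin
            lincomb (λ l → coordinate (dilate p f) l ℤ.+ pos p ℤ.* coordinate m l) basis
              ≈⟨ lincomb-+ (coordinate (dilate p f)) (λ l → pos p ℤ.* coordinate m l) basis ⟩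
            lincomb (coordinate (dilate p f)) basis + lincomb (λ l → pos p ℤ.* coordinate m l) basis
              ≈⟨ +-cong (expand-eval (dilate p f)) (trans (·-congʳ (pos p) (expand-eval m))
                   (sym (lincomb-· (pos p) (coordinate m) basis))) ⟨
            scale · eval z (dilate p f) + pos p · scale · eval z m
              ≈⟨ +-cong (·-congʳ scale (sym (eval-dilate p f)))
                   (trans (sym (·-* (pos p) scale _)) (trans (·-congˡ _ (ℤ.*-comm (pos p) scale))
                     (·-* scale (pos p) _))) ⟩
            scale · eval (z ^ p) f + scale · pos p · eval z m
              ≈⟨ ·-distrib scale _ _ ⟨
            scale · (eval (z ^ p) f + pos p · eval z m)
              ≈⟨ trans (·-congʳ scale minus-h) (·-0# scale) ⟩
            0# ∎)
          p∣ : ∀ l → p ∣ abs (coordinate (dilate p f) l)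
          p∣ l = divides (abs (coordinate m l)) (≡.trans (≡.cong abs (ℤ-inverse-unique
              (coordinate (dilate p f) l) (pos p ℤ.* coordinate m l) (relation l)))
            (≡.trans (ℤ.∣-i∣≡∣i∣ (pos p ℤ.* coordinate m l))
                (≡.trans (ℤ.abs-* (pos p) (coordinate m l))
              (ℕ.*-comm p _))))
          coordinate≡0 : ∀ l → coordinate (dilate p f) l ≡ 0ℤ
          coordinate≡0 l = ℤ.∣i∣≡0⇒i≡0 (small _ (p∣ l) (ℕ.≤-<-trans
            (≡.subst (λ k → abs (coordinate (dilate p f) l) ≤ k ℕ.* K) (norm₁-dilate p f)
              (coordinate-bound bound (dilate p f) l)) B<p))
            where
            small : ∀ k → p ∣ k → k < p → k ≡ 0
            small zero    _  _   = ≡.refl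
            small (suc k) p∣ k<p = contradiction (∣⇒≤ p∣) (ℕ.<⇒≱ k<p)

  -- Subsums are expressed by zeroing coefficients, which keeps the number of terms.
  mask : ∀ {P : Set} → Dec P → ℤ → ℤ
  mask (yes _) a = a
  mask (no _)  a = 0ℤ

  -- Exponents are natural numbers, so `p ∸ c` stands in for `- c` in the congruence `s - c ≡ 0`.
  residue⇒∣ : ∀ {s c p} .{{_ : NonZero p}} → c < p → s % p ≡ c → p ∣ s ℕ.+ (p ∸ c)
  residue⇒∣ {s} {c} {p} c<p ≡.refl = divides (suc (s / p)) (begin
    s ℕ.+ (p ∸ c)                      ≡⟨ ≡.cong (ℕ._+ (p ∸ c)) (m≡m%n+[m/n]*n s p) ⟩
    c ℕ.+ s / p ℕ.* p ℕ.+ (p ∸ c)      ≡⟨ rearrange c (s / p ℕ.* p) (p ∸ c) ⟩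
    c ℕ.+ (p ∸ c) ℕ.+ s / p ℕ.* p      ≡⟨ ≡.cong (ℕ._+ s / p ℕ.* p) (ℕ.m+[n∸m]≡n (ℕ.<⇒≤ c<p)) ⟩
    p ℕ.+ s / p ℕ.* p                  ∎)
    where
    open ≡.≡-Reasoning
    rearrange : ∀ a b c → a ℕ.+ b ℕ.+ c ≡ a ℕ.+ c ℕ.+ b
    rearrange = ℕ-Solver.solve-∀

  ∣⇒residue : ∀ {s c p} .{{_ : NonZero p}} → c < p → p ∣ s ℕ.+ (p ∸ c) → s % p ≡ c
  ∣⇒residue {s} {c} {p} c<p p∣ = begin
    s % p                          ≡⟨ [m+n]%n≡m%n s p ⟨
    (s ℕ.+ p) % p                  ≡⟨ ≡.cong (λ q → (s ℕ.+ q) % p) (ℕ.m∸n+n≡m (ℕ.<⇒≤ c<p)) ⟨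
    (s ℕ.+ (p ∸ c ℕ.+ c)) % p      ≡⟨ ≡.cong (_% p) (ℕ.+-assoc s (p ∸ c) c) ⟨
    (s ℕ.+ (p ∸ c) ℕ.+ c) % p      ≡⟨ %-remove-+ˡ c p∣ ⟩
    c % p                          ≡⟨ m<n⇒m%n≡m c<p ⟩
    c                              ∎
    where open ≡.≡-Reasoning

  -- The difference of the two numbers is `(b - a) Q`, and `p` divides neither `Q` nor the positive
  -- number `b - a` below `p`. So at most one index `j < p` fails to give a conjugation `1 + j * Q`.
  ∣-unique : ∀ {p Q} → Prime p → ¬ p ∣ Q → ∀ {a b} → b < p →
             p ∣ 1 ℕ.+ a ℕ.* Q → p ∣ 1 ℕ.+ b ℕ.* Q → ¬ a < b
  ∣-unique {p} {Q} pr p∤Q {a} {b} b<p p∣a p∣b a<b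
    with euclidsLemma (b ∸ a) Q pr (∣m+n∣m⇒∣n (≡.subst (p ∣_) split p∣b) p∣a)
    where
    split : 1 ℕ.+ b ℕ.* Q ≡ (1 ℕ.+ a ℕ.* Q) ℕ.+ (b ∸ a) ℕ.* Q
    split = ≡.trans (≡.cong (λ b → 1 ℕ.+ b ℕ.* Q) (≡.sym (ℕ.m+[n∸m]≡n (ℕ.<⇒≤ a<b))))
      (≡.cong suc (ℕ.*-distribʳ-+ Q a (b ∸ a)))
  ... | inj₂ p∣Q  = p∤Q p∣Q
  ... | inj₁ p∣ba = ℕ.<⇒≱ (ℕ.≤-<-trans (ℕ.m∸n≤m b a) b<p)
      (∣⇒≤ {{ℕ.>-nonZero (ℕ.m<n⇒0<n∸m a<b)}} p∣ba)

  -- Pigeonhole: fewer than `p` terms cannot occupy all residues. Here the number of terms meets the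
  -- size of the prime, and hence only primes up to `N` survive in Mann's theorem.
  missing-residue : ∀ {I : Set} p .{{_ : NonZero p}} (is : List I) (s : I → ℕ) → length is < p →
                    ∃[ c ] c < p × All (λ i → s i % p ≢ c) is
  missing-residue p is s len<p with any? {n = p} (λ c → ¬? (Any.any? (λ i → s i % p ℕ.≟ toℕ c) is))
  ... | yes (c , none) = toℕ c , toℕ<n c , ¬Any⇒All¬ is none
  ... | no all = contradiction (pigeonhole len<p λ c → Any.index (hit c)) λ where
      (c , c′ , c<c′ , e) → ℕ.<⇒≢ c<c′ (≡.trans (≡.sym (lookup-index (hit c)))
        (≡.trans (≡.cong (λ k → s (List.lookup is k) % p) e) (lookup-index (hit c′))))
    where
    hit : ∀ c → Any (λ i → s i % p ≡ toℕ c) is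
    hit c = decidable-stable (Any.any? (λ i → s i % p ℕ.≟ toℕ c) is) λ ¬h → all (c , ¬h)

  -- Mann's theorem on vanishing sums of roots of unity.

  module MannTheorem (R : CommutativeRing 0ℓ 0ℓ) (dom : StableDomain R) where

    open Galois R dom public

    root-^ : ∀ {z Q} → z ^ Q ≈ 1# → ∀ v → (z ^ v) ^ Q ≈ 1#
    root-^ {z} {Q} e v = trans (^-assocʳ z v Q)
      (trans (reflexive (≡.cong (z ^_) (ℕ.*-comm v Q))) (^-multiple {z} {Q} e v))

    root-≉0 : ∀ {z Q} .{{_ : NonZero Q}} → z ^ Q ≈ 1# → ¬ z ≈ 0#
    root-≉0 {z} {Q} e z≈0 = 1≉0 (trans (sym e) (trans (^-congˡ Q z≈0) (0^ Q)))

    -- The Galois conjugation z ↦ zᵘ: u is congruent modulo Q to a product of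
    -- large primes.
    conjugate : ∀ {Q} .{{_ : NonZero Q}} {z} → z ^ Q ≈ 1# → ∀ f u → 0 < u → Coprime u Q →
                eval z f ≈ 0# → eval (z ^ u) f ≈ 0#
    conjugate {Q} {z} z^Q≈1 f u 0<u u⊥Q fz≈0 = stable λ k →
      ¬¬-bound Q Bounded (λ b≤c h p pr c<p → h p pr (ℕ.≤-<-trans b≤c c<p)) bounded
        λ (B , h) → k (by-primes B h)
      where
      Bounded : Fin Q → ℕ → Set
      Bounded v B = ∀ p → Prime p → B < p →
                    eval (z ^ toℕ v) f ≈ 0# → eval ((z ^ toℕ v) ^ p) f ≈ 0#
      bounded : ∀ v → ¬ ¬ (∃[ B ] Bounded v B)
      bounded v k = coordinates {Q} (λ e → (z ^ toℕ v) ^ toℕ e) λ C →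
        k (Reduction.large-prime (root-^ {z} {Q} z^Q≈1 (toℕ v)) C f)
      by-primes : ∀ B → (∀ v → Bounded v B) → eval (z ^ u) f ≈ 0#
      by-primes B h with t , large ← coprime-shift u Q B u⊥Q = begin
        eval (z ^ u) f
          ≈⟨ eval-cong (trans (trans (sym (*-identityʳ _))
              (*-congˡ (sym (^-multiple {z} {Q} z^Q≈1 t))))
               (sym (^-homo-* z u (Q ℕ.* t)))) f ⟩
        eval (z ^ (u ℕ.+ Q ℕ.* t)) f
          ≡⟨ ≡.cong (λ k → eval (z ^ k) f) (≡.trans isFactorisation (≡.sym (ℕ.*-identityˡ _))) ⟩
        eval (z ^ (1 ℕ.* product factors)) f
          ≈⟨ chain factors 1 factorsPrime (All.tabulate λ {p} p∈ → large p
              (All.lookup factorsPrime p∈)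
               (≡.subst (p ∣_) (≡.sym isFactorisation) (∈⇒∣product p∈)))
               (trans (eval-cong (*-identityʳ z) f) fz≈0) ⟩
        0# ∎
        where
        open PrimeFactorisation (factorise (u ℕ.+ Q ℕ.* t)
          {{ℕ.>-nonZero (ℕ.<-≤-trans 0<u (ℕ.m≤m+n u (Q ℕ.* t)))}})
        chain : ∀ ps v → All Prime ps → All (B <_) ps → eval (z ^ v) f ≈ 0# →
                eval (z ^ (v ℕ.* product ps)) f ≈ 0#
        chain []       v _          _            e =
          trans (reflexive (≡.cong (λ k → eval (z ^ k) f) (ℕ.*-identityʳ v))) e
        chain (p ∷ ps) v (pr ∷ prs) (B<p ∷ B<ps) e =
          trans (reflexive (≡.cong (λ k → eval (z ^ k) f) (≡.sym (ℕ.*-assoc v p (product ps)))))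
            (chain ps (v ℕ.* p) prs B<ps (trans (eval-cong
                (sym (trans (^-congˡ p reduce) (^-assocʳ z v p))) f)
              (h (v mod Q) p pr B<p (trans (eval-cong reduce f) e))))
          where
          reduce : z ^ toℕ (v mod Q) ≈ z ^ v
          reduce = trans (reflexive (≡.cong (z ^_) (toℕ-fromℕ< (m%n<n v Q)))) (sym (^-% z^Q≈1 v))

    geometric : ∀ n y → y * sum (λ (j : Fin n) → y ^ toℕ j) + 1# ≈ sum (λ (j : Fin n) → y ^ toℕ j)
        + y ^ n
    geometric zero    y = +-congʳ (zeroʳ y)
    geometric (suc n) y = begin
      y * (1# + G′) + 1#         ≈⟨ +-comm _ _ ⟩
      1# + y * (1# + G′)         ≈⟨ +-congˡ (*-congˡ (+-congˡ G′≈)) ⟩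
      1# + y * (1# + y * G)      ≈⟨ +-congˡ (*-congˡ (trans (+-comm _ _) (geometric n y))) ⟩
      1# + y * (G + y ^ n)       ≈⟨ +-congˡ (distribˡ y G (y ^ n)) ⟩
      1# + (y * G + y * y ^ n)   ≈⟨ +-assoc 1# _ _ ⟨
      1# + y * G + y * y ^ n     ≈⟨ +-congʳ (+-congˡ (sym G′≈)) ⟩
      1# + G′ + y ^ suc n        ∎
      where
      G = sum (λ (j : Fin n) → y ^ toℕ j)
      G′ = sum (λ (j : Fin n) → y * y ^ toℕ j)
      G′≈ : G′ ≈ y * G
      G′≈ = sym (*-distribˡ-sum y (λ (j : Fin n) → y ^ toℕ j))

    geometric-root : ∀ n y → y ^ n ≈ 1# → ¬ y ≈ 1# → sum (λ (j : Fin n) → y ^ toℕ j) ≈ 0#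
    geometric-root n y y^n≈1 y≉1 = cancel (begin
      (y + - 1#) * G           ≈⟨ distribʳ G y (- 1#) ⟩
      y * G + - 1# * G         ≈⟨ +-cong y*G≈G (trans (sym (-‿distribˡ-* 1# G))
          (-‿cong (*-identityˡ G))) ⟩
      G + - G                  ≈⟨ -‿inverseʳ G ⟩
      0#                       ∎) λ e → y≉1 (begin
        y                  ≈⟨ +-identityʳ y ⟨
        y + 0#             ≈⟨ +-congˡ (-‿inverseˡ 1#) ⟨
        y + (- 1# + 1#)    ≈⟨ +-assoc y _ _ ⟨
        y + - 1# + 1#      ≈⟨ +-congʳ e ⟩
        0# + 1#            ≈⟨ +-identityˡ 1# ⟩
        1#                 ∎)
      where
      G = sum (λ (j : Fin n) → y ^ toℕ j)
      y*G≈G : y * G ≈ G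
      y*G≈G = begin
        y * G                    ≈⟨ +-identityʳ _ ⟨
        y * G + 0#               ≈⟨ +-congˡ (-‿inverseʳ 1#) ⟨
        y * G + (1# + - 1#)      ≈⟨ +-assoc _ _ _ ⟨
        y * G + 1# + - 1#        ≈⟨ +-congʳ (trans (geometric n y) (+-congˡ y^n≈1)) ⟩
        G + 1# + - 1#            ≈⟨ +-assoc _ _ _ ⟩
        G + (1# + - 1#)          ≈⟨ +-congˡ (-‿inverseʳ 1#) ⟩
        G + 0#                   ≈⟨ +-identityʳ G ⟩
        G                        ∎

    geometric-one : ∀ n y → y ≈ 1# → sum (λ (j : Fin n) → y ^ toℕ j) ≈ pos n · 1#
    geometric-one n y y≈1 = trans (sum-cong-≋ {n} {λ j → y ^ toℕ j} {λ _ → 1#} λ j → trans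
        (^-congˡ (toℕ j) y≈1) (1^ (toℕ j))) (ones n)
      where
      ones : ∀ n → sum {n} (λ _ → 1#) ≈ pos n · 1#
      ones zero    = refl
      ones (suc n) = +-congˡ (ones n)

    record Primitive (z : Carrier) (Q : ℕ) : Set where
      field
        ^-order  : z ^ Q ≈ 1#
        order-∣  : ∀ j → z ^ j ≈ 1# → Q ∣ j

    open Primitive public

    -- The conjugations by `1 + j * Q` multiply `η` by the powers of the `p`-th root of unity
    -- `η ^ Q`. A discrete Fourier transform over these `p` conjugates of the relation isolates the
    -- terms with a given exponent modulo `p`.
    module Step {I : Set} {p : ℕ} (pr : Prime p) {Q : ℕ} (0<Q : 0 < Q) {η : Carrier}
                (prim : Primitive η (p ℕ.* Q)) (is : List I) (a : I → ℤ) (s : I → ℕ)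
                (vanish : ∑ is (λ i → a i · η ^ s i) ≈ 0#) where

      instance
        _ = prime⇒nonZero pr
        _ = ℕ.>-nonZero 0<Q
        _ = ℕ.m*n≢0 p Q

      S : ℕ → Carrier
      S j = ∑ is λ i → a i · (η ^ (1 ℕ.+ j ℕ.* Q)) ^ s i

      -- `1 + j * Q` is automatically prime to `Q`, so divisibility by `p` is the only obstruction
      -- to conjugating.
      S≈0 : ∀ j → ¬ p ∣ 1 ℕ.+ j ℕ.* Q → S j ≈ 0#
      S≈0 j p∤ = trans (∑-eval (η ^ (1 ℕ.+ j ℕ.* Q)) is a s)
        (conjugate {p ℕ.* Q} (^-order prim) (map (λ i → a i , s i) is) (1 ℕ.+ j ℕ.* Q) ℕ.z<s
          (coprime-by-primes (ℕ.>-nonZero⁻¹ (p ℕ.* Q)) no-common)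
          (trans (sym (∑-eval η is a s)) vanish))
        where
        no-common : ∀ q → Prime q → q ∣ p ℕ.* Q → ¬ q ∣ 1 ℕ.+ j ℕ.* Q
        no-common q qr q∣pQ q∣u with euclidsLemma p Q qr q∣pQ
        ... | inj₁ q∣p = p∤ (≡.subst (_∣ 1 ℕ.+ j ℕ.* Q) (prime∣prime qr pr q∣p) q∣u)
        ... | inj₂ q∣Q = prime∤1 qr (∣m+n∣m⇒∣n (≡.subst (q ∣_) (ℕ.+-comm 1 (j ℕ.* Q)) q∣u)
            (∣n⇒∣m*n j q∣Q))

      σ : ℕ → Carrier
      σ c = ∑ is λ i → mask (s i % p ℕ.≟ c) (a i) · η ^ s i

      -- The Fourier weight `(η ^ Q) ^ (- c)`, with `p ∸ c` keeping the exponent natural.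
      twist : ℕ → Carrier
      twist c = η ^ (Q ℕ.* (p ∸ c))

      term : ∀ c j i → twist c ^ j * (a i · (η ^ (1 ℕ.+ j ℕ.* Q)) ^ s i) ≈
                       a i · (η ^ s i * (η ^ (Q ℕ.* (s i ℕ.+ (p ∸ c)))) ^ j)
      term c j i = trans (·-comm (a i) _ _) (·-congʳ (a i) (begin
        twist c ^ j * (η ^ (1 ℕ.+ j ℕ.* Q)) ^ s i
          ≈⟨ *-cong (^-assocʳ η (Q ℕ.* (p ∸ c)) j) (^-assocʳ η (1 ℕ.+ j ℕ.* Q) (s i)) ⟩
        η ^ (Q ℕ.* (p ∸ c) ℕ.* j) * η ^ ((1 ℕ.+ j ℕ.* Q) ℕ.* s i)
          ≈⟨ ^-homo-* η (Q ℕ.* (p ∸ c) ℕ.* j) ((1 ℕ.+ j ℕ.* Q) ℕ.* s i) ⟨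
        η ^ (Q ℕ.* (p ∸ c) ℕ.* j ℕ.+ (1 ℕ.+ j ℕ.* Q) ℕ.* s i)
          ≡⟨ ≡.cong (η ^_) (rearrange Q (p ∸ c) j (s i)) ⟩
        η ^ (s i ℕ.+ Q ℕ.* (s i ℕ.+ (p ∸ c)) ℕ.* j)
          ≈⟨ ^-homo-* η (s i) (Q ℕ.* (s i ℕ.+ (p ∸ c)) ℕ.* j) ⟩
        η ^ s i * η ^ (Q ℕ.* (s i ℕ.+ (p ∸ c)) ℕ.* j)
          ≈⟨ *-congˡ (^-assocʳ η (Q ℕ.* (s i ℕ.+ (p ∸ c))) j) ⟨
        η ^ s i * (η ^ (Q ℕ.* (s i ℕ.+ (p ∸ c)))) ^ j ∎))
        where
        rearrange : ∀ Q c j s → Q ℕ.* c ℕ.* j ℕ.+ (1 ℕ.+ j ℕ.* Q) ℕ.* s ≡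
                                s ℕ.+ Q ℕ.* (s ℕ.+ c) ℕ.* j
        rearrange = ℕ-Solver.solve-∀

      -- The sum over `j` is a geometric sum in a `p`-th root of unity that equals 1 exactly when
      -- `s i` is congruent to `c` modulo `p`.
      orthogonality : ∀ c → c < p → ∀ i →
        sum (λ (j : Fin p) → a i · (η ^ s i * (η ^ (Q ℕ.* (s i ℕ.+ (p ∸ c)))) ^ toℕ j)) ≈
        pos p · (mask (s i % p ℕ.≟ c) (a i) · η ^ s i)
      orthogonality c c<p i = trans (begin
        sum (λ (j : Fin p) → a i · (η ^ s i * y ^ toℕ j))
          ≈⟨ sum-· (λ (j : Fin p) → η ^ s i * y ^ toℕ j) ⟨
        a i · sum (λ (j : Fin p) → η ^ s i * y ^ toℕ j)
          ≈⟨ ·-congʳ (a i) (*-distribˡ-sum (η ^ s i) (λ (j : Fin p) → y ^ toℕ j)) ⟨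
        a i · (η ^ s i * sum (λ (j : Fin p) → y ^ toℕ j)) ∎) select
        where
        y = η ^ (Q ℕ.* (s i ℕ.+ (p ∸ c)))
        sum-· : ∀ {n} (f : Fin n → Carrier) → a i · sum f ≈ sum (λ j → a i · f j)
        sum-· {zero}  f = ·-0# (a i)
        sum-· {suc n} f = trans (·-distrib (a i) _ _) (+-congˡ (sum-· (f ∘ suc)))
        y^p≈1 : y ^ p ≈ 1#
        y^p≈1 = trans (^-assocʳ η (Q ℕ.* (s i ℕ.+ (p ∸ c))) p) (trans (reflexive (≡.cong (η ^_)
          (rearrange Q (s i ℕ.+ (p ∸ c)) p))) (^-multiple {η} {p ℕ.* Q} (^-order prim)
              (s i ℕ.+ (p ∸ c))))
          where
          rearrange : ∀ Q t p → Q ℕ.* t ℕ.* p ≡ p ℕ.* Q ℕ.* t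
          rearrange = ℕ-Solver.solve-∀
        select : a i · (η ^ s i * sum (λ (j : Fin p) → y ^ toℕ j)) ≈
                 pos p · (mask (s i % p ℕ.≟ c) (a i) · η ^ s i)
        select with s i % p ℕ.≟ c
        ... | yes e with divides q eq ← residue⇒∣ c<p e = begin
          a i · (η ^ s i * sum (λ (j : Fin p) → y ^ toℕ j))
            ≈⟨ ·-congʳ (a i) (*-congˡ (geometric-one p y y≈1)) ⟩
          a i · (η ^ s i * pos p · 1#)
            ≈⟨ ·-congʳ (a i) (trans (·-comm (pos p) _ _) (·-congʳ (pos p) (*-identityʳ _))) ⟩
          a i · pos p · η ^ s i
            ≈⟨ trans (sym (·-* (a i) (pos p) _)) (trans (·-congˡ _ (ℤ.*-comm (a i) (pos p)))
                (·-* (pos p) (a i) _)) ⟩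
          pos p · a i · η ^ s i ∎
          where
          y≈1 : y ≈ 1#
          y≈1 = trans (reflexive (≡.cong (η ^_) (≡.trans (≡.cong (Q ℕ.*_) eq) (rearrange Q q p))))
            (^-multiple {η} {p ℕ.* Q} (^-order prim) q)
            where
            rearrange : ∀ Q q p → Q ℕ.* (q ℕ.* p) ≡ p ℕ.* Q ℕ.* q
            rearrange = ℕ-Solver.solve-∀
        ... | no ne = begin
          a i · (η ^ s i * sum (λ (j : Fin p) → y ^ toℕ j))
            ≈⟨ ·-congʳ (a i) (trans (*-congˡ (geometric-root p y y^p≈1 y≉1)) (zeroʳ _)) ⟩
          a i · 0#                ≈⟨ ·-0# (a i) ⟩
          0#                      ≈⟨ ·-0# (pos p) ⟨
          pos p · 0#              ∎
          where
          y≉1 : ¬ y ≈ 1#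
          y≉1 e = ne (∣⇒residue c<p (*-cancelˡ-∣ Q
              (≡.subst (_∣ Q ℕ.* (s i ℕ.+ (p ∸ c))) (ℕ.*-comm p Q)
            (order-∣ prim _ e))))

      inversion : ∀ c → c < p → sum (λ (j : Fin p) → twist c ^ toℕ j * S (toℕ j)) ≈ pos p · σ c
      inversion c c<p = begin
        sum (λ (j : Fin p) → twist c ^ toℕ j * S (toℕ j))
          ≈⟨ sum-cong-≋ (λ (j : Fin p) → trans (∑-*ˡ is (twist c ^ toℕ j) _)
              (∑-cong is (term c (toℕ j)))) ⟩
        sum (λ (j : Fin p) → ∑ is λ i → a i · (η ^ s i * (η ^ (Q ℕ.* (s i ℕ.+ (p ∸ c)))) ^ toℕ j))
          ≈⟨ ∑-swap {n = p} is (λ j i → a i · (η ^ s i * (η ^ (Q ℕ.* (s i ℕ.+ (p ∸ c)))) ^ toℕ j)) ⟩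
        ∑ is (λ i → sum (λ (j : Fin p) → a i · (η ^ s i * (η ^ (Q ℕ.* (s i ℕ.+ (p ∸ c)))) ^ toℕ j)))
          ≈⟨ ∑-cong is (orthogonality c c<p) ⟩
        ∑ is (λ i → pos p · (mask (s i % p ℕ.≟ c) (a i) · η ^ s i))
          ≈⟨ ∑-· is (pos p) _ ⟨
        pos p · σ c ∎

      p≢0 : pos p ≢ 0ℤ
      p≢0 e = ℕ.≢-nonZero⁻¹ p (ℤ.+-injective e)

      ∤-tail : ∀ j → p ∣ 1 ℕ.+ j ℕ.* Q → ¬ p ∣ Q
      ∤-tail j p∣ p∣Q = prime∤1 pr
        (∣m+n∣m⇒∣n (≡.subst (p ∣_) (ℕ.+-comm 1 (j ℕ.* Q)) p∣) (∣n⇒∣m*n j p∣Q))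

      other-residues : ∀ j₀ j → j₀ < p → j < p → p ∣ 1 ℕ.+ j₀ ℕ.* Q → j ≢ j₀ →
                       ¬ p ∣ 1 ℕ.+ j ℕ.* Q
      other-residues j₀ j j₀<p j<p p∣j₀ j≢j₀ p∣j with ℕ.<-cmp j j₀
      ... | tri< j<j₀ _ _ = ∣-unique pr (∤-tail j₀ p∣j₀) j₀<p p∣j p∣j₀ j<j₀
      ... | tri≈ _ j≡j₀ _ = j≢j₀ j≡j₀
      ... | tri> _ _ j₀<j = ∣-unique pr (∤-tail j₀ p∣j₀) j<p p∣j₀ p∣j j₀<j

      -- If `p ∣ Q`, then `p` divides no `1 + j * Q`. Otherwise at most one index is bad. With fewer
      -- than `p` terms some residue class `c` is empty, so inversion at `c` yields zero; only the
      -- bad summand is left in it, and its twist is a root of unity, hence can be cancelled.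
      all-S≈0 : p ∣ Q ⊎ length is < p → ∀ (j : Fin p) → S (toℕ j) ≈ 0#
      all-S≈0 hyp j with any? {n = p} (λ j → p ∣? 1 ℕ.+ toℕ j ℕ.* Q)
      all-S≈0 hyp j | no none = S≈0 (toℕ j) λ p∣ → none (j , p∣)
      all-S≈0 (inj₁ p∣Q) j | yes (j₀ , p∣) = contradiction p∣Q (∤-tail (toℕ j₀) p∣)
      all-S≈0 (inj₂ len<p) j | yes (j₀ , p∣) with toℕ j ℕ.≟ toℕ j₀
      ... | no j≢j₀ = S≈0 (toℕ j) (other-residues _ _ (toℕ<n j₀) (toℕ<n j) p∣ j≢j₀)
      ... | yes j≡j₀ with c , c<p , miss ← missing-residue p is s len<p =
        cancel (begin
          twist c ^ toℕ j * S (toℕ j)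
            ≈⟨ sum-at# (λ (j : Fin p) → twist c ^ toℕ j * S (toℕ j)) j (λ j′ j′≢j →
                 trans (*-congˡ (S≈0 (toℕ j′) (other-residues _ _ (toℕ<n j₀) (toℕ<n j′) p∣
                   λ j′≡j₀ → j′≢j (toℕ-injective (≡.trans j′≡j₀ (≡.sym j≡j₀)))))) (zeroʳ _)) ⟨
          sum (λ (j : Fin p) → twist c ^ toℕ j * S (toℕ j))
            ≈⟨ inversion c c<p ⟩
          pos p · σ c
            ≈⟨ ·-congʳ (pos p) (trans (∑-congᴬ (All.map no-term miss)) (∑-0 is λ _ → refl)) ⟩
          pos p · 0#
            ≈⟨ ·-0# (pos p) ⟩
          0# ∎)
          (root-≉0 {Q = p ℕ.* Q} (root-^ {twist c} {p ℕ.* Q}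
            (root-^ {η} {p ℕ.* Q} (^-order prim) (Q ℕ.* (p ∸ c))) (toℕ j)))
        where
        no-term : ∀ {i} → s i % p ≢ c → mask (s i % p ℕ.≟ c) (a i) · η ^ s i ≈ 0#
        no-term {i} ne with s i % p ℕ.≟ c
        ... | yes e = contradiction e ne
        ... | no _  = refl

      class-sum : p ∣ Q ⊎ length is < p → ∀ c → c < p → σ c ≈ 0#
      class-sum hyp c c<p = ·-cancel p≢0 (trans (sym (inversion c c<p))
        (sum-0# (λ (j : Fin p) → twist c ^ toℕ j * S (toℕ j)) λ j →
          trans (*-congˡ (all-S≈0 hyp j)) (zeroʳ _)))

    primitive-^ : ∀ {η p Q} .{{_ : NonZero p}} → Primitive η (p ℕ.* Q) → Primitive (η ^ p) Q
    primitive-^ {η} {p} {Q} prim = record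
      { ^-order = trans (^-assocʳ η p Q) (^-order prim)
      ; order-∣ = λ j e → *-cancelˡ-∣ p (order-∣ prim (p ℕ.* j) (trans (sym (^-assocʳ η p j)) e))
      }

    mask-⇔ : ∀ {P Q : Set} (P? : Dec P) (Q? : Dec Q) →
      (P → Q) → (Q → P) → ∀ a → mask P? a ≡ mask Q? a
    mask-⇔ (yes p) (yes q) f g a = ≡.refl
    mask-⇔ (yes p) (no ¬q) f g a = contradiction (f p) ¬q
    mask-⇔ (no ¬p) (yes q) f g a = contradiction (g q) ¬p
    mask-⇔ (no ¬p) (no ¬q) f g a = ≡.refl

    mask-× : ∀ {P Q : Set} (P? : Dec P) (Q? : Dec Q) a → mask P? (mask Q? a) ≡ mask (P? ×-dec Q?) a
    mask-× (yes p) (yes q) a = ≡.refl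
    mask-× (yes p) (no ¬q) a = ≡.refl
    mask-× (no ¬p) Q?      a = ≡.refl

    -- Mann's theorem, with the partition into minimal vanishing subsums replaced
    -- by the classes of exponents modulo a g that depends on N and Q only.
    record MannModulus (I : Set) (N : ℕ) (z : Carrier) (Q : ℕ) : Set where
      field
        g Q′      : ℕ
        {{g≢0}}   : NonZero g
        Q≡        : Q ≡ Q′ ℕ.* g
        Q′∣       : Q′ ∣ primorial N
        class-sum : ∀ (is : List I) (a : I → ℤ) (s : I → ℕ) → length is ≤ N → ∑ is
            (λ i → a i · z ^ s i) ≈ 0# →
                    ∀ c → ∑ is (λ i → mask (s i % g ℕ.≟ c % g) (a i) · z ^ s i) ≈ 0#

    module _ (I : Set) (N : ℕ) where

      -- The primes at which `Step` applies to `Q = p Q₁`: the case `p * p ∣ Q` amounts to `p ∣ Q₁`,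
      -- and `N < p` is the case of few terms.
      Reducible : ℕ → ℕ → Set
      Reducible Q p = Prime p × p ∣ Q × (p ℕ.* p ∣ Q ⊎ N < p)

      reducible? : ∀ Q → Dec (∃[ p ] p < suc Q × Reducible Q p)
      reducible? Q = ℕ.anyUpTo? (λ p → prime? p ×-dec (p ∣? Q) ×-dec
          ((p ℕ.* p ∣? Q) ⊎-dec (N ℕ.<? p))) (suc Q)

      irreducible-modulus : ∀ {z Q} → 0 < Q → ¬ (∃[ p ] p < suc Q × Reducible Q p) → MannModulus I
          N z Q
      irreducible-modulus {z} {Q} 0<Q irr = record
        { g = 1 ; Q′ = Q ; Q≡ = ≡.sym (ℕ.*-identityʳ Q)
        ; Q′∣ = squarefree-∣-primorial N Q 0<Q
            (λ p pr p∣Q → ℕ.≮⇒≥ λ N<p → irr (p , bounded p∣Q , pr , p∣Q , inj₂ N<p))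
            (λ p pr pp∣Q → irr (p , bounded (∣-trans (m∣m*n p) pp∣Q) , pr , ∣-trans (m∣m*n p) pp∣Q
                , inj₁ pp∣Q))
        ; class-sum = λ is a s _ e c → trans (∑-cong is λ i → ·-congˡ (z ^ s i)
            (≡.trans (mask-⇔ (s i % 1 ℕ.≟ c % 1) (yes tt) (λ _ → tt)
              (λ _ → ≡.trans (n%1≡0 (s i)) (≡.sym (n%1≡0 c))) (a i)) ≡.refl)) e
        }
        where
        bounded : ∀ {p} → p ∣ Q → p < suc Q
        bounded p∣Q = s≤s (∣⇒≤ {{ℕ.>-nonZero 0<Q}} p∣Q)

      -- The class of `c` modulo `p` is `z ^ (c % p)` times a vanishing sum in powers of `z ^ p`, a
      -- root of order `Q`, with exponents `s / p`. The given modulus splits it further; masking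
      -- keeps the list, so the length bound persists.
      refine : ∀ {z p Q} → Prime p → 0 < Q → Primitive z (p ℕ.* Q) → (p ∣ Q ⊎ N < p) →
               MannModulus I N (z ^ p) Q → MannModulus I N z (p ℕ.* Q)
      refine {z} {p} {Q} pr 0<Q prim hyp M = record
        { g = g ℕ.* p ; Q′ = Q′
        ; g≢0 = ℕ.m*n≢0 g p
        ; Q≡ = ≡.trans (≡.cong (p ℕ.*_) Q≡) (rearrange p Q′ g)
        ; Q′∣ = Q′∣
        ; class-sum = refined
        }
        where
        open MannModulus M
        instance
          _ = prime⇒nonZero pr
          _ = ℕ.m*n≢0 g p
          _ = ℕ.m*n≢0 p Q {{prime⇒nonZero pr}} {{ℕ.>-nonZero 0<Q}}
        rearrange : ∀ p q g → p ℕ.* (q ℕ.* g) ≡ q ℕ.* (g ℕ.* p)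
        rearrange = ℕ-Solver.solve-∀
        refined : ∀ (is : List I) (a : I → ℤ) (s : I → ℕ) → length is ≤ N → ∑ is
            (λ i → a i · z ^ s i) ≈ 0# →
                  ∀ c → ∑ is (λ i → mask (s i % (g ℕ.* p) ℕ.≟ c % (g ℕ.* p)) (a i) · z ^ s i) ≈ 0#
        refined is a s len vanish c = begin
          ∑ is (λ i → mask (s i % (g ℕ.* p) ℕ.≟ c % (g ℕ.* p)) (a i) · z ^ s i)
            ≈⟨ ∑-cong is (λ i → trans (·-congˡ (z ^ s i) (≡.trans (split i)
                 (≡.sym (mask-× (s i / p % g ℕ.≟ c / p % g) (s i % p ℕ.≟ c % p) (a i)))))
                     (factor i)) ⟩
          ∑ is (λ i → z ^ (c % p) * (mask (s i / p % g ℕ.≟ c / p % g) (a′ i) · (z ^ p) ^ (s i / p)))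
            ≈⟨ ∑-*ˡ is (z ^ (c % p)) _ ⟨
          z ^ (c % p) * ∑ is (λ i → mask (s i / p % g ℕ.≟ c / p % g) (a′ i) · (z ^ p) ^ (s i / p))
            ≈⟨ trans (*-congˡ (class-sum is a′ (λ i → s i / p) len vanish′ (c / p))) (zeroʳ _) ⟩
          0# ∎
          where
          a′ : I → ℤ
          a′ i = mask (s i % p ℕ.≟ c % p) (a i)
          split : ∀ i → mask (s i % (g ℕ.* p) ℕ.≟ c % (g ℕ.* p)) (a i) ≡
                        mask ((s i / p % g ℕ.≟ c / p % g) ×-dec (s i % p ℕ.≟ c % p)) (a i)
          split i = mask-⇔ (s i % (g ℕ.* p) ℕ.≟ c % (g ℕ.* p))
            ((s i / p % g ℕ.≟ c / p % g) ×-dec (s i % p ℕ.≟ c % p))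
            (λ e → %-*-projʳ (s i) c g p e , %-*-projˡ (s i) c g p e)
            (λ (e , e′) → %-*-split (s i) c g p e′ e) (a i)
          hyp′ : p ∣ Q ⊎ length is < p
          hyp′ = Sum.map₂ (ℕ.≤-<-trans len) hyp
          z^-split : ∀ i → s i % p ≡ c % p → z ^ s i ≈ z ^ (c % p) * (z ^ p) ^ (s i / p)
          z^-split i e = trans (reflexive (≡.cong (z ^_) (≡.trans (m≡m%n+[m/n]*n (s i) p)
            (≡.cong₂ ℕ._+_ e (ℕ.*-comm (s i / p) p)))))
            (trans (^-homo-* z (c % p) (p ℕ.* (s i / p))) (*-congˡ (sym (^-assocʳ z p (s i / p)))))
          zero-mask : ∀ {P : Set} (P? : Dec P) x → mask P? 0ℤ · x ≈ 0#
          zero-mask (yes _) x = refl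
          zero-mask (no _)  x = refl
          pull-mask : ∀ i {P : Set} (P? : Dec P) (E? : Dec (s i % p ≡ c % p)) →
                      mask P? (mask E? (a i)) · z ^ s i ≈
                      z ^ (c % p) * (mask P? (mask E? (a i)) · (z ^ p) ^ (s i / p))
          pull-mask i P? (yes e) = trans (·-congʳ (mask P? (a i)) (z^-split i e))
            (sym (·-comm (mask P? (a i)) (z ^ (c % p)) ((z ^ p) ^ (s i / p))))
          pull-mask i P? (no _)  = trans (zero-mask P? (z ^ s i))
            (sym (trans (*-congˡ (zero-mask P? ((z ^ p) ^ (s i / p)))) (zeroʳ (z ^ (c % p)))))
          pull : ∀ i {P : Set} (P? : Dec P) → mask P? (a′ i) · z ^ s i ≈
                 z ^ (c % p) * (mask P? (a′ i) · (z ^ p) ^ (s i / p))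
          pull i P? = pull-mask i P? (s i % p ℕ.≟ c % p)
          factor : ∀ i → mask (s i / p % g ℕ.≟ c / p % g) (a′ i) · z ^ s i ≈
                   z ^ (c % p) * (mask (s i / p % g ℕ.≟ c / p % g) (a′ i) · (z ^ p) ^ (s i / p))
          factor i = pull i (s i / p % g ℕ.≟ c / p % g)
          vanish′ : ∑ is (λ i → a′ i · (z ^ p) ^ (s i / p)) ≈ 0#
          vanish′ = cancel (trans (∑-*ˡ is (z ^ (c % p)) _)
            (trans (sym (∑-cong is λ i → pull i {⊤} (yes tt)))
              (Step.class-sum pr 0<Q prim is a s vanish hyp′ (c % p) (m%n<n c p))))
            (root-≉0 {Q = p ℕ.* Q} (root-^ {z} {p ℕ.* Q} (^-order prim) (c % p)))

      mann : ∀ {z} Q → 0 < Q → Primitive z Q → MannModulus I N z Q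
      mann Q = go Q (<-wellFounded Q)
        where
        go : ∀ {z} Q → Acc _<_ Q → 0 < Q → Primitive z Q → MannModulus I N z Q
        go Q (acc rec) 0<Q prim with reducible? Q
        ... | no irr = irreducible-modulus 0<Q irr
        ... | yes (p , _ , pr , divides Q₁ ≡.refl , h) = ≡.subst (MannModulus I N _) (ℕ.*-comm p Q₁)
            (refine pr 0<Q₁ prim′ (Sum.map₁ (λ pp∣ → *-cancelˡ-∣ p
                (≡.subst (p ℕ.* p ∣_) (ℕ.*-comm Q₁ p) pp∣)) h)
              (go Q₁ (rec (ℕ.m<m*n Q₁ p (prime>1 pr))) 0<Q₁ (primitive-^ prim′)))
          where
          0<Q₁ : 0 < Q₁
          0<Q₁ = ℕ.n≢0⇒n>0 λ where ≡.refl → ℕ.<-irrefl ≡.refl 0<Q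
          instance
            _ = prime⇒nonZero pr
            _ = ℕ.>-nonZero 0<Q₁
          prim′ : Primitive _ (p ℕ.* Q₁)
          prim′ = ≡.subst (Primitive _) (ℕ.*-comm Q₁ p) prim

  -- Roots of unity in a local ring.

  module RootsOfUnity (R : CommutativeRing 0ℓ 0ℓ) (dom : StableDomain R) where

    open MannTheorem R dom public

    primitive-from-minimal : ∀ {u M} .{{_ : NonZero M}} → u ^ M ≈ 1# →
      (∀ j → suc j < M → ¬ u ^ suc j ≈ 1#) → Primitive u M
    primitive-from-minimal {u} {M} u^M≈1 minimal = record
      { ^-order = u^M≈1
      ; order-∣ = λ j e → m%n≡0⇒n∣m j M (remainder (j % M) (m%n<n j M)
          (trans (sym (^-% u^M≈1 j)) e))
      }
      where
      remainder : ∀ k → k < M → u ^ k ≈ 1# → k ≡ 0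
      remainder zero    _   _ = ≡.refl
      remainder (suc k) k<M e = contradiction e (minimal k k<M)

    -- The root is `w / w̄`, whose powers are 1 exactly where those of `w` and `w̄` agree. For
    -- complex conjugates this is a condition on imaginary parts only.
    quotient-primitive : ∀ {w w̄ v M} .{{_ : NonZero M}} → w̄ * v ≈ 1# → w ^ M ≈ w̄ ^ M →
      (∀ j → suc j < M → ¬ w ^ suc j ≈ w̄ ^ suc j) → ∃[ u ] Primitive u M
    quotient-primitive {w} {w̄} {v} {M} w̄v≈1 w^M≈ w^≉ = w * v , primitive-from-minimal
      (trans (^-distrib-* w v M) (trans (*-congʳ w^M≈) (w̄v^≈1 M)))
      λ j j<M e → w^≉ j j<M (begin
        w ^ suc j                              ≈⟨ *-identityʳ _ ⟨
        w ^ suc j * 1#                         ≈⟨ *-congˡ (trans (*-comm _ _) (w̄v^≈1 (suc j))) ⟨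
        w ^ suc j * (v ^ suc j * w̄ ^ suc j)    ≈⟨ *-assoc _ _ _ ⟨
        w ^ suc j * v ^ suc j * w̄ ^ suc j      ≈⟨ *-congʳ (^-distrib-* w v (suc j)) ⟨
        (w * v) ^ suc j * w̄ ^ suc j            ≈⟨ *-congʳ e ⟩
        1# * w̄ ^ suc j                         ≈⟨ *-identityˡ _ ⟩
        w̄ ^ suc j                              ∎)
      where
      w̄v^≈1 : ∀ j → w̄ ^ j * v ^ j ≈ 1#
      w̄v^≈1 j = trans (sym (^-distrib-* w̄ v j)) (trans (^-congˡ j w̄v≈1) (1^ j))

    ∃-primitive-factor : ∀ p Q .{{_ : NonZero p}} → ∃[ u ] Primitive u (p ℕ.* Q) → ∃[ z ]
        Primitive z Q
    ∃-primitive-factor p Q (u , prim) = u ^ p , primitive-^ {u} {p} {Q} prim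

    ¬invertible-0 : ∀ {x} → x ≈ 0# → ¬ Invertible x
    ¬invertible-0 x≈0 (y , xy≈1) = 1≉0 (trans (sym xy≈1) (trans (*-congʳ x≈0) (zeroˡ y)))

    module Local (local : ∀ {x y} → x + y ≈ 1# → Invertible x ⊎ Invertible y)
                 (ℕ-invertible : ∀ n → Invertible (pos (suc n) · 1#)) where

      -- The average `x` of the powers of `ζ` is 1 if `ζ ≈ 1#` and 0 otherwise. In a local ring `x`
      -- or `1# - x` is invertible, and knowing which one settles the question.
      one? : ∀ {ζ Q} → 0 < Q → ζ ^ Q ≈ 1# → Dec (ζ ≈ 1#)
      one? {ζ} {suc q} _ ζ^Q≈1 = cases (local x+y≈1)
        where
        S k x y : Carrier
        S = sum (λ (j : Fin (suc q)) → ζ ^ toℕ j)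
        k = proj₁ (ℕ-invertible q)
        x = S * k
        y = 1# + - x
        x+y≈1 : x + y ≈ 1#
        x+y≈1 = begin
          x + (1# + - x)   ≈⟨ +-congˡ (+-comm 1# (- x)) ⟩
          x + (- x + 1#)   ≈⟨ +-assoc x (- x) 1# ⟨
          x + - x + 1#     ≈⟨ +-congʳ (-‿inverseʳ x) ⟩
          0# + 1#          ≈⟨ +-identityˡ 1# ⟩
          1#               ∎
        cases : Invertible x ⊎ Invertible y → Dec (ζ ≈ 1#)
        cases (inj₁ inv) = yes (stable λ ζ≉1 → ¬invertible-0
          (trans (*-congʳ (geometric-root (suc q) ζ ζ^Q≈1 ζ≉1)) (zeroˡ k)) inv)
        cases (inj₂ inv) = no λ ζ≈1 → ¬invertible-0 (begin
          1# + - (S * k)   ≈⟨ +-congˡ (-‿cong (trans (*-congʳ (geometric-one (suc q) ζ ζ≈1))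
              (proj₂ (ℕ-invertible q)))) ⟩
          1# + - 1#        ≈⟨ -‿inverseʳ 1# ⟩
          0#               ∎) inv

      -- Otherwise Σᵢ Σⱼ (ζ zʲ)ⁱ would be both 0 and Q.
      power-of-primitive : ∀ {z Q ζ} → 0 < Q → Primitive z Q → ζ ^ Q ≈ 1# → ∃[ e ] ζ ≈ z ^ e
      power-of-primitive {z} {Q@(suc q)} {ζ} 0<Q prim ζ^Q≈1 = cases
          (any? {n = Q} λ j → one? {Q = Q} 0<Q (y^Q≈1 j))
        where
        y : Fin Q → Carrier
        y j = ζ * z ^ toℕ j
        y^Q≈1 : ∀ j → y j ^ Q ≈ 1#
        y^Q≈1 j = trans (^-distrib-* ζ (z ^ toℕ j) Q)
          (trans (*-cong ζ^Q≈1 (root-^ {z} {Q} (^-order prim) (toℕ j))) (*-identityˡ 1#))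
        term : ∀ i j → y j ^ i ≈ ζ ^ i * (z ^ i) ^ toℕ j
        term i j = trans (^-distrib-* ζ (z ^ toℕ j) i) (*-congˡ (trans (^-assocʳ z (toℕ j) i)
          (trans (reflexive (≡.cong (z ^_) (ℕ.*-comm (toℕ j) i))) (sym (^-assocʳ z i (toℕ j))))))
        row : ∀ i → sum (λ (j : Fin Q) → y j ^ i) ≈ ζ ^ i * sum (λ (j : Fin Q) → (z ^ i) ^ toℕ j)
        row i = trans (sum-cong-≋ {Q} {λ j → y j ^ i} {λ j → ζ ^ i * (z ^ i) ^ toℕ j} (term i))
          (sym (*-distribˡ-sum (ζ ^ i) (λ (j : Fin Q) → (z ^ i) ^ toℕ j)))
        other-rows : ∀ (i : Fin Q) → i ≢ zero → sum (λ (j : Fin Q) → y j ^ toℕ i) ≈ 0#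
        other-rows zero    i≢0 = contradiction ≡.refl i≢0
        other-rows (suc i) _   = trans (row (suc (toℕ i)))
            (trans (*-congˡ (geometric-root Q (z ^ suc (toℕ i))
          (root-^ {z} {Q} (^-order prim) (suc (toℕ i)))
          λ e → ℕ.<⇒≱ (toℕ<n (suc i)) (∣⇒≤ (order-∣ prim (suc (toℕ i)) e)))) (zeroʳ _))
        total : sum (λ (i : Fin Q) → sum (λ (j : Fin Q) → y j ^ toℕ i)) ≈ pos Q · 1#
        total = trans (sum-at# (λ (i : Fin Q) → sum (λ (j : Fin Q) → y j ^ toℕ i)) zero other-rows)
          (trans (row 0) (trans (*-identityˡ _) (geometric-one Q 1# refl)))
        cases : Dec (∃[ j ] y j ≈ 1#) → ∃[ e ] ζ ≈ z ^ e
        cases (yes (j , e)) = Q ℕ.∸ toℕ j , (begin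
          ζ                                         ≈⟨ *-identityʳ ζ ⟨
          ζ * 1#
              ≈⟨ *-congˡ (trans (sym (^-homo-* z (toℕ j) (Q ℕ.∸ toℕ j)))
                   (trans (reflexive (≡.cong (z ^_)
                     (ℕ.m+[n∸m]≡n (ℕ.<⇒≤ (toℕ<n j)))))
                   (^-order prim))) ⟨
          ζ * (z ^ toℕ j * z ^ (Q ℕ.∸ toℕ j))       ≈⟨ *-assoc _ _ _ ⟨
          y j * z ^ (Q ℕ.∸ toℕ j)                   ≈⟨ trans (*-congʳ e) (*-identityˡ _) ⟩
          z ^ (Q ℕ.∸ toℕ j)                         ∎)
        cases (no none) = contradiction (begin
          pos Q · 1#                                                     ≈⟨ total ⟨
          sum (λ (i : Fin Q) → sum (λ (j : Fin Q) → y j ^ toℕ i))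
              ≈⟨ ∑-comm (λ (i j : Fin Q) → y j ^ toℕ i) ⟩
          sum (λ (j : Fin Q) → sum (λ (i : Fin Q) → y j ^ toℕ i))
              ≈⟨ sum-0# (λ (j : Fin Q) → sum (λ (i : Fin Q) → y j ^ toℕ i))
                   (λ j → geometric-root Q (y j) (y^Q≈1 j) λ e → none (j , e)) ⟩
          0#                                                             ∎) (char-0 q)

  -- Least elements, dual vectors and torsion points of subtori.

  ¬¬-least : ∀ {P : ℕ → Set} n → P n → ¬ ¬ (∃[ m ] P m × (∀ j → j < m → ¬ P j))
  ¬¬-least {P} n = go n (<-wellFounded n)
    where
    go : ∀ n → Acc _<_ n → P n → ¬ ¬ (∃[ m ] P m × (∀ j → j < m → ¬ P j))
    go n (acc rec) Pn k = excluded-middle {∃[ j ] j < n × P j} λ where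
      (yes (j , j<n , Pj)) → go j (rec j<n) Pj k
      (no none)            → k (n , Pn , λ j j<n Pj → none (j , j<n , Pj))

  least : ∀ {P : ℕ → Set} → (∀ n → Dec (P n)) → ∀ n → P n → ∃[ m ] P m × (∀ j → j < m → ¬ P j)
  least {P} P? n = go n (<-wellFounded n)
    where
    go : ∀ n → Acc _<_ n → P n → ∃[ m ] P m × (∀ j → j < m → ¬ P j)
    go n (acc rec) Pn with ℕ.anyUpTo? P? n
    ... | yes (j , j<n , Pj) = go j (rec j<n) Pj
    ... | no none            = n , Pn , λ j j<n Pj → none (j , j<n , Pj)

  any-function? : ∀ {r M} {P : (Fin r → Fin M) → Set} → (∀ {f g} → f ≗ g → P f → P g) →
                  (∀ f → Dec (P f)) → Dec (∃[ f ] P f)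
  any-function? {P = P} resp P? = map′
    (λ (k , p) → finToFun k , p)
    (λ (f , p) → funToFin f , resp (λ i → ≡.sym (finToFun-funToFin f i)) p)
    (any? λ k → P? (finToFun k))

  -- Row `l` is outside the rational span of the other rows, so the Fredholm alternative supplies a
  -- vector of the dual basis, up to a scale factor.
  dual-row : ∀ {r n} (E : Fin r → Vecᶻ n) → HasFullRowRank E → ∀ l →
             ∃[ v ] (∀ j → j ≢ l → dot v (E j) ≡ 0ℤ) × dot v (E l) ≢ 0ℤ
  dual-row {suc r} E rank l with separate (removeAt E l) (E l)
  ... | inj₂ (v , kills , ne) = v , (λ j j≢l → ≡.subst (λ j → dot v (E j) ≡ 0ℤ)
          (punchIn-punchOut (j≢l ∘ ≡.sym)) (kills (punchOut (j≢l ∘ ≡.sym)))) , ne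
  ... | inj₁ (b , b≢0 , c , e) = contradiction
      (≡.trans (≡.sym (ℤ.neg-involutive b)) (≡.cong ℤ.-_
          (≡.trans (≡.sym (insertAt-lookup c l (ℤ.- b))) (rank c′ zeros l)))) b≢0
    where
    c′ : Fin (suc r) → ℤ
    c′ = insertAt c l (ℤ.- b)
    zeros : ∀ i → comb c′ E i ≡ 0ℤ
    zeros i = begin
      comb c′ E i
        ≡⟨ sum-remove {i = l} (λ j → c′ j ℤ.* E j i) ⟩
      c′ l ℤ.* E l i ℤ.+ IntegerLattices.sum (λ j → c′ (punchIn l j) ℤ.* E (punchIn l j) i)
        ≡⟨ ≡.cong₂ (λ x y → x ℤ.* E l i ℤ.+ y) (insertAt-lookup c l (ℤ.- b))
             (sum-cong-≗ λ j → ≡.cong (ℤ._* E (punchIn l j) i) (insertAt-punchIn c l (ℤ.- b) j)) ⟩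
      ℤ.- b ℤ.* E l i ℤ.+ comb c (removeAt E l) i
        ≡⟨ ≡.cong (λ y → ℤ.- b ℤ.* E l i ℤ.+ y) (e i) ⟨
      ℤ.- b ℤ.* E l i ℤ.+ b ℤ.* E l i
        ≡⟨ cancel b (E l i) ⟩
      0ℤ ∎
      where
      open ≡.≡-Reasoning
      cancel : ∀ b x → ℤ.- b ℤ.* x ℤ.+ b ℤ.* x ≡ 0ℤ
      cancel = ℤ-Solver.solve-∀

  common-multiple : ∀ r (s : Fin r → ℕ) → (∀ l → 0 < s l) → ∃[ K ] 0 < K × (∀ l → s l ∣ K)
  common-multiple zero    s _  = 1 , ℕ.z<s , λ ()
  common-multiple (suc r) s 0<s with K , 0<K , s∣K ← common-multiple r (s ∘ suc) (0<s ∘ suc) =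
    s zero ℕ.* K , ℕ.*-mono-≤ (0<s zero) 0<K , λ where
      zero    → m∣m*n K
      (suc l) → ∣n⇒∣m*n (s zero) (s∣K l)

  δᶻ : ∀ {n} → Fin n → Vecᶻ n
  δᶻ zero    zero    = 1ℤ
  δᶻ zero    (suc j) = 0ℤ
  δᶻ (suc i) zero    = 0ℤ
  δᶻ (suc i) (suc j) = δᶻ i j

  -- The torsion of the group is to look like that of `ℂ*`: triviality is decidable, the elements
  -- killed by `Q` form a cyclic group, and torsion elements have torsion roots.
  record TorsionTheory (G : AbelianGroup 0ℓ 0ℓ) : Set where
    open IntegerPower G using (_^_)
    open AbelianGroup G using (Carrier; _≈_; ε)
    field
      trivial?  : ∀ {ζ Q} → 0 < Q → ζ ^ Q ≈ ε → Dec (ζ ≈ ε)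
      generator : ∀ Q → 0 < Q → Σ[ z ∈ Carrier ] z ^ Q ≈ ε × (∀ ζ → ζ ^ Q ≈ ε → ∃[ e ] ζ ≈ z ^ e)
      root      : ∀ {ζ Q} d → 0 < Q → 0 < d → ζ ^ Q ≈ ε → Σ[ t ∈ Carrier ] t ^ d ≈ ζ × t ^
          (d ℕ.* Q) ≈ ε

  module Torsion (G : AbelianGroup 0ℓ 0ℓ) (theory : TorsionTheory G) where

    open AbelianGroup G
    open IntegerPower G
    open TorsionTheory theory
    open import Algebra.Properties.AbelianGroup G using (⁻¹-∙-comm; ε⁻¹≈ε; inverseˡ-unique; ⁻¹-involutive)
    open import Relation.Binary.Reasoning.Setoid setoid

    InTorus : ∀ {r n} → (Fin r → Vecᶻ n) → (Fin n → Carrier) → Set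
    InTorus {r} E x = Σ[ t ∈ (Fin r → Carrier) ] (∀ i → x i ≈ monomialMap E t i)

    ⁻¹-^ : ∀ x n → (x ⁻¹) ^ n ≈ (x ^ n) ⁻¹
    ⁻¹-^ x zero    = sym ε⁻¹≈ε
    ⁻¹-^ x (suc n) = trans (∙-congˡ (⁻¹-^ x n)) (⁻¹-∙-comm x (x ^ n))

    ^ᶻ-^ : ∀ x a n → (x ^ᶻ a) ^ n ≈ (x ^ n) ^ᶻ a
    ^ᶻ-^ x a n = trans (sym (^ᶻ-* x a (pos n)))
      (trans (reflexive (≡.cong (x ^ᶻ_) (ℤ.*-comm a (pos n)))) (^ᶻ-* x (pos n) a))

    ∏-^ : ∀ {n} (f : Fin n → Carrier) m → ∏ f ^ m ≈ ∏ (λ i → f i ^ m)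
    ∏-^ f m = ∏-^ᶻ f (pos m)

    ^-multiple : ∀ {x Q M} → Q ∣ M → x ^ Q ≈ ε → x ^ M ≈ ε
    ^-multiple {x} {Q} (divides k ≡.refl) e = trans (reflexive (≡.cong (x ^_) (ℕ.*-comm k Q)))
      (trans (sym (^-* x Q k)) (trans (^-cong k e) (ε^ k)))

    character-^ : ∀ {n} (x : Fin n → Carrier) v m → character x v ^ m ≈ character (λ i → x i ^ m) v
    character-^ x v m = sym (character-^ᶻ x (pos m) v)

    character-trivial : ∀ {n} {x : Fin n → Carrier} v → (∀ i → x i ≈ ε) → character x v ≈ ε
    character-trivial {x = x} v h = ∏-ε {f = λ i → x i ^ᶻ v i} λ i → trans (^ᶻ-cong (v i) (h i))
        (ε^ᶻ (v i))

    character-torsion : ∀ {n} {x : Fin n → Carrier} {Q} v → (∀ i → x i ^ Q ≈ ε) → character x v ^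
        Q ≈ ε
    character-torsion {x = x} {Q} v h = trans (character-^ x v Q) (character-trivial v h)

    ∏-at : ∀ {n} (f : Fin n → Carrier) l → (∀ i → i ≢ l → f i ≈ ε) → ∏ f ≈ f l
    ∏-at {suc n} f zero    h = trans (∙-congˡ (∏-ε {f = f ∘ suc} λ i → h (suc i) λ ()))
        (identityʳ _)
    ∏-at {suc n} f (suc l) h = trans (∙-cong (h zero λ ())
      (∏-at (f ∘ suc) l λ i i≢l → h (suc i) λ where ≡.refl → i≢l ≡.refl)) (identityˡ _)

    character-δ : ∀ {n} (x : Fin n → Carrier) i → character x (δᶻ i) ≈ x i
    character-δ x i = trans (∏-at (λ j → x j ^ᶻ δᶻ i j) i λ j j≢i → reflexive
        (≡.cong (x j ^ᶻ_) (off i j j≢i)))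
      (trans (reflexive (≡.cong (x i ^ᶻ_) (on i))) (^ᶻ-1 (x i)))
      where
      on : ∀ {n} (i : Fin n) → δᶻ i i ≡ 1ℤ
      on zero    = ≡.refl
      on (suc i) = on i
      off : ∀ {n} (i j : Fin n) → j ≢ i → δᶻ i j ≡ 0ℤ
      off zero    zero    j≢i = contradiction ≡.refl j≢i
      off zero    (suc j) _   = ≡.refl
      off (suc i) zero    _   = ≡.refl
      off (suc i) (suc j) j≢i = off i j λ where ≡.refl → j≢i ≡.refl

    equal? : ∀ {a b Q} → 0 < Q → a ^ Q ≈ ε → b ^ Q ≈ ε → Dec (a ≈ b)
    equal? {a} {b} {Q} 0<Q a^Q b^Q = map′
      (λ e → trans (inverseˡ-unique a (b ⁻¹) e) (⁻¹-involutive b))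
      (λ e → trans (∙-congʳ e) (inverseʳ b))
      (trivial? {a ∙ b ⁻¹} {Q} 0<Q (trans (^-∙ a (b ⁻¹) Q)
          (trans (∙-cong a^Q (trans (⁻¹-^ b Q) (trans (⁻¹-cong b^Q) ε⁻¹≈ε))) (identityˡ ε))))

    monomialMap-∙ : ∀ {r n} (E : Fin r → Vecᶻ n) s t i →
      monomialMap E (λ j → s j ∙ t j) i ≈ monomialMap E s i ∙ monomialMap E t i
    monomialMap-∙ E s t i = character-∙ s t (λ j → E j i)

    inTorus-∙ : ∀ {r n} {E : Fin r → Vecᶻ n} {x y} → InTorus E x → InTorus E y → InTorus E
        (λ i → x i ∙ y i)
    inTorus-∙ {E = E} (s , e) (t , f) = (λ j → s j ∙ t j) , λ i →
      trans (∙-cong (e i) (f i)) (sym (monomialMap-∙ E s t i))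

    inTorus-^ᶻ : ∀ {r n} {E : Fin r → Vecᶻ n} {x} a → InTorus E x → InTorus E (λ i → x i ^ᶻ a)
    inTorus-^ᶻ {E = E} a (t , e) = (λ j → t j ^ᶻ a) , λ i →
      trans (^ᶻ-cong a (e i)) (sym (character-^ᶻ t a (λ j → E j i)))

    inTorus-cong : ∀ {r n} {E : Fin r → Vecᶻ n} {x y} → (∀ i → x i ≈ y i) → InTorus E x → InTorus
        E y
    inTorus-cong x≈y (t , e) = t , λ i → trans (sym (x≈y i)) (e i)

    -- Extending characters to ℤʳ one coordinate at a time: t₀ is a d-th root of x^λ₀,
    -- where d = e·λ₀ generates {e·λ | E′ λ = 0} for the first row e of E.
    duality : ∀ r {n} (E : Fin r → Vecᶻ n) {Q} (x : Fin n → Carrier) → 0 < Q → (∀ i → x i ^ Q ≈ ε) →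
              (∀ v → (∀ j → dot (E j) v ≡ 0ℤ) → character x v ≈ ε) → ¬ ¬ InTorus E x
    duality zero    E x 0<Q tors ann k = k ((λ ()) , λ i → trans (sym (character-δ x i))
        (ann (δᶻ i) λ ()))
    -- `Value d` says that `d` is a positive value of `e` on the kernel of the remaining rows.
    -- Neither its existence nor the least such `d` is computed, hence the double negation.
    duality (suc r) {n} E {Q} x 0<Q tors ann k = excluded-middle {∃[ d ] Value d} λ where
        (no none)        → trivial-row none
        (yes (d , val))  → ¬¬-least {Value} d val generator-row
      where
      e = E zero
      E′ = E ∘ suc
      Value : ℕ → Set
      Value d = 0 < d × Σ[ v ∈ Vecᶻ n ] (∀ j → dot (E′ j) v ≡ 0ℤ) × dot e v ≡ pos d

      extend : ∀ t₀ → InTorus E′ (λ i → x i ∙ (t₀ ^ᶻ e i) ⁻¹) → InTorus E x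
      extend t₀ (t , h) = t₀ ◂ t , λ i → begin
        x i                                                  ≈⟨ identityʳ _ ⟨
        x i ∙ ε                                              ≈⟨ ∙-congˡ (inverseˡ _) ⟨
        x i ∙ ((t₀ ^ᶻ e i) ⁻¹ ∙ t₀ ^ᶻ e i)                   ≈⟨ assoc _ _ _ ⟨
        x i ∙ (t₀ ^ᶻ e i) ⁻¹ ∙ t₀ ^ᶻ e i                     ≈⟨ ∙-congʳ (h i) ⟩
        monomialMap E′ t i ∙ t₀ ^ᶻ e i                       ≈⟨ comm _ _ ⟩
        t₀ ^ᶻ e i ∙ monomialMap E′ t i                       ∎

      -- Here `e` vanishes on the kernel of `E′`, so the first parameter can be taken to be `ε`.
      trivial-row : ¬ (∃[ d ] Value d) → _
      trivial-row none = duality r E′ x 0<Q tors (λ v h → ann v λ where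
          zero    → vanish v h
          (suc j) → h j) λ torus → k (extend ε (inTorus-cong {E = E′} (λ i → sym (trans (∙-congˡ
            (trans (⁻¹-cong (ε^ᶻ (e i))) ε⁻¹≈ε)) (identityʳ (x i)))) torus))
        where
        vanish : ∀ v → (∀ j → dot (E′ j) v ≡ 0ℤ) → dot e v ≡ 0ℤ
        vanish v h with dot e v in eq
        ... | pos zero    = ≡.refl
        ... | pos (suc d) = contradiction (suc d , ℕ.z<s , v , h , eq) none
        ... | -[1+ d ]    = contradiction (suc d , ℕ.z<s , (λ i → ℤ.-1ℤ ℤ.* v i) ,
                (λ j → ≡.trans (dot-* (E′ j) ℤ.-1ℤ v) (≡.cong (ℤ.-1ℤ ℤ.*_) (h j))) ,
                ≡.trans (dot-* e ℤ.-1ℤ v) (≡.trans (≡.cong (ℤ.-1ℤ ℤ.*_) eq) (ℤ.-1*i≡-i -[1+ d ])))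
                    none

      generator-row : (∃[ d ] Value d × (∀ j → j < d → ¬ Value j)) → _
      generator-row (d , (0<d , v₀ , E′v₀ , ev₀) , minimal) with root d 0<Q 0<d
          (character-torsion {x = x} {Q} v₀ tors)
      ... | t₀ , t₀^d , t₀^dQ = duality r E′ {d ℕ.* Q} x′ (ℕ.*-mono-≤ 0<d 0<Q) tors′ ann′ λ torus
          → k (extend t₀ torus)
        where
        x′ : Fin n → Carrier
        x′ i = x i ∙ (t₀ ^ᶻ e i) ⁻¹
        tors′ : ∀ i → x′ i ^ (d ℕ.* Q) ≈ ε
        tors′ i = begin
          x′ i ^ (d ℕ.* Q)                                      ≈⟨ ^-∙ (x i) _ (d ℕ.* Q) ⟩
          x i ^ (d ℕ.* Q) ∙ ((t₀ ^ᶻ e i) ⁻¹) ^ (d ℕ.* Q)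
              ≈⟨ ∙-cong (^-multiple (∣n⇒∣m*n d (divides 1 (≡.sym (ℕ.*-identityˡ Q)))) (tors i))
                                                                     (⁻¹-^ _ (d ℕ.* Q)) ⟩
          ε ∙ ((t₀ ^ᶻ e i) ^ (d ℕ.* Q)) ⁻¹
              ≈⟨ ∙-congˡ (⁻¹-cong (trans (^ᶻ-^ t₀ (e i) (d ℕ.* Q))
                                                                     (trans (^ᶻ-cong (e i) t₀^dQ)
                                                                         (ε^ᶻ (e i))))) ⟩
          ε ∙ ε ⁻¹                                              ≈⟨ inverseʳ ε ⟩
          ε                                                     ∎
        instance
          _ = ℕ.>-nonZero 0<d

        module _ (v : Vecᶻ n) (E′v : ∀ j → dot (E′ j) v ≡ 0ℤ) where
          c : ℤ
          c = dot e v ℤ./ℕ d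
          -- Division with remainder: subtracting `c` times `v₀` leaves `e` with a value below `d`,
          -- which is 0 by minimality of `d`. So `v′` lies in the kernel of all of `E`, where the
          -- character is trivial.
          v′ : Vecᶻ n
          v′ i = 1ℤ ℤ.* v i ℤ.+ ℤ.- c ℤ.* v₀ i
          ev′ : dot e v′ ≡ pos (dot e v ℤ.%ℕ d)
          ev′ = ≡.trans (dot-lin e 1ℤ v (ℤ.- c) v₀)
              (≡.trans (≡.cong₂ (λ a b → 1ℤ ℤ.* a ℤ.+ ℤ.- c ℤ.* b)
            (ℤ.a≡a%ℕn+[a/ℕn]*n (dot e v) d) ev₀) (simplify (pos (dot e v ℤ.%ℕ d)) c (pos d)))
            where
            simplify : ∀ r c d → 1ℤ ℤ.* (r ℤ.+ c ℤ.* d) ℤ.+ ℤ.- c ℤ.* d ≡ r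
            simplify = ℤ-Solver.solve-∀
          E′v′ : ∀ j → dot (E′ j) v′ ≡ 0ℤ
          E′v′ j = ≡.trans (dot-lin (E′ j) 1ℤ v (ℤ.- c) v₀) (≡.trans
            (≡.cong₂ (λ a b → 1ℤ ℤ.* a ℤ.+ ℤ.- c ℤ.* b) (E′v j) (E′v₀ j)) (simplify c))
            where
            simplify : ∀ c → 1ℤ ℤ.* 0ℤ ℤ.+ ℤ.- c ℤ.* 0ℤ ≡ 0ℤ
            simplify = ℤ-Solver.solve-∀
          remainder≡0 : dot e v ℤ.%ℕ d ≡ 0
          remainder≡0 = small (dot e v ℤ.%ℕ d) (ℤ.n%ℕd<d (dot e v) d) ev′
            where
            small : ∀ m → m < d → dot e v′ ≡ pos m → m ≡ 0
            small zero    _   _  = ≡.refl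
            small (suc m) m<d eq = contradiction (ℕ.z<s , v′ , E′v′ , eq) (minimal (suc m) m<d)
          v′∈ker : ∀ j → dot (E j) v′ ≡ 0ℤ
          v′∈ker zero    = ≡.trans ev′ (≡.cong pos remainder≡0)
          v′∈ker (suc j) = E′v′ j
          v≡ : ∀ i → v i ≡ v′ i ℤ.+ c ℤ.* v₀ i
          v≡ i = simplify (v i) c (v₀ i)
            where
            simplify : ∀ v c w → v ≡ (1ℤ ℤ.* v ℤ.+ ℤ.- c ℤ.* w) ℤ.+ c ℤ.* w
            simplify = ℤ-Solver.solve-∀
          ev≡ : dot e v ≡ pos d ℤ.* c
          ev≡ = ≡.trans (ℤ.a≡a%ℕn+[a/ℕn]*n (dot e v) d) (≡.trans
            (≡.cong (λ m → pos m ℤ.+ c ℤ.* pos d) remainder≡0)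
                (≡.trans (ℤ.+-identityˡ _) (ℤ.*-comm c (pos d))))
          character-x : character x v ≈ t₀ ^ᶻ dot e v
          character-x = begin
            character x v                                       ≈⟨ character-congʳ x v≡ ⟩
            character x (λ i → v′ i ℤ.+ c ℤ.* v₀ i)
                ≈⟨ character-+ x v′ (λ i → c ℤ.* v₀ i) ⟩
            character x v′ ∙ character x (λ i → c ℤ.* v₀ i)
                ≈⟨ ∙-cong (ann v′ v′∈ker) (character-* x c v₀) ⟩
            ε ∙ character x v₀ ^ᶻ c                             ≈⟨ identityˡ _ ⟩
            character x v₀ ^ᶻ c                                 ≈⟨ ^ᶻ-cong c t₀^d ⟨
            (t₀ ^ d) ^ᶻ c                                       ≈⟨ ^ᶻ-* t₀ (pos d) c ⟨
            t₀ ^ᶻ (pos d ℤ.* c)                                 ≡⟨ ≡.cong (t₀ ^ᶻ_) ev≡ ⟨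
            t₀ ^ᶻ dot e v                                       ∎
          ann′ : character x′ v ≈ ε
          ann′ = begin
            character x′ v
              ≈⟨ character-∙ x (λ i → (t₀ ^ᶻ e i) ⁻¹) v ⟩
            character x v ∙ character (λ i → (t₀ ^ᶻ e i) ⁻¹) v
              ≈⟨ ∙-cong character-x (trans (character-cong v λ i → inv-as-power (t₀ ^ᶻ e i))
                   (trans (character-^ᶻ (λ i → t₀ ^ᶻ e i) ℤ.-1ℤ v)
                       (trans (^ᶻ-cong ℤ.-1ℤ power) (sym (inv-as-power _))))) ⟩
            t₀ ^ᶻ dot e v ∙ (t₀ ^ᶻ dot e v) ⁻¹
              ≈⟨ inverseʳ _ ⟩
            ε ∎
            where
            inv-as-power : ∀ y → y ⁻¹ ≈ y ^ᶻ ℤ.-1ℤ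
            inv-as-power y = ⁻¹-cong (sym (^-1 y))
            power : character (λ i → t₀ ^ᶻ e i) v ≈ t₀ ^ᶻ dot e v
            power = trans (∏-cong λ i → sym (^ᶻ-* t₀ (e i) (v i)))
                (sym (^ᶻ-sum t₀ (λ i → e i ℤ.* v i)))

    module _ {r n} (E : Fin r → Vecᶻ n) (rank : HasFullRowRank E) where

      private
        scale : Fin r → ℕ
        scale l = abs (dot (proj₁ (dual-row E rank l)) (E l))

        0<scale : ∀ l → 0 < scale l
        0<scale l = ℕ.n≢0⇒n>0 λ e → proj₂ (proj₂ (dual-row E rank l)) (ℤ.∣i∣≡0⇒i≡0 e)

        K = proj₁ (common-multiple r scale 0<scale)
        0<K = proj₁ (proj₂ (common-multiple r scale 0<scale))
        scale∣K = proj₂ (proj₂ (common-multiple r scale 0<scale))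

      -- Pairing `x` with the dual vector of row `l` cancels every parameter except `t l`, so a
      -- power of `t l` is a character value of `x` and therefore torsion.
      preimage-torsion : ∀ {x Q} t → (∀ i → x i ^ Q ≈ ε) → (∀ i → x i ≈ monomialMap E t i) →
                         ∀ l → t l ^ (Q ℕ.* K) ≈ ε
      preimage-torsion {x} {Q} t tors x≈t l =
        ^-multiple {t l} {Q ℕ.* scale l} {Q ℕ.* K} (*-monoʳ-∣ Q (scale∣K l))
            (abs-power (dot w (E l)) (begin
          (t l ^ᶻ dot w (E l)) ^ Q                        ≈⟨ ^-cong Q (sym t-power) ⟩
          character x w ^ Q                               ≈⟨ character-torsion {x = x} {Q} w tors ⟩
          ε                                               ∎))
        where
        w = proj₁ (dual-row E rank l)
        t-power : character x w ≈ t l ^ᶻ dot w (E l)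
        t-power = trans (character-cong w x≈t) (trans (character-monomialMap E t w)
          (trans (∏-at (λ j → t j ^ᶻ dot (E j) w) l λ j j≢l → reflexive (≡.cong (t j ^ᶻ_)
              (≡.trans (dot-comm (E j) w) (proj₁ (proj₂ (dual-row E rank l)) j j≢l))))
            (reflexive (≡.cong (t l ^ᶻ_) (dot-comm (E l) w)))))
        abs-power : ∀ a → (t l ^ᶻ a) ^ Q ≈ ε → t l ^ (Q ℕ.* abs a) ≈ ε
        abs-power (pos m)  e = trans (reflexive (≡.cong (t l ^_) (ℕ.*-comm Q m)))
            (trans (sym (^-* (t l) m Q)) e)
        abs-power -[1+ m ] e = trans (reflexive (≡.cong (t l ^_) (ℕ.*-comm Q (suc m))))
            (trans (sym (^-* (t l) (suc m) Q))
          (trans (sym (⁻¹-involutive _)) (trans (⁻¹-cong (trans (sym (⁻¹-^ _ Q)) e)) ε⁻¹≈ε)))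

      -- All possible parameters are killed by the single exponent `M`, hence are powers of one
      -- generator with exponents below `M`. Membership is thus a finite search among decidable
      -- equations.
      inTorus? : ∀ {Q} (x : Fin n → Carrier) → 0 < Q → (∀ i → x i ^ Q ≈ ε) → Dec (InTorus E x)
      inTorus? {Q} x 0<Q tors = map′
        (λ (f , h) → (λ j → z ^ toℕ (f j)) , h)
        (λ (t , h) → (λ j → reduce (exponent t h j)) , λ i → trans (h i)
          (∏-cong λ j → ^ᶻ-cong (E j i) (trans (proj₂
              (powers (t j) (preimage-torsion {x} {Q} t tors h j)))
                  (sym (reduce-^ (exponent t h j))))))
        (any-function? (λ f≗g h i → trans (h i) (∏-cong λ j → ^ᶻ-cong (E j i)
            (reflexive (≡.cong (λ k → z ^ toℕ k) (f≗g j)))))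
          λ f → all? λ i → equal? {x i} {monomialMap E (λ j → z ^ toℕ (f j)) i} {M} 0<M
            (^-multiple {x i} {Q} {M} (m∣m*n K) (tors i))
            (trans (∏-^ (λ j → (z ^ toℕ (f j)) ^ᶻ E j i) M)
              (∏-ε {f = λ j → ((z ^ toℕ (f j)) ^ᶻ E j i) ^ M} λ j → trans
                  (^ᶻ-^ (z ^ toℕ (f j)) (E j i) M)
                (trans (^ᶻ-cong (E j i) (trans (^-* z (toℕ (f j)) M)
                    (^-multiple {z} {M} (∣n⇒∣m*n (toℕ (f j))
                        (divides 1 (≡.sym (ℕ.*-identityˡ M)))) z^M)))
                  (ε^ᶻ (E j i))))))
        where
        M : ℕ
        M = Q ℕ.* K
        0<M : 0 < M
        0<M = ℕ.*-mono-≤ 0<Q 0<K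
        instance
          _ = ℕ.>-nonZero 0<M
        z = proj₁ (generator M 0<M)
        z^M = proj₁ (proj₂ (generator M 0<M))
        powers = proj₂ (proj₂ (generator M 0<M))
        exponent : ∀ t → (∀ i → x i ≈ monomialMap E t i) → Fin r → ℕ
        exponent t h j = proj₁ (powers (t j) (preimage-torsion {x} {Q} t tors h j))
        reduce : ℕ → Fin M
        reduce m = fromℕ< (m%n<n m M)
        reduce-^ : ∀ m → z ^ toℕ (reduce m) ≈ z ^ m
        reduce-^ m = sym (begin
          z ^ m                                  ≡⟨ ≡.cong (z ^_) (m≡m%n+[m/n]*n m M) ⟩
          z ^ (m % M ℕ.+ m / M ℕ.* M)            ≈⟨ ^-+ z (m % M) _ ⟩
          z ^ (m % M) ∙ z ^ (m / M ℕ.* M)        ≈⟨ ∙-congˡ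
              (^-multiple {z} {M} (∣n⇒∣m*n (m / M) (divides 1 (≡.sym (ℕ.*-identityˡ M)))) z^M) ⟩
          z ^ (m % M) ∙ ε                        ≈⟨ identityʳ _ ⟩
          z ^ (m % M)                            ≡⟨ ≡.cong (z ^_) (toℕ-fromℕ< (m%n<n m M)) ⟨
          z ^ toℕ (reduce m)                     ∎)

      -- `Q` is one positive power that lands in the torus, so a bounded search finds the least one;
      -- division with remainder shows that it divides all others.
      order : ∀ {Q} (x : Fin n → Carrier) → 0 < Q → (∀ i → x i ^ Q ≈ ε) →
        ∃[ q ] 0 < q × InTorus E (λ i → x i ^ q) ×
            (∀ j → 0 < j → InTorus E (λ i → x i ^ j) → q ≤ j) ×
               (∀ m → InTorus E (λ i → x i ^ m) → q ∣ m)
      order {Q} x 0<Q tors with least {λ j → 0 < j × InTorus E (λ i → x i ^ j)} decide Q (0<Q , one)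
        where
        decide : ∀ j → Dec (0 < j × InTorus E (λ i → x i ^ j))
        decide j = (0 ℕ.<? j) ×-dec inTorus? {Q} (λ i → x i ^ j) 0<Q λ i →
          trans (^-* (x i) j Q) (^-multiple {x i} {Q}
              (∣n⇒∣m*n j (divides 1 (≡.sym (ℕ.*-identityˡ Q)))) (tors i))
        one : InTorus E (λ i → x i ^ Q)
        one = (λ _ → ε) , λ i → trans (tors i) (sym (∏-ε {f = λ j → ε ^ᶻ E j i} λ j → ε^ᶻ (E j i)))
      ... | q , (0<q , q∈) , minimal = q , 0<q , q∈ ,
          (λ j 0<j j∈ → ℕ.≮⇒≥ λ j<q → minimal j j<q (0<j , j∈)) , divides-all
        where
        instance
          _ = ℕ.>-nonZero 0<q
        divides-all : ∀ m → InTorus E (λ i → x i ^ m) → q ∣ m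
        divides-all m m∈ = m%n≡0⇒n∣m m q (zero-remainder (m % q) (m%n<n m q) remainder∈)
          where
          remainder∈ : InTorus E (λ i → x i ^ (m % q))
          remainder∈ = inTorus-cong {E = E} eq (inTorus-∙ {E = E} m∈
              (inTorus-^ᶻ {E = E} (ℤ.- pos (m / q)) q∈))
            where
            eq : ∀ i → x i ^ m ∙ (x i ^ q) ^ᶻ (ℤ.- pos (m / q)) ≈ x i ^ (m % q)
            eq i = begin
              x i ^ m ∙ (x i ^ q) ^ᶻ (ℤ.- pos (m / q))
                ≈⟨ ∙-congˡ (^ᶻ-* (x i) (pos q) (ℤ.- pos (m / q))) ⟨
              x i ^ᶻ pos m ∙ x i ^ᶻ (pos q ℤ.* ℤ.- pos (m / q))
                ≈⟨ ^ᶻ-+ (x i) (pos m) (pos q ℤ.* ℤ.- pos (m / q)) ⟨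
              x i ^ᶻ (pos m ℤ.+ pos q ℤ.* ℤ.- pos (m / q))
                ≡⟨ ≡.cong (x i ^ᶻ_) (≡.trans (≡.cong (λ k → pos k ℤ.+ pos q ℤ.* ℤ.- pos (m / q))
                    (m≡m%n+[m/n]*n m q))
                     (≡.trans (≡.cong (ℤ._+ pos q ℤ.* ℤ.- pos (m / q)) (≡.trans (ℤ.pos-+ (m % q) _)
                       (≡.cong (λ a → pos (m % q) ℤ.+ a) (ℤ.pos-* (m / q) q))))
                           (simplify (pos (m % q)) (pos (m / q)) (pos q)))) ⟩
              x i ^ᶻ pos (m % q) ∎
              where
              simplify : ∀ r k q → r ℤ.+ k ℤ.* q ℤ.+ q ℤ.* ℤ.- k ≡ r
              simplify = ℤ-Solver.solve-∀
          zero-remainder : ∀ k → k < q → InTorus E (λ i → x i ^ k) → k ≡ 0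
          zero-remainder zero    _   _  = ≡.refl
          zero-remainder (suc k) k<q k∈ = contradiction (ℕ.z<s , k∈) (minimal (suc k) k<q)

  -- Splitting and regrouping sums along classes of characters.

  module Grouping (R : CommutativeRing 0ℓ 0ℓ) (dom : StableDomain R) where

    open RootsOfUnity R dom public

    select : ∀ {P : Set} → Dec P → Carrier → Carrier
    select (yes _) x = x
    select (no _)  x = 0#

    *-≉0 : ∀ {x y} → ¬ x ≈ 0# → ¬ y ≈ 0# → ¬ x * y ≈ 0#
    *-≉0 x≉0 y≉0 xy≈0 = y≉0 (cancel xy≈0 x≉0)

    difference-≉0 : ∀ {x y} → ¬ x ≈ y → ¬ x + - y ≈ 0#
    difference-≉0 {x} {y} x≉y e = x≉y (begin
      x                ≈⟨ +-identityʳ x ⟨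
      x + 0#           ≈⟨ +-congˡ (-‿inverseˡ y) ⟨
      x + (- y + y)    ≈⟨ +-assoc x (- y) y ⟨
      x + - y + y      ≈⟨ +-congʳ e ⟩
      0# + y           ≈⟨ +-identityˡ y ⟩
      y                ∎)

    -- An Artin–Dedekind elimination of the characters different from χ c.
    module Independence {I G : Set} (is : List I) (b : I → Carrier)
      (χ : I → G → Carrier) (_⊙_ : G → G → G) (χ-⊙ : ∀ i g h → χ i (g ⊙ h) ≈ χ i g * χ i h)
      (g₀ : G) (χ-g₀ : ∀ i → χ i g₀ ≈ 1#)
      (vanish : ∀ g → ∑ is (λ i → b i * χ i g) ≈ 0#)
      (Same : I → Set) (same? : ∀ i → Dec (Same i)) (c : I)
      (same⇒≈ : ∀ {i} → Same i → ∀ g → χ i g ≈ χ c g)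
      (¬same⇒≉ : ∀ {i} → ¬ Same i → ∃[ g ] ¬ χ c g ≈ χ i g) where

      record Eliminator (js : List I) : Set where
        field
          K         : I → Carrier
          K-vanish  : ∀ g → ∑ is (λ i → b i * K i * χ i g) ≈ 0#
          κ         : Carrier
          κ≉0       : ¬ κ ≈ 0#
          K-same    : ∀ {i} → Same i → K i ≈ κ
          K-others  : All (λ j → ¬ Same j → K j ≈ 0#) js

      eliminate : ∀ js → Eliminator js
      eliminate []       = record
        { K = λ _ → 1# ; κ = 1# ; κ≉0 = 1≉0 ; K-same = λ _ → refl ; K-others = []
        ; K-vanish = λ g → trans (∑-cong is λ i → *-congʳ (*-identityʳ (b i))) (vanish g) }
      eliminate (j ∷ js) = cases (same? j)
        where
        open Eliminator (eliminate js)
        cases : Dec (Same j) → Eliminator (j ∷ js)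
        cases (yes same) = record
          { K = K ; κ = κ ; κ≉0 = κ≉0 ; K-same = K-same ; K-vanish = K-vanish
          ; K-others = (λ ¬same → contradiction same ¬same) ∷ K-others }
        -- Choose `h` with `χ c h` different from `χ j h`. The relation at `h ⊙ g` minus `χ j h`
        -- times the relation at `g` loses the term of `j`, while the class of `c` is rescaled by a
        -- nonzero constant.
        cases (no ¬same) = record
          { K = λ i → K i * (χ i h + - χ j h)
          ; κ = κ * (χ c h + - χ j h)
          ; κ≉0 = *-≉0 κ≉0 (difference-≉0 (proj₂ (¬same⇒≉ ¬same)))
          ; K-same = λ same → *-cong (K-same same) (+-congʳ (same⇒≈ same h))
          ; K-others = (λ _ → trans (*-congˡ (-‿inverseʳ (χ j h))) (zeroʳ (K j))) ∷
              All.map (λ e ¬s → trans (*-congʳ (e ¬s)) (zeroˡ _)) K-others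
          ; K-vanish = λ g → begin
              ∑ is (λ i → b i * (K i * (χ i h + - χ j h)) * χ i g)
                ≈⟨ ∑-cong is (split g) ⟩
              ∑ is (λ i → b i * K i * χ i (h ⊙ g) + - χ j h * (b i * K i * χ i g))
                ≈⟨ ∑-+ is _ _ ⟩
              ∑ is (λ i → b i * K i * χ i (h ⊙ g)) + ∑ is (λ i → - χ j h * (b i * K i * χ i g))
                ≈⟨ +-cong (K-vanish (h ⊙ g)) (trans (sym (∑-*ˡ is (- χ j h) _))
                     (trans (*-congˡ (K-vanish g)) (zeroʳ _))) ⟩
              0# + 0#
                ≈⟨ +-identityˡ 0# ⟩
              0# ∎
          }
          where
          h = proj₁ (¬same⇒≉ ¬same)
          split : ∀ g i → b i * (K i * (χ i h + - χ j h)) * χ i g ≈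
                          b i * K i * χ i (h ⊙ g) + - χ j h * (b i * K i * χ i g)
          split g i = begin
            b i * (K i * (x + y)) * z          ≈⟨ *-congʳ (*-assoc (b i) (K i) _) ⟨
            b i * K i * (x + y) * z            ≈⟨ *-assoc k _ z ⟩
            k * ((x + y) * z)                  ≈⟨ *-congˡ (distribʳ z x y) ⟩
            k * (x * z + y * z)                ≈⟨ distribˡ k _ _ ⟩
            k * (x * z) + k * (y * z)          ≈⟨ +-cong (*-congˡ (sym (χ-⊙ i h g)))
                (x*yz≈y*xz k y z) ⟩
            k * χ i (h ⊙ g) + y * (k * z)      ∎
            where
            k = b i * K i
            x = χ i h
            y = - χ j h
            z = χ i g

      class-sum : ∑ is (λ i → select (same? i) (b i)) ≈ 0#
      class-sum = cancel (begin
        κ * ∑ is (λ i → select (same? i) (b i))       ≈⟨ ∑-*ˡ is κ _ ⟩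
        ∑ is (λ i → κ * select (same? i) (b i))
            ≈⟨ ∑-congᴬ (All.map (λ {i} → weigh i) K-others) ⟩
        ∑ is (λ i → b i * K i * χ i g₀)               ≈⟨ K-vanish g₀ ⟩
        0#                                            ∎) κ≉0
        where
        open Eliminator (eliminate is)
        weigh : ∀ i → (¬ Same i → K i ≈ 0#) → κ * select (same? i) (b i) ≈ b i * K i * χ i g₀
        weigh i zeros with same? i
        ... | yes same = trans (*-comm κ (b i)) (trans (*-congˡ (sym (K-same same)))
                (sym (trans (*-congˡ (χ-g₀ i)) (*-identityʳ _))))
        ... | no ¬same = trans (zeroʳ κ) (sym (trans
            (*-congʳ (trans (*-congˡ (zeros ¬same)) (zeroʳ (b i)))) (zeroˡ _)))

    module Regroup {I : Set} (is : List I) (_~_ : I → I → Set) (_~?_ : ∀ i j → Dec (i ~ j))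
      (~-refl : ∀ {i} → i ~ i) (~-sym : ∀ {i j} → i ~ j → j ~ i)
          (~-trans : ∀ {i j k} → i ~ j → j ~ k → i ~ k)
      (φ : I → Carrier) (φ-class : ∀ {i j} → i ∈ is → j ∈ is → i ~ j → φ i ≈ φ j) where

      -- Induction over representatives `js`: since `φ` is constant on the class of `c`, that class
      -- contributes zero and its coefficients may be dropped. That the remaining coefficients are
      -- represented is known only under double negation, which suffices as equality is stable.
      regroup-from : ∀ js (b : I → Carrier) → (∀ {j} → j ∈ js → j ∈ is) →
        (∀ {i} → i ∈ is → ¬ b i ≈ 0# → ¬ ¬ i ∈ js) →
        (∀ c → ∑ is (λ i → select (i ~? c) (b i)) ≈ 0#) → ∑ is (λ i → b i * φ i) ≈ 0#
      regroup-from [] b _ supp _ = trans (∑-congᴬ (All.tabulate λ {i} i∈ →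
          trans (*-congʳ (stable λ b≉0 → supp i∈ b≉0 λ ())) (zeroˡ (φ i)))) (∑-0 is λ _ → refl)
      regroup-from (c ∷ js) b js⊆ supp class = begin
        ∑ is (λ i → b i * φ i)
          ≈⟨ ∑-congᴬ (All.tabulate λ {i} i∈ → split i i∈) ⟩
        ∑ is (λ i → φ c * select (i ~? c) (b i) + b′ i * φ i)
          ≈⟨ ∑-+ is _ _ ⟩
        ∑ is (λ i → φ c * select (i ~? c) (b i)) + ∑ is (λ i → b′ i * φ i)
          ≈⟨ +-cong (trans (sym (∑-*ˡ is (φ c) _)) (trans (*-congˡ (class c)) (zeroʳ (φ c))))
               (regroup-from js b′ (js⊆ ∘ there) supp′ class′) ⟩
        0# + 0#
          ≈⟨ +-identityˡ 0# ⟩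
        0# ∎
        where
        drop : ∀ {P : Set} → Dec P → Carrier → Carrier
        drop (yes _) x = 0#
        drop (no _)  x = x
        b′ : I → Carrier
        b′ i = drop (i ~? c) (b i)
        split : ∀ i → i ∈ is → b i * φ i ≈ φ c * select (i ~? c) (b i) + b′ i * φ i
        split i i∈ with i ~? c
        ... | yes i~c = trans (trans (*-comm (b i) (φ i))
            (*-congʳ (φ-class i∈ (js⊆ (here ≡.refl)) i~c)))
                (sym (trans (+-congˡ (zeroˡ (φ i))) (+-identityʳ _)))
        ... | no _    = sym (trans (+-congʳ (zeroʳ (φ c))) (+-identityˡ _))
        supp′ : ∀ {i} → i ∈ is → ¬ b′ i ≈ 0# → ¬ ¬ i ∈ js
        supp′ {i} i∈ b′≉0 i∉js with i ~? c
        ... | yes _   = b′≉0 refl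
        ... | no ¬i~c = supp i∈ b′≉0 λ where
          (here ≡.refl) → ¬i~c ~-refl
          (there i∈js)  → i∉js i∈js
        class′ : ∀ d → ∑ is (λ i → select (i ~? d) (b′ i)) ≈ 0#
        class′ d with d ~? c
        ... | yes d~c = ∑-0 is λ i → removed i (i ~? d)
          where
          removed : ∀ i (i~?d : Dec (i ~ d)) → select i~?d (b′ i) ≈ 0#
          removed i (no _)    = refl
          removed i (yes i~d) with i ~? c
          ... | yes _   = refl
          ... | no ¬i~c = contradiction (~-trans i~d d~c) ¬i~c
        ... | no ¬d~c = trans (∑-cong is λ i → kept i (i ~? d)) (class d)
          where
          kept : ∀ i (i~?d : Dec (i ~ d)) → select i~?d (b′ i) ≈ select i~?d (b i)
          kept i (no _)    = refl
          kept i (yes i~d) with i ~? c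
          ... | yes i~c = contradiction (~-trans (~-sym i~d) i~c) ¬d~c
          ... | no _    = refl

      regroup : ∀ (b : I → Carrier) → (∀ c → ∑ is (λ i → select (i ~? c) (b i)) ≈ 0#) →
                ∑ is (λ i → b i * φ i) ≈ 0#
      regroup b = regroup-from is b (λ j∈ → j∈) (λ i∈ _ k → k i∈)

  record CyclotomicRing (R : CommutativeRing 0ℓ 0ℓ) : Set where
    open RingSums R
    field
      domain         : StableDomain R
      local          : ∀ {x y} → x + y ≈ 1# → Invertible x ⊎ Invertible y
      ℕ-invertible   : ∀ n → Invertible (pos (suc n) · 1#)
      primitive-root : ∀ Q → 0 < Q → ∃[ z ] MannTheorem.Primitive R domain z Q

  -- The unit group as a torsion theory, and points outside a coset.

  module Units (R : CommutativeRing 0ℓ 0ℓ) (cyclotomic : CyclotomicRing R) where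

    open CyclotomicRing cyclotomic public
    open Grouping R domain public
    open Local local ℕ-invertible public
    open UnitGroup R public using (Unit; unit; val; inv; mk≈ᵘ; val-≈)

    U : AbelianGroup 0ℓ 0ℓ
    U = UnitGroup.abelianGroup R

    module U where
      open AbelianGroup U public
      open IntegerPower U public

    val-^ : ∀ x n → val (x U.^ n) ≈ val x ^ n
    val-^ x zero    = refl
    val-^ x (suc n) = *-congˡ (val-^ x n)

    ^-val : ∀ {x n} → x U.^ n U.≈ U.ε → val x ^ n ≈ 1#
    ^-val {x} {n} (mk≈ᵘ e) = trans (sym (val-^ x n)) e

    primitive-unit : ∀ {Q} → 0 < Q → ∃[ z ] Primitive z Q → Unit
    primitive-unit {suc q} _ (z , prim) = unit z (z ^ q) (^-order prim)

    val-primitive-unit : ∀ {Q} (0<Q : 0 < Q) z → val (primitive-unit 0<Q z) ≡ proj₁ z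
    val-primitive-unit {suc q} _ z = ≡.refl

    ^-unit : ∀ {Q} (0<Q : 0 < Q) z e → val (primitive-unit 0<Q z U.^ e) ≈ proj₁ z ^ e
    ^-unit 0<Q z e = trans (val-^ (primitive-unit 0<Q z) e)
      (reflexive (≡.cong (_^ e) (val-primitive-unit 0<Q z)))

    torsionTheory : TorsionTheory U
    torsionTheory = record
      { trivial?  = λ {ζ} {Q} 0<Q ζ^Q → map′ mk≈ᵘ val-≈ (one? {val ζ} {Q} 0<Q (^-val {ζ} {Q} ζ^Q))
      ; generator = λ Q 0<Q → let z = primitive-root Q 0<Q in primitive-unit 0<Q z ,
          mk≈ᵘ (trans (^-unit 0<Q z Q) (^-order (proj₂ z))) ,
          λ ζ ζ^Q → let (e , h) = power-of-primitive 0<Q (proj₂ z) (^-val {ζ} {Q} ζ^Q) in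
            e , mk≈ᵘ (trans h (sym (^-unit 0<Q z e)))
      ; root = extract
      }
      where
      extract : ∀ {ζ Q} d → 0 < Q → 0 < d → ζ U.^ Q U.≈ U.ε →
                Σ[ t ∈ Unit ] t U.^ d U.≈ ζ × t U.^ (d ℕ.* Q) U.≈ U.ε
      extract {ζ} {Q} d 0<Q 0<d ζ^Q = t ,
        mk≈ᵘ (trans (power d) (trans (reflexive (≡.cong (z ^_) (ℕ.*-comm e d)))
          (trans (sym (^-assocʳ z d e)) (sym ζ≈)))) ,
        mk≈ᵘ (trans (power (d ℕ.* Q)) (trans (reflexive (≡.cong (z ^_) (ℕ.*-comm e (d ℕ.* Q))))
          (^-multiple {z} {d ℕ.* Q} (^-order prim) e)))
        where
        instance
          _ = ℕ.>-nonZero 0<d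
        0<dQ : 0 < d ℕ.* Q
        0<dQ = ℕ.*-mono-≤ 0<d 0<Q
        -- For `z` of order `d * Q` the power `z ^ d` has order `Q`, so `ζ` is some `(z ^ d) ^ e`
        -- and `z ^ e` is a `d`-th root of it.
        p = primitive-root (d ℕ.* Q) 0<dQ
        z = proj₁ p
        prim = proj₂ p
        found = power-of-primitive 0<Q (primitive-^ {z} {d} {Q} prim) (^-val {ζ} {Q} ζ^Q)
        e = proj₁ found
        ζ≈ : val ζ ≈ (z ^ d) ^ e
        ζ≈ = proj₂ found
        t : Unit
        t = primitive-unit 0<dQ p U.^ e
        power : ∀ m → val (t U.^ m) ≈ z ^ (e ℕ.* m)
        power m = trans (val-^ t m) (trans (^-congˡ m (^-unit 0<dQ p e)) (^-assocʳ z e m))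

    open Torsion U torsionTheory public renaming (^-multiple to ^ᵘ-multiple)

    -- A unit of infinite order: its integer powers determine the exponent, so points with
    -- coordinates powers of 2 serve as generic points.
    two : Unit
    two = unit (pos 2 · 1#) (proj₁ (ℕ-invertible 1)) (proj₂ (ℕ-invertible 1))

    two^≉ε : ∀ n → ¬ two U.^ suc n U.≈ U.ε
    two^≉ε n (mk≈ᵘ e) = char-0ℤ {pos (2 ℕ.^ suc n) ℤ.+ -[1+ 0 ]} (λ eq → power≢1 n (i+j≡0 eq))
        (begin
      (pos (2 ℕ.^ suc n) ℤ.+ -[1+ 0 ]) · 1#         ≈⟨ ·-+ (pos (2 ℕ.^ suc n)) -[1+ 0 ] 1# ⟩
      pos (2 ℕ.^ suc n) · 1# + -[1+ 0 ] · 1#        ≈⟨ +-cong (trans (sym (power (suc n))) e)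
                                                         (trans (neg-· 1ℤ 1#) (-‿cong (1·x≈x 1#))) ⟩
      1# + - 1#                                     ≈⟨ -‿inverseʳ 1# ⟩
      0#                                            ∎)
      where
      power : ∀ n → val (two U.^ n) ≈ pos (2 ℕ.^ n) · 1#
      power zero    = sym (1·x≈x 1#)
      power (suc n) = trans (*-congˡ (power n)) (trans (·-assoc (pos 2) 1# _)
        (trans (·-congʳ (pos 2) (*-identityˡ _)) (sym
            (trans (·-congˡ 1# (ℤ.pos-* 2 (2 ℕ.^ n))) (·-* (pos 2) (pos (2 ℕ.^ n)) 1#)))))
      i+j≡0 : ∀ {m} → pos m ℤ.+ -[1+ 0 ] ≡ 0ℤ → m ≡ 1
      i+j≡0 {suc zero} _ = ≡.refl
      power≢1 : ∀ n → 2 ℕ.^ suc n ≢ 1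
      power≢1 n eq = ℕ.<⇒≢ (ℕ.*-mono-≤ {2} {2} ℕ.≤-refl (ℕ.m^n>0 2 n)) (≡.sym eq)

    two^ᶻ-injective : ∀ a → two U.^ᶻ a U.≈ U.ε → a ≡ 0ℤ
    two^ᶻ-injective (pos zero)    _ = ≡.refl
    two^ᶻ-injective (pos (suc n)) e = contradiction e (two^≉ε n)
    two^ᶻ-injective -[1+ n ]      e = contradiction
        (U.trans (U.sym (⁻¹-involutive _)) (U.trans (U.⁻¹-cong e) ε⁻¹≈ε)) (two^≉ε n)
      where open import Algebra.Properties.AbelianGroup U using (⁻¹-involutive; ε⁻¹≈ε)

    -- The vector `x` is a character trivial on the torus, yet at the given point its value is 2 to
    -- the power `dot v x`, which is not 1.
    two^v∉torus : ∀ {r n} (E : Fin r → Vecᶻ n) v x → (∀ j → dot (E j) x ≡ 0ℤ) → dot v x ≢ 0ℤ →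
                  ¬ InTorus E (λ i → two U.^ᶻ v i)
    two^v∉torus E v x Ex≡0 vx≢0 (t , h) = vx≢0 (two^ᶻ-injective (dot v x) (U.trans
      (U.trans (U.^ᶻ-sum two (λ i → v i ℤ.* x i)) (U.∏-cong λ i → U.^ᶻ-* two (v i) (x i)))
      (U.trans (U.character-cong x h) (U.trans (U.character-monomialMap E t x)
        (U.∏-ε {f = λ j → t j U.^ᶻ dot (E j) x} λ j → U.reflexive (≡.cong (t j U.^ᶻ_) (Ex≡0 j)))))))

    translate : ∀ {r n} (E : Fin r → Vecᶻ n) (ω x h : Fin n → Unit) t →
        (∀ i → x i U.≈ ω i U.∙ h i) →
      (∀ i → h i U.≈ U.monomialMap E t i) → ∀ i → ω i U.∙ U.monomialMap E t i U.≈ x i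
    translate E ω x h t x≈ h≈ i = U.sym (U.trans (x≈ i) (U.∙-congˡ (h≈ i)))

    monomialMap-ε◂ : ∀ {r n} (E : Fin r → Vecᶻ n) v t (h : Fin n → Unit) →
      (∀ i → h i U.≈ U.monomialMap E t i) → ∀ i → h i U.≈ U.monomialMap (v ◂ E) (U.ε ◂ t) i
    monomialMap-ε◂ E v t h h≈ i = U.trans (h≈ i) (U.sym
        (U.trans (U.∙-congʳ (U.ε^ᶻ (v i))) (U.identityˡ _)))

    monomialMap-◂ε : ∀ {r n} (E : Fin r → Vecᶻ n) v y i →
      y U.^ᶻ v i U.≈ U.monomialMap (v ◂ E) (y ◂ λ _ → U.ε) i
    monomialMap-◂ε E v y i = U.sym (U.trans
      (U.∙-congˡ (character-trivial {x = λ _ → U.ε} (λ j → E j i) λ _ → U.refl)) (U.identityʳ _))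

    ω·two^v∉coset : ∀ {r n} (E : Fin r → Vecᶻ n) v x → (∀ j → dot (E j) x ≡ 0ℤ) → dot v x ≢ 0ℤ →
      ∀ (ω h : Fin n → Unit) → InTorus E h → ¬ (∀ i → ω i U.∙ two U.^ᶻ v i U.≈ ω i U.∙ h i)
    ω·two^v∉coset E v x Ex≡0 vx≢0 ω h h∈ eq = two^v∉torus E v x Ex≡0 vx≢0
      (inTorus-cong {E = E} (λ i → U.sym (∙-cancelˡ (ω i) (two U.^ᶻ v i) (h i) (eq i))) h∈)
      where open import Algebra.Properties.Group U.group using (∙-cancelˡ)

    record IntegralMultiple {I : Set} (is : List I) (q : I → Carrier) : Set where
      field
        d    : ℤ
        d≢0  : d ≢ 0ℤ
        A    : I → ℤ
        d·q≈ : All (λ i → d · q i ≈ A i · 1#) is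

    -- The product of the denominators clears all of them. `D i` is the denominator minus one, as
    -- rationals store it, so that `suc (D i)` is visibly nonzero.
    clear-denominators : ∀ {I : Set} (is : List I) (q : I → Carrier) (D : I → ℕ) (N : I → ℤ) →
      (∀ i → pos (suc (D i)) · q i ≈ N i · 1#) → IntegralMultiple is q
    clear-denominators {I} is q D N Dq≈N = record
      { d = pos d ; d≢0 = λ e → ℕ.≢-nonZero⁻¹ d (ℤ.+-injective e)
      ; A = λ i → pos (d / suc (D i)) ℤ.* N i
      ; d·q≈ = All.tabulate λ {i} i∈ → begin
          pos d · q i
            ≡⟨ ≡.cong (λ k → pos k · q i) (m/n*n≡m (∈⇒∣product (∈-map⁺ (suc ∘ D) i∈))) ⟨
          pos (d / suc (D i) ℕ.* suc (D i)) · q i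
            ≈⟨ trans (·-congˡ (q i) (ℤ.pos-* (d / suc (D i)) (suc (D i))))
                (·-* (pos (d / suc (D i))) (pos (suc (D i))) (q i)) ⟩
          pos (d / suc (D i)) · pos (suc (D i)) · q i
            ≈⟨ ·-congʳ (pos (d / suc (D i))) (Dq≈N i) ⟩
          pos (d / suc (D i)) · N i · 1#
            ≈⟨ ·-* (pos (d / suc (D i))) (N i) 1# ⟨
          (pos (d / suc (D i)) ℤ.* N i) · 1# ∎
      }
      where
      d : ℕ
      d = product (map (suc ∘ D) is)
      instance
        d≢0 : NonZero d
        d≢0 = product≢0 (All.tabulate λ k∈ → nonZero k∈)
          where
          nonZero : ∀ {k} → k ∈ map (suc ∘ D) is → NonZero k
          nonZero k∈ with _ , _ , ≡.refl ← ∈-map⁻ (suc ∘ D) k∈ = _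

    -- Mann's theorem for fractional coefficients and for a subsum already selected by `P?`. Terms
    -- outside the subsum receive coefficient zero, so the list and its length stay the same.
    mann-classes : ∀ {I N z Q} (is : List I) → length is ≤ N → (M : MannModulus I N z Q) →
      ∀ {P : I → Set} (P? : ∀ i → Dec (P i)) (q w : I → Carrier) (e : I → ℕ) → IntegralMultiple is
          q →
      (∀ i → w i ≈ z ^ e i) → ∑ is (λ i → select (P? i) (q i * w i)) ≈ 0# →
      ∀ c → ∑ is (λ i → select (P? i ×-dec (_%_ (e i) (MannModulus.g M) {{MannModulus.g≢0 M}} ℕ.≟
          _%_ (e c) (MannModulus.g M) {{MannModulus.g≢0 M}})) (q i * w i)) ≈ 0#
    mann-classes {I} {z = z} is len M P? q w e mult w≈ vanish c = ·-cancel d≢0 (begin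
      d · ∑ is (λ i → select (P? i ×-dec (e i % g ℕ.≟ e c % g)) (q i * w i))
        ≈⟨ trans (∑-· is d _) (∑-congᴬ (All.map (λ {i} h → trans
            (scale i (P? i ×-dec (e i % g ℕ.≟ e c % g)) h)
             (·-congˡ (z ^ e i) (×-mask (P? i) (e i % g ℕ.≟ e c % g) (A i)))) d·q≈)) ⟩
      ∑ is (λ i → mask (e i % g ℕ.≟ e c % g) (mask (P? i) (A i)) · z ^ e i)
        ≈⟨ class-sum is (λ i → mask (P? i) (A i)) e len vanish′ (e c) ⟩
      0# ∎)
      where
      open MannModulus M
      open IntegralMultiple mult
      scale : ∀ i {X : Set} (X? : Dec X) → d · q i ≈ A i · 1# → d · select X? (q i * w i) ≈ mask
          X? (A i) · z ^ e i
      scale i (no _)  h = ·-0# d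
      scale i (yes _) h = begin
        d · (q i * w i)        ≈⟨ ·-assoc d (q i) (w i) ⟨
        (d · q i) * w i        ≈⟨ *-cong h (w≈ i) ⟩
        (A i · 1#) * z ^ e i   ≈⟨ ·-as-* (A i) (z ^ e i) ⟨
        A i · z ^ e i          ∎
      ×-mask : ∀ {X Y : Set} (X? : Dec X) (Y? : Dec Y) a → mask (X? ×-dec Y?) a ≡ mask Y?
          (mask X? a)
      ×-mask (yes _) (yes _) a = ≡.refl
      ×-mask (yes _) (no _)  a = ≡.refl
      ×-mask (no _)  (yes _) a = ≡.refl
      ×-mask (no _)  (no _)  a = ≡.refl
      vanish′ : ∑ is (λ i → mask (P? i) (A i) · z ^ e i) ≈ 0#
      vanish′ = trans (∑-congᴬ (All.map (λ {i} h → sym (scale i (P? i) h)) d·q≈))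
        (trans (sym (∑-· is d _)) (trans (·-congʳ d vanish) (·-0# d)))

  -- Differences of exponents and the final estimate.

  square-difference : ∀ p q → (1ℤ ℤ.* pos p ℤ.+ ℤ.-1ℤ ℤ.* pos q) ℤ.*
      (1ℤ ℤ.* pos p ℤ.+ ℤ.-1ℤ ℤ.* pos q) ≡ pos (ℕ.∣ p - q ∣ ℕ.^ 2)
  square-difference p q with ℕ.≤-total p q
  ... | inj₁ p≤q = begin
    (1ℤ ℤ.* pos p ℤ.+ ℤ.-1ℤ ℤ.* pos q) ℤ.* (1ℤ ℤ.* pos p ℤ.+ ℤ.-1ℤ ℤ.* pos q)
      ≡⟨ ≡.cong (λ k → (1ℤ ℤ.* pos p ℤ.+ ℤ.-1ℤ ℤ.* pos k) ℤ.* (1ℤ ℤ.* pos p ℤ.+ ℤ.-1ℤ ℤ.* pos k))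
          (ℕ.m+[n∸m]≡n p≤q) ⟨
    (1ℤ ℤ.* pos p ℤ.+ ℤ.-1ℤ ℤ.* (pos p ℤ.+ pos (q ∸ p))) ℤ.*
        (1ℤ ℤ.* pos p ℤ.+ ℤ.-1ℤ ℤ.* (pos p ℤ.+ pos (q ∸ p)))
      ≡⟨ lemma (pos p) (pos (q ∸ p)) ⟩
    pos (q ∸ p) ℤ.* pos (q ∸ p)
      ≡⟨ ℤ.pos-* (q ∸ p) (q ∸ p) ⟨
    pos ((q ∸ p) ℕ.* (q ∸ p))
      ≡⟨ ≡.cong pos (≡.trans (≡.cong ((q ∸ p) ℕ.*_) (≡.sym (ℕ.*-identityʳ (q ∸ p))))
          (≡.cong (ℕ._^ 2) (≡.sym (ℕ.m≤n⇒∣m-n∣≡n∸m p≤q)))) ⟩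
    pos (ℕ.∣ p - q ∣ ℕ.^ 2) ∎
    where
    open ≡.≡-Reasoning
    lemma : ∀ p d → (1ℤ ℤ.* p ℤ.+ ℤ.-1ℤ ℤ.* (p ℤ.+ d)) ℤ.* (1ℤ ℤ.* p ℤ.+ ℤ.-1ℤ ℤ.* (p ℤ.+ d)) ≡ d
        ℤ.* d
    lemma = ℤ-Solver.solve-∀
  ... | inj₂ q≤p = begin
    (1ℤ ℤ.* pos p ℤ.+ ℤ.-1ℤ ℤ.* pos q) ℤ.* (1ℤ ℤ.* pos p ℤ.+ ℤ.-1ℤ ℤ.* pos q)
      ≡⟨ ≡.cong (λ k → (1ℤ ℤ.* pos k ℤ.+ ℤ.-1ℤ ℤ.* pos q) ℤ.* (1ℤ ℤ.* pos k ℤ.+ ℤ.-1ℤ ℤ.* pos q))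
          (ℕ.m+[n∸m]≡n q≤p) ⟨
    (1ℤ ℤ.* (pos q ℤ.+ pos (p ∸ q)) ℤ.+ ℤ.-1ℤ ℤ.* pos q) ℤ.*
        (1ℤ ℤ.* (pos q ℤ.+ pos (p ∸ q)) ℤ.+ ℤ.-1ℤ ℤ.* pos q)
      ≡⟨ lemma (pos q) (pos (p ∸ q)) ⟩
    pos (p ∸ q) ℤ.* pos (p ∸ q)
      ≡⟨ ℤ.pos-* (p ∸ q) (p ∸ q) ⟨
    pos ((p ∸ q) ℕ.* (p ∸ q))
      ≡⟨ ≡.cong pos (≡.trans (≡.cong ((p ∸ q) ℕ.*_) (≡.sym (ℕ.*-identityʳ (p ∸ q))))
          (≡.cong (ℕ._^ 2) (≡.sym (ℕ.m≤n⇒∣n-m∣≡n∸m q≤p)))) ⟩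
    pos (ℕ.∣ p - q ∣ ℕ.^ 2) ∎
    where
    open ≡.≡-Reasoning
    lemma : ∀ q d → (1ℤ ℤ.* (q ℤ.+ d) ℤ.+ ℤ.-1ℤ ℤ.* q) ℤ.* (1ℤ ℤ.* (q ℤ.+ d) ℤ.+ ℤ.-1ℤ ℤ.* q) ≡ d
        ℤ.* d
    lemma = ℤ-Solver.solve-∀

  exponents : ∀ {n} → Vec ℕ n → Vecᶻ n
  exponents i j = pos (lookup i j)

  difference : ∀ {n} → Vec ℕ n × Vec ℕ n → Vecᶻ n
  difference (i , c) j = 1ℤ ℤ.* exponents i j ℤ.+ ℤ.-1ℤ ℤ.* exponents c j

  dot-difference-self : ∀ {n} (i c : Vec ℕ n) → dot (difference (i , c)) (difference (i , c)) ≡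
      pos (distance² i c)
  dot-difference-self []      []      = ≡.refl
  dot-difference-self (x ∷ i) (y ∷ c) = ≡.cong₂ ℤ._+_ (square-difference x y)
      (dot-difference-self i c)

  dot-difference : ∀ {n} (v : Vecᶻ n) i c →
                   dot v (difference (i , c)) ≡ 1ℤ ℤ.* dot v (exponents i) ℤ.+ ℤ.-1ℤ ℤ.* dot v
                       (exponents c)
  dot-difference v i c = dot-lin v 1ℤ (exponents i) ℤ.-1ℤ (exponents c)

  difference≡0 : ∀ {a b} → a ≡ b → 1ℤ ℤ.* a ℤ.+ ℤ.-1ℤ ℤ.* b ≡ 0ℤ
  difference≡0 {a} ≡.refl = lemma a
    where
    lemma : ∀ a → 1ℤ ℤ.* a ℤ.+ ℤ.-1ℤ ℤ.* a ≡ 0ℤ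
    lemma = ℤ-Solver.solve-∀

  difference≡0⁻¹ : ∀ {a b} → 1ℤ ℤ.* a ℤ.+ ℤ.-1ℤ ℤ.* b ≡ 0ℤ → a ≡ b
  difference≡0⁻¹ {a} {b} e = ≡.trans (lemma a b) (≡.trans (≡.cong (ℤ._+ b) e) (ℤ.+-identityˡ b))
    where
    lemma : ∀ a b → a ≡ 1ℤ ℤ.* a ℤ.+ ℤ.-1ℤ ℤ.* b ℤ.+ b
    lemma = ℤ-Solver.solve-∀

  dot-δ : ∀ {n} i (v : Vecᶻ n) → dot (δᶻ i) v ≡ v i
  dot-δ zero    v = ≡.trans (≡.cong₂ ℤ._+_ (ℤ.*-identityˡ (v zero))
      (sum-0 (λ j → 0ℤ ℤ.* v (suc j)) λ _ → ≡.refl)) (ℤ.+-identityʳ _)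
  dot-δ (suc i) v = ≡.trans (ℤ.+-identityˡ _) (dot-δ i (v ∘ suc))

  -- For positive `K` the passage from `K ^ s` with `s ≤ k` to the required bound only enlarges. For
  -- `K = 0` a positive `s` contradicts `0 < m`, and `s = 0` would allow `m = 1` because
  -- `0 ^ 0 = 1`; there the hypothesis on `K`, `s` and `k` forces `k = 0`.
  exponent-bound : ∀ K s k → s ≤ k → (K ≡ 0 → s ≡ 0 → k ≡ 0) → ∀ {m} → 0 < m → m ℕ.^ 2 ≤ K ℕ.^ s →
                   m ℕ.^ 2 ≤ K ℕ.^ (2 ℕ.* k) ℕ.* k ℕ.^ k
  exponent-bound zero    zero    k s≤k deg 0<m m²≤ with ≡.refl ← deg ≡.refl ≡.refl = m²≤
  exponent-bound zero    (suc s) k s≤k deg {suc m} 0<m ()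
  exponent-bound (suc K) s       k s≤k deg 0<m m²≤ = ℕ.≤-trans m²≤ (ℕ.≤-trans
    (ℕ.^-monoʳ-≤ (suc K) (ℕ.≤-trans s≤k (ℕ.m≤n*m k 2)))
    (ℕ.m≤m*n (suc K ℕ.^ (2 ℕ.* k)) (k ℕ.^ k) {{k^k≢0 k}}))
    where
    k^k≢0 : ∀ k → NonZero (k ℕ.^ k)
    k^k≢0 zero    = _
    k^k≢0 (suc k) = ℕ.m^n≢0 (suc k) (suc k)

  -- The exponent of a maximal torsion coset.

  module ExponentTheorem (R : CommutativeRing 0ℓ 0ℓ) (cyclotomic : CyclotomicRing R)
    {n L : ℕ} (𝒩 : List (Vec ℕ n)) (q : Fin L → Vec ℕ n → CommutativeRing.Carrier R)
    (multiple : ∀ ℓ → Units.IntegralMultiple R cyclotomic 𝒩 (q ℓ)) where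

    open Units R cyclotomic

    monomialᵘ : (Fin n → Unit) → Vec ℕ n → Unit
    monomialᵘ x i = U.character x (exponents i)

    OnVariety : (Fin n → Unit) → Set
    OnVariety x = ∀ ℓ → ∑ 𝒩 (λ i → q ℓ i * val (monomialᵘ x i)) ≈ 0#

    module _ {r} (E : Fin r → Vecᶻ n) (rank : HasFullRowRank E)
      (ω : Fin n → Unit) {Q} (0<Q : 0 < Q) (ω^Q≈ε : ∀ i → ω i U.^ Q U.≈ U.ε)
      (onVariety : ∀ t → OnVariety (λ i → ω i U.∙ U.monomialMap E t i))
      -- Maximality in the form used: no additional row `v` that is nonzero somewhere on the kernel
      -- of `E` gives a coset on the variety.
      (maximal : ∀ v x → (∀ j → dot (E j) x ≡ 0ℤ) → dot v x ≢ 0ℤ →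
                 ¬ (∀ t → OnVariety (λ i → ω i U.∙ U.monomialMap (v ◂ E) t i))) where

      private
        N = length 𝒩
        z = proj₁ (primitive-root Q 0<Q)
        prim = proj₂ (primitive-root Q 0<Q)

        abstract
          modulus : MannModulus (Vec ℕ n) N z Q
          modulus = mann (Vec ℕ n) N Q 0<Q prim

        open MannModulus modulus using (g; Q′; Q≡; Q′∣)

        instance
          g-nonZero : NonZero g
          g-nonZero = MannModulus.g≢0 modulus

        w : Vec ℕ n → Carrier
        w i = val (monomialᵘ ω i)

        abstract
          power : ∀ i → ∃[ e ] w i ≈ z ^ e
          power i = power-of-primitive 0<Q prim (^-val {monomialᵘ ω i} {Q}
            (character-torsion {x = ω} {Q} (exponents i) ω^Q≈ε))

        e : Vec ℕ n → ℕ
        e i = proj₁ (power i)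

        image : Vec ℕ n → Vecᶻ r
        image i j = dot (E j) (exponents i)

        Same : Vec ℕ n → Vec ℕ n → Set
        Same c i = ∀ j → image i j ≡ image c j

        same? : ∀ c i → Dec (Same c i)
        same? c i = all? λ j → image i j ℤ.≟ image c j

        monomial-split : ∀ {s} (F : Fin s → Vecᶻ n) t i →
          val (monomialᵘ (λ j → ω j U.∙ U.monomialMap F t j) i) ≈
          w i * val (U.character t (λ j → dot (F j) (exponents i)))
        monomial-split F t i = val-≈ (U.trans (U.character-∙ ω (U.monomialMap F t) (exponents i))
          (U.∙-congˡ (U.character-monomialMap F t (exponents i))))

        value-split : ∀ {s} (F : Fin s → Vecᶻ n) t ℓ →
          ∑ 𝒩 (λ i → q ℓ i * val (monomialᵘ (λ j → ω j U.∙ U.monomialMap F t j) i)) ≈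
          ∑ 𝒩 (λ i → q ℓ i * w i * val (U.character t (λ j → dot (F j) (exponents i))))
        value-split F t ℓ = ∑-cong 𝒩 λ i → trans (*-congˡ (monomial-split F t i))
            (sym (*-assoc _ _ _))

        -- The two images differ in some entry `l`; the parameter that is 2 at `l` and 1 elsewhere
        -- gives the two characters different powers of 2.
        separating : ∀ {c i} → ¬ Same c i → ∃[ t ] ¬ val (U.character t (image c)) ≈ val
            (U.character t (image i))
        separating {c} {i} ¬same = (λ j → two U.^ᶻ δᶻ l j) , λ eq → ne
            (≡.sym (two-≈ (image c l) (image i l)
            (U.trans (U.sym (at-l c)) (U.trans (mk≈ᵘ eq) (at-l i)))))
          where
          found = ¬∀⟶∃¬ r (λ j → image i j ≡ image c j) (λ j → image i j ℤ.≟ image c j) ¬same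
          l = proj₁ found
          ne = proj₂ found
          at-l : ∀ a → U.character (λ j → two U.^ᶻ δᶻ l j) (image a) U.≈ two U.^ᶻ image a l
          at-l a = U.trans (U.trans (U.∏-cong λ j → U.sym (U.^ᶻ-* two (δᶻ l j) (image a j)))
              (U.sym (U.^ᶻ-sum two (λ j → δᶻ l j ℤ.* image a j))))
            (U.reflexive (≡.cong (two U.^ᶻ_) (dot-δ l (image a))))
          two-≈ : ∀ a b → two U.^ᶻ a U.≈ two U.^ᶻ b → a ≡ b
          two-≈ a b h = ℤ.i-j≡0⇒i≡j a b (two^ᶻ-injective (a ℤ.- b) (U.trans (U.^ᶻ-+ two a (ℤ.- b))
            (U.trans (U.∙-congʳ h) (U.trans (U.sym (U.^ᶻ-+ two b (ℤ.- b)))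
              (U.reflexive (≡.cong (two U.^ᶻ_) (ℤ.+-inverseʳ b)))))))

        same-sum : ∀ ℓ c → ∑ 𝒩 (λ i → select (same? c i) (q ℓ i * w i)) ≈ 0#
        same-sum ℓ c = Independence.class-sum 𝒩 (λ i → q ℓ i * w i)
          (λ i t → val (U.character t (image i))) (λ s t j → s j U.∙ t j)
          (λ i s t → val-≈ (U.character-∙ s t (image i)))
          (λ _ → U.ε) (λ i → val-≈ (character-trivial {x = λ _ → U.ε} (image i) λ _ → U.refl))
          (λ t → trans (sym (value-split E t ℓ)) (onVariety t ℓ))
          (Same c) (same? c) c (λ same t → val-≈ (U.character-congʳ t same))
              (λ {i} → separating {c} {i})

        _~_ : Vec ℕ n → Vec ℕ n → Set
        i ~ c = Same c i × e i % g ≡ e c % g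

        _~?_ : ∀ i c → Dec (i ~ c)
        i ~? c = same? c i ×-dec (e i % g ℕ.≟ e c % g)

        class-sums : ∀ ℓ c → ∑ 𝒩 (λ i → select (i ~? c) (q ℓ i * w i)) ≈ 0#
        class-sums ℓ c = mann-classes 𝒩 ℕ.≤-refl modulus (same? c) (q ℓ) w e (multiple ℓ)
            (λ i → proj₂ (power i))
          (same-sum ℓ c) c

        D : List (Vecᶻ n)
        D = map difference (filter (uncurry _~?_) (cartesianProduct 𝒩 𝒩))

        difference∈D : ∀ {i c} → i ∈ 𝒩 → c ∈ 𝒩 → i ~ c → difference (i , c) ∈ D
        difference∈D i∈ c∈ i~c = ∈-map⁺ difference
            (∈-filter⁺ (uncurry _~?_) (∈-cartesianProduct⁺ i∈ c∈) i~c)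

        record Difference (x : Vecᶻ n) : Set where
          field
            {i c} : Vec ℕ n
            i∈    : i ∈ 𝒩
            c∈    : c ∈ 𝒩
            i~c   : i ~ c
            x≡    : x ≡ difference (i , c)

        fromD : ∀ {x} → x ∈ D → Difference x
        fromD x∈ = go (∈-map⁻ difference x∈)
          where
          go : ∀ {x} → ∃[ p ] p ∈ filter (uncurry _~?_) (cartesianProduct 𝒩 𝒩) × x ≡ difference p
              → Difference x
          go ((i , c) , p∈ , x≡) =
            let (p∈′ , i~c) = ∈-filter⁻ (uncurry _~?_) {xs = cartesianProduct 𝒩 𝒩} p∈
                (i∈ , c∈) = ∈-cartesianProduct⁻ 𝒩 𝒩 p∈′
            in record { i∈ = i∈ ; c∈ = c∈ ; i~c = i~c ; x≡ = x≡ }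

        abstract
          basis : ∃[ s ] Σ[ μ ∈ (Fin s → Vecᶻ n) ]
            HasFullRowRank μ × (∀ l → μ l ∈ D) × (∀ x → x ∈ D → InRationalSpan μ x)
          basis = extract-basis D

        s = proj₁ basis
        μ : Fin s → Vecᶻ n
        μ = proj₁ (proj₂ basis)
        μ-rank : HasFullRowRank μ
        μ-rank = proj₁ (proj₂ (proj₂ basis))
        μ∈D : ∀ l → μ l ∈ D
        μ∈D = proj₁ (proj₂ (proj₂ (proj₂ basis)))
        D-span : ∀ x → x ∈ D → InRationalSpan μ x
        D-span = proj₂ (proj₂ (proj₂ (proj₂ basis)))

        E⊥μ : ∀ l j → dot (E j) (μ l) ≡ 0ℤ
        E⊥μ l j = ≡.trans (≡.cong (dot (E j)) x≡)
          (≡.trans (dot-difference (E j) i c) (difference≡0 (proj₁ i~c j)))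
          where open Difference (fromD (μ∈D l))

        -- A functional killing μ but not ker E would enlarge the torsion coset.
        kernel-in-span : ∀ x → (∀ j → dot (E j) x ≡ 0ℤ) → InRationalSpan μ x
        kernel-in-span x Ex≡0 = cases (separate μ x)
          where
          cases : InRationalSpan μ x ⊎ Separable μ x → InRationalSpan μ x
          cases (inj₁ in-span)         = in-span
          cases (inj₂ (v , v⊥μ , vx≢0)) = contradiction enlarged (maximal v x Ex≡0 vx≢0)
            where
            image⁺ : Vec ℕ n → Vecᶻ (suc r)
            image⁺ i j = dot ((v ◂ E) j) (exponents i)
            -- As `v` kills all differences of equivalent exponents, the characters of the enlarged
            -- torus remain constant on classes, and the vanishing class sums can be regrouped with
            -- these characters as weights.
            image⁺-class : ∀ {i c} → i ∈ 𝒩 → c ∈ 𝒩 → i ~ c → ∀ j → image⁺ i j ≡ image⁺ c j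
            image⁺-class {i} {c} i∈ c∈ i~c zero    = difference≡0⁻¹
                (≡.trans (≡.sym (dot-difference v i c))
              (kills-span v μ v⊥μ (D-span (difference (i , c)) (difference∈D i∈ c∈ i~c))))
            image⁺-class         i∈ c∈ i~c (suc j) = proj₁ i~c j
            φ : (Fin (suc r) → Unit) → Vec ℕ n → Carrier
            φ t i = val (U.character t (image⁺ i))
            φ-class : ∀ t {i c} → i ∈ 𝒩 → c ∈ 𝒩 → i ~ c → φ t i ≈ φ t c
            φ-class t {i} {c} i∈ c∈ i~c =
              val-≈ (U.character-congʳ t {image⁺ i} {image⁺ c} (image⁺-class i∈ c∈ i~c))
            enlarged : ∀ t → OnVariety (λ i → ω i U.∙ U.monomialMap (v ◂ E) t i)
            enlarged t ℓ = trans (value-split (v ◂ E) t ℓ)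
              (Regroup.regroup 𝒩 _~_ _~?_ ((λ _ → ≡.refl) , ≡.refl)
                (λ (p , p′) → (λ j → ≡.sym (p j)) , ≡.sym p′)
                (λ (p , p′) (q , q′) → (λ j → ≡.trans (p j) (q j)) , ≡.trans p′ q′)
                (φ t) (φ-class t) (λ i → q ℓ i * w i) (class-sums ℓ))

        -- The values of `ω` at two equivalent exponents are powers of `z` that agree modulo `g`, so
        -- their quotient is a power of `z ^ g`, which is killed by `Q′` because `Q ≡ Q′ * g`.
        character-μ : ∀ l → U.character ω (μ l) U.^ Q′ U.≈ U.ε
        character-μ l = U.trans
          (U.^-cong Q′ (U.trans (U.reflexive (≡.cong (U.character ω) x≡)) quotient))
          (U.trans (U.^-∙ _ _ Q′) (U.trans (U.∙-cong (mk≈ᵘ same-power) (⁻¹-^ (monomialᵘ ω c) Q′))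
              (U.inverseʳ _)))
          where
          open Difference (fromD (μ∈D l))
          quotient : U.character ω (difference (i , c)) U.≈ monomialᵘ ω i U.∙ monomialᵘ ω c U.⁻¹
          quotient = U.trans (U.character-+ ω (λ j → 1ℤ ℤ.* exponents i j)
              (λ j → ℤ.-1ℤ ℤ.* exponents c j))
            (U.∙-cong (U.trans (U.character-* ω 1ℤ (exponents i)) (U.^ᶻ-1 _))
              (U.trans (U.character-* ω ℤ.-1ℤ (exponents c)) (U.⁻¹-cong (U.^-1 _))))
          z^g^Q′ : (z ^ g) ^ Q′ ≈ 1#
          z^g^Q′ = trans (^-assocʳ z g Q′) (trans (reflexive (≡.cong (z ^_)
            (≡.trans (ℕ.*-comm g Q′) (≡.sym Q≡)))) (^-order prim))
          reduce : ∀ a → val (monomialᵘ ω a U.^ Q′) ≈ (z ^ (e a % g)) ^ Q′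
          reduce i = trans (val-^ (monomialᵘ ω i) Q′) (trans (^-congˡ Q′ (proj₂ (power i)))
            (trans (^-congˡ Q′ (trans (reflexive (≡.cong (z ^_) (≡.trans (m≡m%n+[m/n]*n (e i) g)
                (≡.cong (e i % g ℕ.+_) (ℕ.*-comm (e i / g) g)))))
                    (trans (^-homo-* z (e i % g) (g ℕ.* (e i / g)))
                (*-congˡ (sym (^-assocʳ z g (e i / g)))))))
              (trans (^-distrib-* (z ^ (e i % g)) ((z ^ g) ^ (e i / g)) Q′)
                (trans (*-congˡ (root-^ {z ^ g} {Q′} z^g^Q′ (e i / g))) (*-identityʳ _)))))
          same-power : val (monomialᵘ ω i U.^ Q′) ≈ val (monomialᵘ ω c U.^ Q′)
          same-power = trans (reduce i) (trans (reflexive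
              (≡.cong (λ k → (z ^ k) ^ Q′) (proj₂ i~c))) (sym (reduce c)))

      exponent : ∀ K → (∀ {i c} → i ∈ 𝒩 → c ∈ 𝒩 → distance² i c ≤ K) → ∀ k → n ∸ r ≡ k →
          (k ≢ 0 → r < n) →
        ∃[ m ] 0 < m × m ℕ.^ 2 ≤ K ℕ.^ (2 ℕ.* k) ℕ.* k ℕ.^ k × InTorus E
            (λ i → ω i U.^ (m ℕ.* primorial N))
      exponent K distance≤K k n∸r≡k r<n = m , 0<m ,
        exponent-bound K s k (≡.subst (s ≤_) n∸r≡k (independent-kernel-bound E μ rank μ-rank E⊥μ))
            degenerate 0<m
          (proj₁ (proj₂ (proj₂ cleared))) , in-torus
        where
        dot≤K : ∀ l → dot (μ l) (μ l) ℤ.≤ pos K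
        dot≤K l = ≡.subst (λ x → dot x x ℤ.≤ pos K) (≡.sym x≡)
            (≡.subst (ℤ._≤ pos K) (≡.sym (dot-difference-self i c)) (ℤ.+≤+ (distance≤K i∈ c∈)))
          where open Difference (fromD (μ∈D l))
        abstract
          cleared : ∃[ δ ] δ ≢ 0ℤ × abs δ ℕ.^ 2 ≤ K ℕ.^ s ×
            (∀ x → InRationalSpan μ x → ∃[ d ] (∀ i → δ ℤ.* x i ≡ comb d μ i))
          cleared = common-denominator μ μ-rank K dot≤K
        δ = proj₁ cleared
        m = abs δ
        P = primorial N
        0<m : 0 < m
        0<m = ℕ.n≢0⇒n>0 λ eq → proj₁ (proj₂ cleared) (ℤ.∣i∣≡0⇒i≡0 eq)
        -- An empty `μ` spans only 0, whereas for `k ≢ 0` the kernel of `E` has a nonzero vector,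
        -- which would lie in that span.
        degenerate : K ≡ 0 → s ≡ 0 → k ≡ 0
        degenerate _ s≡0 = decidable-stable (k ℕ.≟ 0) λ k≢0 →
          let (x , Ex≡0 , j , xj≢0) = ∃-kernel (r<n k≢0) E
              (b , b≢0 , c , bx≡) = kernel-in-span x Ex≡0
          in *-≢0 b≢0 xj≢0 (≡.trans (bx≡ j) (empty-sum s≡0 (λ l → c l ℤ.* μ l j)))
          where
          empty-sum : ∀ {s} → s ≡ 0 → (f : Fin s → ℤ) → IntegerLattices.sum f ≡ 0ℤ
          empty-sum ≡.refl f = ≡.refl
        annihilates : ∀ x → (∀ j → dot (E j) x ≡ 0ℤ) → U.character (λ i → ω i U.^ (m ℕ.* P)) x U.≈
            U.ε
        annihilates x Ex≡0 = U.trans (U.sym (character-^ ω x (m ℕ.* P)))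
          (U.trans (U.sym (U.^-* (U.character ω x) m P)) (^ᵘ-multiple {Q = Q′} {P} Q′∣
            (from-abs δ (U.trans (U.^-cong Q′ (U.trans (U.sym (U.character-* ω δ x))
                (U.character-congʳ ω δx≡))) comb-trivial))))
          where
          d = proj₁ (proj₂ (proj₂ (proj₂ cleared)) x (kernel-in-span x Ex≡0))
          δx≡ : ∀ i → δ ℤ.* x i ≡ comb d μ i
          δx≡ = proj₂ (proj₂ (proj₂ (proj₂ cleared)) x (kernel-in-span x Ex≡0))
          comb-trivial : U.character ω (comb d μ) U.^ Q′ U.≈ U.ε
          comb-trivial = U.trans (U.^-cong Q′ (U.character-comb ω d μ))
              (U.trans (∏-^ (λ l → U.character ω (μ l) U.^ᶻ d l) Q′)
            (U.∏-ε {f = λ l → (U.character ω (μ l) U.^ᶻ d l) U.^ Q′} λ l → U.trans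
                (^ᶻ-^ (U.character ω (μ l)) (d l) Q′)
              (U.trans (U.^ᶻ-cong (d l) (character-μ l)) (U.ε^ᶻ (d l)))))
          from-abs : ∀ a → (U.character ω x U.^ᶻ a) U.^ Q′ U.≈ U.ε → (U.character ω x U.^ abs a)
              U.^ Q′ U.≈ U.ε
          from-abs (pos a)  h = h
          from-abs -[1+ a ] h = U.trans (U.sym (⁻¹-involutive _))
              (U.trans (U.⁻¹-cong (U.trans (U.sym (⁻¹-^ _ Q′)) h)) ε⁻¹≈ε)
            where open import Algebra.Properties.AbelianGroup U using (⁻¹-involutive; ε⁻¹≈ε)
        torsion : ∀ i → (ω i U.^ (m ℕ.* P)) U.^ Q U.≈ U.ε
        torsion i = U.trans (U.^-* (ω i) (m ℕ.* P) Q)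
          (^ᵘ-multiple {ω i} {Q} (divides (m ℕ.* P) ≡.refl) (ω^Q≈ε i))
        in-torus : InTorus E (λ i → ω i U.^ (m ℕ.* P))
        -- `duality` yields the membership only under double negation; it is removed because
        -- membership of torsion points is decidable.
        in-torus = decidable-stable (inTorus? E rank {Q} (λ i → ω i U.^ (m ℕ.* P)) 0<Q torsion)
          (duality r E {Q} (λ i → ω i U.^ (m ℕ.* P)) 0<Q torsion annihilates)

-- The complex numbers: inverses, locality and stable equality.

module ComplexNumbers where

  open import Algebra.Bundles using (CommutativeRing)
  open import Data.Integer.Base as ℤ using (ℤ; 1ℤ) renaming (+_ to pos)
  import Data.Integer.Properties as ℤ
  open import Data.Nat.Base as ℕ using (ℕ; zero; suc; z≤n; s≤s)
  import Data.Nat.Coprimality as Coprimality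
  import Data.Nat.Properties as ℕ
  open import Data.Product.Base using (_×_; _,_; ∃-syntax; proj₁; proj₂)
  open import Data.Rational.Base as ℚ
    using (ℚ; mkℚ; 0ℚ; 1ℚ; ½; _+_; _*_; _-_; -_; _<_; _≤_; ∣_∣; ↥_; ↧_; ↧ₙ_)
  import Data.Rational.Properties as ℚ
  open import Data.Rational.Solver using (module +-*-Solver)
  import Data.Rational.Unnormalised.Base as ℚᵘ
  import Data.Rational.Unnormalised.Properties as ℚᵘ
  open import Data.Sum.Base using (_⊎_; inj₁; inj₂)
  open import Function.Base using (_∘_; id)
  open import Relation.Binary.PropositionalEquality
  open import Relation.Nullary using (¬_; yes; no; contradiction)
  open VanishingSums using (StableDomain; module RingSums; module MannTheorem; module RootsOfUnity)

  open ℝ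
  open _≈ᴿ_
  open +-*-Solver using (solve; _:+_; _:*_; _:-_; :-_; _:=_; con)

  fromℤ : ℤ → ℚ
  fromℤ z = mkℚ z 0 (Coprimality.sym (Coprimality.1-coprimeTo ℤ.∣ z ∣))

  fromℤ-+ : ∀ a b → fromℤ (a ℤ.+ b) ≡ fromℤ a + fromℤ b
  fromℤ-+ a b = ℚ.toℚᵘ-injective (ℚᵘ.≃-trans (ℚᵘ.*≡* eq)
    (ℚᵘ.≃-sym (ℚ.toℚᵘ-homo-+ (fromℤ a) (fromℤ b))))
    where
    eq : (a ℤ.+ b) ℤ.* pos 1 ≡ (a ℤ.* pos 1 ℤ.+ b ℤ.* pos 1) ℤ.* pos 1
    eq = cong (ℤ._* pos 1) (cong₂ ℤ._+_ (sym (ℤ.*-identityʳ a)) (sym (ℤ.*-identityʳ b)))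

  fromℤ-↥ : ∀ a → fromℤ (↧ a) * a ≡ fromℤ (↥ a)
  fromℤ-↥ a@record{} = ℚ.toℚᵘ-injective (ℚᵘ.≃-trans (ℚ.toℚᵘ-homo-* (fromℤ (↧ a)) a) (ℚᵘ.*≡* eq))
    where
    eq : ↧ a ℤ.* ↥ a ℤ.* pos 1 ≡ ↥ a ℤ.* pos (1 ℕ.* ↧ₙ a)
    eq = trans (ℤ.*-identityʳ _) (trans (ℤ.*-comm (↧ a) (↥ a))
      (cong (λ n → ↥ a ℤ.* pos n) (sym (ℕ.*-identityˡ (↧ₙ a)))))

  fromℤ-mono-≤ : ∀ {a b} → a ℤ.≤ b → fromℤ a ≤ fromℤ b
  fromℤ-mono-≤ a≤b = ℚ.*≤* (ℤ.*-monoʳ-≤-nonNeg (pos 1) a≤b)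

  nat : ℕ → ℚ
  nat n = fromℤ (pos n)

  nat-suc : ∀ n → nat (suc n) ≡ 1ℚ + nat n
  nat-suc n = fromℤ-+ 1ℤ (pos n)

  0≤nat : ∀ n → 0ℚ ≤ nat n
  0≤nat n = fromℤ-mono-≤ (ℤ.+≤+ z≤n)

  nat-mono-≤ : ∀ {m n} → m ℕ.≤ n → nat m ≤ nat n
  nat-mono-≤ m≤n = fromℤ-mono-≤ (ℤ.+≤+ m≤n)

  -- The denominator of `ε` works: it turns `ε` into its numerator, a positive integer.
  archimedean : ∀ {ε} → 0ℚ < ε → ∃[ d ] 1ℚ ≤ nat d * ε
  archimedean {ε@record{}} 0<ε = ↧ₙ ε , subst (1ℚ ≤_) (sym (fromℤ-↥ ε))
    (fromℤ-mono-≤ (ℤ.i<j⇒suc[i]≤j (ℤ.positive⁻¹ (↥ ε) {{ℚ.positive 0<ε}})))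

  <⇒≱ : ∀ {a b} → a < b → ¬ b ≤ a
  <⇒≱ a<b b≤a = ℚ.<-irrefl refl (ℚ.<-≤-trans a<b b≤a)

  +-cancelʳ-< : ∀ c {a b} → a + c < b + c → a < b
  +-cancelʳ-< c {a} {b} h = subst₂ _<_ (cancel a c) (cancel b c) (ℚ.+-monoˡ-< (- c) h)
    where
    cancel : ∀ a c → a + c + - c ≡ a
    cancel = solve 2 (λ a c → a :+ c :+ (:- c) := a) refl

  *-monoˡ : ∀ {a b c} → 0ℚ ≤ c → a ≤ b → c * a ≤ c * b
  *-monoˡ {c = c} 0≤c = ℚ.*-monoˡ-≤-nonNeg c {{ℚ.nonNegative 0≤c}}

  *-monoʳ : ∀ {a b c} → 0ℚ ≤ c → a ≤ b → a * c ≤ b * c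
  *-monoʳ {c = c} 0≤c = ℚ.*-monoʳ-≤-nonNeg c {{ℚ.nonNegative 0≤c}}

  *-nonNeg : ∀ {a b} → 0ℚ ≤ a → 0ℚ ≤ b → 0ℚ ≤ a * b
  *-nonNeg {a} {b} 0≤a 0≤b = subst (_≤ a * b) (ℚ.*-zeroʳ a) (*-monoˡ 0≤a 0≤b)

  *-pos : ∀ {a b} → 0ℚ < a → 0ℚ < b → 0ℚ < a * b
  *-pos {a} {b} 0<a 0<b = subst (_< a * b) (ℚ.*-zeroʳ a) (ℚ.*-monoʳ-<-pos a {{ℚ.positive 0<a}} 0<b)

  *-mono : ∀ {a b c d} → 0ℚ ≤ a → 0ℚ ≤ d → a ≤ b → c ≤ d → a * c ≤ b * d
  *-mono 0≤a 0≤d a≤b c≤d = ℚ.≤-trans (*-monoˡ 0≤a c≤d) (*-monoʳ 0≤d a≤b)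

  *-cancelˡ-≤ : ∀ {a b c} → 0ℚ < c → c * a ≤ c * b → a ≤ b
  *-cancelˡ-≤ {c = c} 0<c = ℚ.*-cancelˡ-≤-pos c {{ℚ.positive 0<c}}

  square-≥0 : ∀ a → 0ℚ ≤ a * a
  square-≥0 a with ℚ.≤-total 0ℚ a
  ... | inj₁ 0≤a = *-nonNeg 0≤a 0≤a
  ... | inj₂ a≤0 = subst (0ℚ ≤_) (solve 1 (λ a → (:- a) :* (:- a) := a :* a) refl a)
    (*-nonNeg (ℚ.neg-antimono-≤ a≤0) (ℚ.neg-antimono-≤ a≤0))

  ≤⇒0≤- : ∀ {a b} → a ≤ b → 0ℚ ≤ b - a
  ≤⇒0≤- {a} {b} a≤b = subst (_≤ b - a) (ℚ.+-inverseʳ a) (ℚ.+-monoˡ-≤ (- a) a≤b)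

  0≤-⇒≤ : ∀ {a b} → 0ℚ ≤ b - a → a ≤ b
  0≤-⇒≤ {a} {b} h = subst₂ _≤_ (ℚ.+-identityˡ a)
    (solve 2 (λ a b → b :- a :+ a := b) refl a b) (ℚ.+-monoˡ-≤ a h)

  <⇒0<- : ∀ {a b} → a < b → 0ℚ < b - a
  <⇒0<- {a} {b} a<b = subst (_< b - a) (ℚ.+-inverseʳ a) (ℚ.+-monoˡ-< (- a) a<b)

  a≤∣a∣ : ∀ a → a ≤ ∣ a ∣
  a≤∣a∣ a with ℚ.≤-total 0ℚ a
  ... | inj₁ 0≤a = ℚ.≤-reflexive (sym (ℚ.0≤p⇒∣p∣≡p 0≤a))
  ... | inj₂ a≤0 = ℚ.≤-trans a≤0 (ℚ.0≤∣p∣ a)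

  ∣∣-sym : ∀ a b → ∣ a - b ∣ ≡ ∣ b - a ∣
  ∣∣-sym a b = trans (sym (ℚ.∣-p∣≡∣p∣ (a - b))) (cong ∣_∣ (swap-difference a b))

  ∣∣<-intro : ∀ {a b} → a < b → - a < b → ∣ a ∣ < b
  ∣∣<-intro {a} a<b -a<b with ℚ.∣p∣≡p∨∣p∣≡-p a
  ... | inj₁ e = subst (_< _) (sym e) a<b
  ... | inj₂ e = subst (_< _) (sym e) -a<b

  ∣-∣<⇒<+ : ∀ {a b ε} → ∣ a - b ∣ < ε → a < b + ε
  ∣-∣<⇒<+ {a} {b} h = subst (_< b + _) (solve 2 (λ a b → b :+ (a :- b) := a) refl a b)
    (ℚ.+-monoʳ-< b (ℚ.≤-<-trans (a≤∣a∣ (a - b)) h))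

  0<½ : 0ℚ < ½
  0<½ = ℚ.positive⁻¹ ½

  0<½* : ∀ {ε} → 0ℚ < ε → 0ℚ < ½ * ε
  0<½* = *-pos 0<½

  ½*< : ∀ {ε} → 0ℚ < ε → ½ * ε < ε
  ½*< {ε} 0<ε = subst₂ _<_ (ℚ.+-identityʳ (½ * ε)) (half+half ε) (ℚ.+-monoʳ-< (½ * ε) (0<½* 0<ε))

  -- The reciprocal, with the junk value 0 at 0
  recip : ℚ → ℚ
  recip q with q ℚ.≟ 0ℚ
  ... | yes _  = 0ℚ
  ... | no q≢0 = ℚ.1/_ q {{ℚ.≢-nonZero q≢0}}

  *-recip : ∀ {q} → q ≢ 0ℚ → q * recip q ≡ 1ℚ
  *-recip {q} q≢0 with q ℚ.≟ 0ℚ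
  ... | yes q≡0 = contradiction q≡0 q≢0
  ... | no q≢0′ = ℚ.*-inverseʳ q {{ℚ.≢-nonZero q≢0′}}

  recip-bound : ∀ {c q} → 0ℚ < c → c ≤ ∣ q ∣ → ∣ recip q ∣ ≤ recip c
  recip-bound {c} {q} 0<c c≤∣q∣ = *-cancelˡ-≤ 0<c (subst (c * ∣ recip q ∣ ≤_) eq
    (*-monoʳ (ℚ.0≤∣p∣ (recip q)) c≤∣q∣))
    where
    q≢0 : q ≢ 0ℚ
    q≢0 refl = <⇒≱ 0<c c≤∣q∣
    eq : ∣ q ∣ * ∣ recip q ∣ ≡ c * recip c
    eq = trans (sym (ℚ.∣p*q∣≡∣p∣*∣q∣ q (recip q))) (trans (cong ∣_∣ (*-recip q≢0))
      (sym (*-recip λ e → ℚ.<⇒≢ 0<c (sym e))))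

  module _ {I : Set} {stage : I → ℕ} where

    vanishes-eventually : ∀ {f g : I → ℚ} N → (∀ i → N ℕ.≤ stage i → f i ≡ g i) →
                          Vanishes stage f → Vanishes stage g
    vanishes-eventually N f≡g vf ε 0<ε with M , small ← vf ε 0<ε =
      M ℕ.⊔ N , λ i b≤i → subst (λ q → ∣ q ∣ < ε) (f≡g i (ℕ.m⊔n≤o⇒n≤o M N b≤i))
        (small i (ℕ.m⊔n≤o⇒m≤o M N b≤i))

    vanishes-dominated : ∀ {f g : I → ℚ} N → (∀ i → N ℕ.≤ stage i → ∣ f i ∣ ≤ ∣ g i ∣) →
                         Vanishes stage g → Vanishes stage f
    vanishes-dominated N f≤g vg ε 0<ε with M , small ← vg ε 0<ε =
      M ℕ.⊔ N , λ i b≤i → ℚ.≤-<-trans (f≤g i (ℕ.m⊔n≤o⇒n≤o M N b≤i))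
        (small i (ℕ.m⊔n≤o⇒m≤o M N b≤i))

  -- The positive form of being nonzero, and precisely what the construction of a reciprocal
  -- consumes.
  BoundedBelow : ℝ → Set
  BoundedBelow x = ∃[ c ] 0ℚ < c × ∃[ N ] (∀ n → N ℕ.≤ n → c ≤ ∣ seq x n ∣)

  module _ (x : ℝ) (bb : BoundedBelow x) where

    private
      c = proj₁ bb
      0<c = proj₁ (proj₂ bb)
      N = proj₁ (proj₂ (proj₂ bb))
      c≤ = proj₂ (proj₂ (proj₂ bb))

      x≢0 : ∀ n → N ℕ.≤ n → seq x n ≢ 0ℚ
      x≢0 n N≤n e = <⇒≱ 0<c (subst (λ q → c ≤ ∣ q ∣) e (c≤ n N≤n))

      0<B : 0ℚ < recip c + 1ℚ
      0<B = subst (_< recip c + 1ℚ) (ℚ.+-identityˡ 0ℚ)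
        (ℚ.+-mono-≤-< (ℚ.≤-trans (ℚ.0≤∣p∣ (recip c)) (recip-bound 0<c (a≤∣a∣ c))) (ℚ.positive⁻¹ 1ℚ))

      recip-bounded : EventuallyBounded id (recip ∘ seq x)
      recip-bounded = recip c + 1ℚ , 0<B , N , λ n N≤n → ℚ.≤-<-trans (recip-bound 0<c (c≤ n N≤n))
        (subst (_< recip c + 1ℚ) (ℚ.+-identityʳ (recip c))
            (ℚ.+-monoʳ-< (recip c) (ℚ.positive⁻¹ 1ℚ)))

    -- With `u = 1/a` and `v = 1/b`, the difference `u - v` is `u v (b - a)`, a product of two
    -- bounded factors and a vanishing one.
    cauchy-recip : Cauchy (recip ∘ seq x)
    cauchy-recip = vanishes-eventually N difference
      (vanishes-* (bounded-proj₁ recip-bounded)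
        (vanishes-* (bounded-proj₂ recip-bounded) (vanishes-neg (cauchy x))))
      where
      difference : ∀ (i : ℕ × ℕ) → N ℕ.≤ proj₁ i ℕ.⊓ proj₂ i →
        recip (seq x (proj₁ i)) * (recip (seq x (proj₂ i)) * -
            (seq x (proj₁ i) - seq x (proj₂ i))) ≡
        recip (seq x (proj₁ i)) - recip (seq x (proj₂ i))
      difference (m , n) N≤ = begin
        u * (v * - (a - b))           ≡⟨ solve 4 (λ u v a b → u :* (v :* (:- (a :- b))) :=
                                           (b :* v) :* u :- (a :* u) :* v) refl u v a b ⟩
        (b * v) * u - (a * u) * v     ≡⟨ cong₂ (λ p q → p * u - q * v)
                                           (*-recip (x≢0 n (ℕ.m≤n⊓o⇒m≤o m n N≤)))
                                           (*-recip (x≢0 m (ℕ.m≤n⊓o⇒m≤n m n N≤))) ⟩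
        1ℚ * u - 1ℚ * v               ≡⟨ cong₂ _-_ (ℚ.*-identityˡ u) (ℚ.*-identityˡ v) ⟩
        u - v                         ∎
        where
        open ≡-Reasoning
        a = seq x m
        b = seq x n
        u = recip a
        v = recip b

    recipᴿ : ℝ
    recipᴿ = mkℝ (recip ∘ seq x) cauchy-recip

    *-recipᴿ : x *ᴿ recipᴿ ≈ᴿ fromℚᴿ 1ℚ
    *-recipᴿ = mk≈ (vanishes-eventually N
      (λ n N≤n → sym (trans (cong (_- 1ℚ) (*-recip (x≢0 n N≤n))) (ℚ.+-inverseʳ 1ℚ))) vanishes-0)

  -- The constructive substitute for comparing a real with a rational: an approximation good to half
  -- the gap is compared with the midpoint of `a` and `b`. The two alternatives overlap.
  locate : ∀ x {a b} → a < b → (∃[ N ] (∀ n → N ℕ.≤ n → a ≤ seq x n)) ⊎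
      (∃[ N ] (∀ n → N ℕ.≤ n → seq x n ≤ b))
  locate x {a} {b} a<b with N , near ← cauchy x (½ * (b - a)) (0<½* (<⇒0<- a<b))
    with ℚ.≤-total (a + ½ * (b - a)) (seq x N)
  ... | inj₁ m≤x = inj₁ (N , λ n N≤n → ℚ.<⇒≤ (+-cancelʳ-< (½ * (b - a)) (ℚ.≤-<-trans m≤x
          (∣-∣<⇒<+ (near (N , n) (ℕ.⊓-glb ℕ.≤-refl N≤n))))))
  ... | inj₂ x≤m = inj₂ (N , λ n N≤n → ℚ.<⇒≤ (ℚ.<-≤-trans
          (∣-∣<⇒<+ (near (n , N) (ℕ.⊓-glb N≤n ℕ.≤-refl)))
          (subst (seq x N + ½ * (b - a) ≤_) (trans (ℚ.+-assoc a _ _)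
              (trans (cong (a +_) (half+half (b - a)))
            (solve 2 (λ a b → a :+ (b :- a) := b) refl a b))) (ℚ.+-monoˡ-≤ (½ * (b - a)) x≤m))))

  module ℝ-ring = CommutativeRing ℝ-commutativeRing
  open AdjoinI ℝ-commutativeRing using (_+i_; re; im; _≈ᵢ_) renaming (_,_ to _,ᵢ_)
  open _≈ᵢ_

  Inv : ℂ → Set
  Inv z = ∃[ y ] z ℂ.* y ℂ.≈ ℂ.1#

  -- The inverse is the conjugate of `z` divided by the squared modulus.
  conjugate-inverse : ∀ z → BoundedBelow (re z *ᴿ re z +ᴿ im z *ᴿ im z) → Inv z
  conjugate-inverse z bb = (re z *ᴿ t) +i (-ᴿ (im z *ᴿ t)) , (real ,ᵢ imaginary)
    where
    norm t : ℝ
    norm = re z *ᴿ re z +ᴿ im z *ᴿ im z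
    t = recipᴿ norm bb
    a b r : ℕ → ℚ
    a = seq (re z)
    b = seq (im z)
    r = seq t
    real : re z *ᴿ (re z *ᴿ t) +ᴿ -ᴿ (im z *ᴿ (-ᴿ (im z *ᴿ t))) ≈ᴿ fromℚᴿ 1ℚ
    real = ℝ-ring.trans (pointwise λ n → solve 3 (λ a b r →
        a :* (a :* r) :+ (:- (b :* (:- (b :* r)))) := (a :* a :+ b :* b) :* r) refl (a n) (b n)
            (r n))
      (*-recipᴿ norm bb)
    imaginary : re z *ᴿ (-ᴿ (im z *ᴿ t)) +ᴿ im z *ᴿ (re z *ᴿ t) ≈ᴿ fromℚᴿ 0ℚ
    imaginary = pointwise λ n → solve 3 (λ a b r →
        a :* (:- (b :* r)) :+ b :* (a :* r) := con 0ℚ) refl (a n) (b n) (r n)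

  ∣a∣²≡a² : ∀ a → ∣ a ∣ * ∣ a ∣ ≡ a * a
  ∣a∣²≡a² a with ℚ.∣p∣≡p∨∣p∣≡-p a
  ... | inj₁ e = cong₂ _*_ e e
  ... | inj₂ e = trans (cong₂ _*_ e e) (solve 1 (λ a → (:- a) :* (:- a) := a :* a) refl a)

  square-bound : ∀ {c a} b → 0ℚ < c → c ≤ ∣ a ∣ → c * c ≤ a * a + b * b
  square-bound {c} {a} b 0<c c≤ = ℚ.≤-trans
    (ℚ.≤-trans (*-mono (ℚ.<⇒≤ 0<c) (ℚ.0≤∣p∣ a) c≤ c≤) (ℚ.≤-reflexive (∣a∣²≡a² a)))
    (subst (_≤ a * a + b * b) (ℚ.+-identityʳ (a * a)) (ℚ.+-monoʳ-≤ (a * a) (square-≥0 b)))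

  re-inverse : ∀ z → BoundedBelow (re z) → Inv z
  re-inverse z (c , 0<c , N , c≤) = conjugate-inverse z
    (c * c , *-pos 0<c 0<c , N , λ n N≤n → ℚ.≤-trans (square-bound (seq (im z) n) 0<c (c≤ n N≤n))
        (a≤∣a∣ _))

  im-inverse : ∀ z → BoundedBelow (im z) → Inv z
  im-inverse z (c , 0<c , N , c≤) = conjugate-inverse z
    (c * c , *-pos 0<c 0<c , N , λ n N≤n → ℚ.≤-trans (square-bound (seq (re z) n) 0<c (c≤ n N≤n))
      (subst (_≤ ∣ seq (re z) n * seq (re z) n + seq (im z) n * seq (im z) n ∣)
        (ℚ.+-comm (seq (re z) n * seq (re z) n) (seq (im z) n * seq (im z) n)) (a≤∣a∣ _)))

  null-or-bounded : ∀ x {ε} → 0ℚ < ε →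
    (∃[ N ] (∀ n → N ℕ.≤ n → ∣ seq x n ∣ < ε)) ⊎ BoundedBelow x
  null-or-bounded x {ε} 0<ε = cases (locate x δ<) (locate (-ᴿ x) δ<)
    where
    η δ : ℚ
    η = ½ * ε
    δ = ½ * η
    0<δ : 0ℚ < δ
    0<δ = 0<½* (0<½* 0<ε)
    δ< : δ < η
    δ< = ½*< (0<½* 0<ε)
    Above Below : ℝ → Set
    Above y = ∃[ N ] (∀ n → N ℕ.≤ n → δ ≤ seq y n)
    Below y = ∃[ N ] (∀ n → N ℕ.≤ n → seq y n ≤ η)
    cases : Above x ⊎ Below x → Above (-ᴿ x) ⊎ Below (-ᴿ x) →
            (∃[ N ] (∀ n → N ℕ.≤ n → ∣ seq x n ∣ < ε)) ⊎ BoundedBelow x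
    cases (inj₁ (N , above)) _ = inj₂ (δ , 0<δ , N , λ n N≤n →
      ℚ.≤-trans (above n N≤n) (a≤∣a∣ (seq x n)))
    cases (inj₂ _) (inj₁ (N , above)) = inj₂ (δ , 0<δ , N , λ n N≤n →
      ℚ.≤-trans (above n N≤n) (subst (- seq x n ≤_) (ℚ.∣-p∣≡∣p∣ (seq x n)) (a≤∣a∣ (- seq x n))))
    cases (inj₂ (M , below)) (inj₂ (N , below′)) = inj₁ (M ℕ.⊔ N , λ n b≤n → ∣∣<-intro
      (ℚ.≤-<-trans (below n (ℕ.m⊔n≤o⇒m≤o M N b≤n)) (½*< 0<ε))
      (ℚ.≤-<-trans (below′ n (ℕ.m⊔n≤o⇒n≤o M N b≤n)) (½*< 0<ε)))

  -- For each `ε` the sequence is either eventually below `ε` or bounded away from 0, and the second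
  -- case is excluded; no single decision covers all `ε`.
  null : ∀ {x} → ¬ BoundedBelow x → x ≈ᴿ fromℚᴿ 0ℚ
  null {x} ¬bb = mk≈ λ ε 0<ε → go ε (null-or-bounded x 0<ε)
    where
    go : ∀ ε → (∃[ N ] (∀ n → N ℕ.≤ n → ∣ seq x n ∣ < ε)) ⊎ BoundedBelow x →
         ∃[ N ] (∀ n → N ℕ.≤ n → ∣ seq x n - 0ℚ ∣ < ε)
    go ε (inj₁ (N , h)) = N , λ n N≤n → subst (λ q → ∣ q ∣ < ε) (sym (ℚ.+-identityʳ (seq x n)))
        (h n N≤n)
    go ε (inj₂ bb)        = contradiction bb ¬bb

  ¬null : ∀ {x} → BoundedBelow x → ¬ x ≈ᴿ fromℚᴿ 0ℚ
  ¬null {x} (c , 0<c , N , c≤) (mk≈ v) with M , small ← v c 0<c =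
    <⇒≱ (small (M ℕ.⊔ N) (ℕ.m≤m⊔n M N))
      (subst (λ q → c ≤ ∣ q ∣) (sym (ℚ.+-identityʳ _)) (c≤ (M ℕ.⊔ N) (ℕ.m≤n⊔m M N)))

  -- If `z` has no inverse, neither its real nor its imaginary part is bounded away from 0, so both
  -- are null. Stability of equality and cancellation follow from this.
  tight : ∀ {z} → ¬ Inv z → z ℂ.≈ ℂ.0#
  tight {z} ¬inv = null (¬inv ∘ re-inverse z) ,ᵢ null (¬inv ∘ im-inverse z)

  -- The real parts add up to 1: either that of `z` is eventually at least 1/4, or it is at most 1/2
  -- and then, with an error below 1/4 in the sum, that of `w` is at least 1/4.
  local : ∀ {z w} → z ℂ.+ w ℂ.≈ ℂ.1# → Inv z ⊎ Inv w
  local {z} {w} (mk≈ sum≈1 ,ᵢ _)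
    with locate (re z) {½ * ½} {½} (½*< 0<½) | sum≈1 (½ * ½) (0<½* 0<½)
  ... | inj₁ (N , above) | _ = inj₁ (re-inverse z (½ * ½ , 0<½* 0<½ , N , λ n N≤n →
          ℚ.≤-trans (above n N≤n) (a≤∣a∣ _)))
  ... | inj₂ (N , below) | M , near = inj₂ (re-inverse w (½ * ½ , 0<½* 0<½ , M ℕ.⊔ N , λ n b≤n →
          ℚ.≤-trans (bound (seq (re z) n) (seq (re w) n) (below n (ℕ.m⊔n≤o⇒n≤o M N b≤n))
            (near n (ℕ.m⊔n≤o⇒m≤o M N b≤n))) (a≤∣a∣ _)))
    where
    bound : ∀ a b → a ≤ ½ → ∣ (a + b) - 1ℚ ∣ < ½ * ½ → ½ * ½ ≤ b
    bound a b a≤½ h = 0≤-⇒≤ (subst (0ℚ ≤_) eq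
      (ℚ.+-mono-≤ (≤⇒0≤- a≤½) (≤⇒0≤- (ℚ.<⇒≤ (ℚ.≤-<-trans (a≤∣a∣ (1ℚ - (a + b)))
        (subst (_< ½ * ½) (∣∣-sym (a + b) 1ℚ) h))))))
      where
      eq : (½ - a) + (½ * ½ - (1ℚ - (a + b))) ≡ b - ½ * ½
      eq = solve 2 (λ a b → (con ½ :- a) :+ (con (½ * ½) :- (con 1ℚ :- (a :+ b))) := b :- con
          (½ * ½)) refl a b

  fromℚ-≉0 : ∀ {q} → q ≢ 0ℚ → ¬ fromℚ q ℂ.≈ ℂ.0#
  fromℚ-≉0 {q} q≢0 (e ,ᵢ _) = ¬null (∣ q ∣ , 0<∣q∣ , 0 , λ _ _ → ℚ.≤-refl) e
    where
    0<∣q∣ : 0ℚ < ∣ q ∣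
    0<∣q∣ = ℚ.≰⇒> λ ∣q∣≤0 → q≢0 (ℚ.∣p∣≡0⇒p≡0 q (ℚ.≤-antisym ∣q∣≤0 (ℚ.0≤∣p∣ q)))

  fromℚ-+ : ∀ p q → fromℚ (p + q) ℂ.≈ fromℚ p ℂ.+ fromℚ q
  fromℚ-+ p q = pointwise (λ _ → refl) ,ᵢ pointwise (λ _ → refl)

  fromℚ-* : ∀ p q → fromℚ (p * q) ℂ.≈ fromℚ p ℂ.* fromℚ q
  fromℚ-* p q = pointwise (λ _ → solve 2 (λ p q → p :* q := p :* q :+ (:- (con 0ℚ :* con 0ℚ)))
      refl p q) ,ᵢ
                pointwise (λ _ → solve 2 (λ p q → con 0ℚ := p :* con 0ℚ :+ con 0ℚ :* q) refl p q)

  open RingSums ℂ-commutativeRing using (_·_; ·-as-*; module ℤMod)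

  fromℚ-fromℤ : ∀ a → fromℚ (fromℤ a) ℂ.≈ a · ℂ.1#
  fromℚ-fromℤ = ℤMod.hom-unique (λ a → fromℚ (fromℤ a)) λ a b →
    ℂ.trans (ℂ.reflexive (cong fromℚ (fromℤ-+ a b))) (fromℚ-+ (fromℤ a) (fromℤ b))

  clear-denominator : ∀ a → (↧ a) · fromℚ a ℂ.≈ (↥ a) · ℂ.1#
  clear-denominator a = begin
    (↧ a) · fromℚ a                    ≈⟨ ·-as-* (↧ a) (fromℚ a) ⟩
    ((↧ a) · ℂ.1#) ℂ.* fromℚ a         ≈⟨ ℂ.*-congʳ (fromℚ-fromℤ (↧ a)) ⟨
    fromℚ (fromℤ (↧ a)) ℂ.* fromℚ a    ≈⟨ fromℚ-* (fromℤ (↧ a)) a ⟨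
    fromℚ (fromℤ (↧ a) * a)            ≡⟨ cong fromℚ (fromℤ-↥ a) ⟩
    fromℚ (fromℤ (↥ a))                ≈⟨ fromℚ-fromℤ (↥ a) ⟩
    (↥ a) · ℂ.1#                       ∎
    where open import Relation.Binary.Reasoning.Setoid ℂ.setoid

  ℂ-stableDomain : StableDomain ℂ-commutativeRing
  ℂ-stableDomain = record
    { stable = λ {x} {y} ¬¬x≈y → x-y≈0⇒x≈y x y (tight λ inv → ¬¬x≈y λ x≈y →
        inv⇒≉0 inv (ℂ.trans (ℂ.+-congʳ x≈y) (ℂ.-‿inverseʳ y)))
    ; cancel = λ {x} {y} xy≈0 x≉0 → tight λ (y′ , yy′≈1) → x≉0 (begin
        x                   ≈⟨ ℂ.*-identityʳ x ⟨
        x ℂ.* ℂ.1#          ≈⟨ ℂ.*-congˡ yy′≈1 ⟨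
        x ℂ.* (y ℂ.* y′)    ≈⟨ ℂ.*-assoc x y y′ ⟨
        x ℂ.* y ℂ.* y′      ≈⟨ ℂ.*-congʳ xy≈0 ⟩
        ℂ.0# ℂ.* y′         ≈⟨ ℂ.zeroˡ y′ ⟩
        ℂ.0#                ∎)
    ; char-0 = λ n e → fromℚ-≉0 {nat (suc n)} (λ ()) (ℂ.trans (fromℚ-fromℤ (pos (suc n))) e)
    }
    where
    open import Relation.Binary.Reasoning.Setoid ℂ.setoid
    inv⇒≉0 : ∀ {z} → Inv z → ¬ z ℂ.≈ ℂ.0#
    inv⇒≉0 {z} (y , zy≈1) z≈0 = fromℚ-≉0 {1ℚ} (λ ())
      (ℂ.trans (ℂ.sym zy≈1) (ℂ.trans (ℂ.*-congʳ z≈0) (ℂ.zeroˡ y)))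
    x-y≈0⇒x≈y : ∀ x y → x ℂ.+ (ℂ.- y) ℂ.≈ ℂ.0# → x ℂ.≈ y
    x-y≈0⇒x≈y x y e = begin
      x                          ≈⟨ ℂ.+-identityʳ x ⟨
      x ℂ.+ ℂ.0#                 ≈⟨ ℂ.+-congˡ (ℂ.-‿inverseˡ y) ⟨
      x ℂ.+ ((ℂ.- y) ℂ.+ y)      ≈⟨ ℂ.+-assoc x _ y ⟨
      x ℂ.+ (ℂ.- y) ℂ.+ y        ≈⟨ ℂ.+-congʳ e ⟩
      ℂ.0# ℂ.+ y                 ≈⟨ ℂ.+-identityˡ y ⟩
      y                          ∎

  -- Primitive roots of unity by bisection.

  open MannTheorem ℂ-commutativeRing ℂ-stableDomain
    using (_^_; Primitive)
  open RootsOfUnity ℂ-commutativeRing ℂ-stableDomain using (quotient-primitive; ∃-primitive-factor)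

  -- ρ j t + i ι j t = (1 + i t)ʲ
  ρ ι : ℕ → ℚ → ℚ
  ρ zero    t = 1ℚ
  ρ (suc j) t = ρ j t + - (t * ι j t)
  ι zero    t = 0ℚ
  ι (suc j) t = ι j t + t * ρ j t

  -- Each factor `1 + i t` multiplies the squared modulus by `1 + t²`.
  1≤ρ²+ι² : ∀ j t → 1ℚ ≤ ρ j t * ρ j t + ι j t * ι j t
  1≤ρ²+ι² zero    t = ℚ.≤-refl
  1≤ρ²+ι² (suc j) t = ℚ.≤-trans (1≤ρ²+ι² j t) (0≤-⇒≤ (subst (0ℚ ≤_)
    (solve 3 (λ t r i → (t :* t) :* (r :* r :+ i :* i) :=
      ((r :+ (:- (t :* i))) :* (r :+ (:- (t :* i))) :+ (i :+ t :* r) :* (i :+ t :* r)) :-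
      (r :* r :+ i :* i)) refl t (ρ j t) (ι j t))
    (*-nonNeg (square-≥0 t) (ℚ.≤-trans (ℚ.nonNegative⁻¹ 1ℚ) (1≤ρ²+ι² j t)))))

  -- For `t > 0`, `Good M t` says that `M arctan t < π`, expressed by the signs of rational
  -- polynomials; being rational, `t` is decidably good or bad.
  Good Bad : ℕ → ℚ → Set
  Good M t = ∀ j → j ℕ.< M → 0ℚ < ι (suc j) t
  Bad  M t = ∃[ j ] j ℕ.< M × ι (suc j) t ≤ 0ℚ

  good-or-bad : ∀ M t → Good M t ⊎ Bad M t
  good-or-bad M t with ℕ.anyUpTo? (λ j → ι (suc j) t ℚ.≤? 0ℚ) M
  ... | yes bad = inj₂ bad
  ... | no ¬bad = inj₁ λ j j<M → ℚ.≰⇒> λ ≤0 → ¬bad (j , j<M , ≤0)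

  1≤nat-suc : ∀ n → 1ℚ ≤ nat (suc n)
  1≤nat-suc n = nat-mono-≤ (s≤s (z≤n {n}))

  module _ {M t} (Mt≡1 : nat M * t ≡ 1ℚ) (0<t : 0ℚ < t) where

    private
      nt≤1 : ∀ {j} → j ℕ.≤ M → nat j * t ≤ 1ℚ
      nt≤1 j≤M = subst (_ ≤_) Mt≡1 (*-monoʳ (ℚ.<⇒≤ 0<t) (nat-mono-≤ j≤M))

      nt-suc : ∀ j → nat (suc j) * t ≡ nat j * t + t
      nt-suc j = trans (cong (_* t) (nat-suc j))
        (solve 2 (λ n t → (con 1ℚ :+ n) :* t := n :* t :+ t) refl (nat j) t)

      record Small (j : ℕ) : Set where
        field
          ι≥0 : 0ℚ ≤ ι j t
          ι≤  : ι j t ≤ nat j * t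
          ρ≤1 : ρ j t ≤ 1ℚ
          ρ≥  : 1ℚ ≤ ρ j t + nat j * t

      ρ≥0 : ∀ {j} → j ℕ.≤ M → Small j → 0ℚ ≤ ρ j t
      ρ≥0 {j} j≤M s = subst (0ℚ ≤_) (solve 2 (λ r n → (r :+ n) :- con 1ℚ :+ (con 1ℚ :- n) := r)
          refl (ρ j t) (nat j * t))
        (ℚ.+-mono-≤ (≤⇒0≤- (Small.ρ≥ s)) (≤⇒0≤- (nt≤1 j≤M)))

      small : ∀ j → j ℕ.≤ M → Small j
      small zero    _    = record
        { ι≥0 = ℚ.≤-refl ; ι≤ = ℚ.≤-reflexive (sym (ℚ.*-zeroˡ t)) ; ρ≤1 = ℚ.≤-refl
        ; ρ≥ = ℚ.≤-reflexive (cong (1ℚ +_) (sym (ℚ.*-zeroˡ t))) }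
      small (suc j) j<M = record
        { ι≥0 = ℚ.+-mono-≤ S.ι≥0 (*-nonNeg (ℚ.<⇒≤ 0<t) (ρ≥0 (ℕ.<⇒≤ j<M) s))
        ; ι≤  = subst (ι (suc j) t ≤_) (sym (nt-suc j)) (ℚ.+-mono-≤ S.ι≤
            (subst (t * ρ j t ≤_) (ℚ.*-identityʳ t) (*-monoˡ (ℚ.<⇒≤ 0<t) S.ρ≤1)))
        ; ρ≤1 = ℚ.≤-trans (0≤-⇒≤ (subst (0ℚ ≤_)
            (solve 3 (λ t r i → t :* i := r :- (r :+ (:- (t :* i)))) refl t (ρ j t) (ι j t))
            (*-nonNeg (ℚ.<⇒≤ 0<t) S.ι≥0))) S.ρ≤1
        ; ρ≥  = subst (1ℚ ≤_)
            (trans (solve 4 (λ t r i n → (r :+ n) :+ t :* (con 1ℚ :- i) := (r :+ (:- (t :* i))) :+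
                (n :+ t))
              refl t (ρ j t) (ι j t) (nat j * t)) (cong (ρ (suc j) t +_) (sym (nt-suc j))))
            (subst (_≤ (ρ j t + nat j * t) + t * (1ℚ - ι j t)) (ℚ.+-identityʳ 1ℚ)
              (ℚ.+-mono-≤ S.ρ≥ (*-nonNeg (ℚ.<⇒≤ 0<t)
                (≤⇒0≤- (ℚ.≤-trans S.ι≤ (nt≤1 (ℕ.<⇒≤ j<M)))))))
        }
        where
        s = small j (ℕ.<⇒≤ j<M)
        module S = Small s

    -- With `M t = 1` the real parts satisfy `ρ j t ≥ 1 - j t ≥ t` for `j < M`, so each factor
    -- raises the imaginary part by at least `t²`.
    good-start : Good M t
    good-start j j<M = ℚ.<-≤-trans (*-pos 0<t 0<ρ)
      (subst (_≤ ι (suc j) t) (ℚ.+-identityˡ (t * ρ j t)) (ℚ.+-monoˡ-≤ (t * ρ j t) (Small.ι≥0 s)))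
      where
      s = small j (ℕ.<⇒≤ j<M)
      0<ρ : 0ℚ < ρ j t
      0<ρ = ℚ.<-≤-trans 0<t (0≤-⇒≤ (subst (0ℚ ≤_)
        (trans (cong (λ q → (ρ j t + nat j * t - 1ℚ) + (1ℚ - q)) (nt-suc j))
          (solve 3 (λ r n t → ((r :+ n) :- con 1ℚ) :+ (con 1ℚ :- (n :+ t)) := r :- t) refl (ρ j t)
              (nat j * t) t))
        (ℚ.+-mono-≤ (≤⇒0≤- (Small.ρ≥ s)) (≤⇒0≤- (nt≤1 j<M)))))

  -- Write y and r for ι (suc j) a and ρ (suc j) a.  Then y ± a r are multiples
  -- of neighbouring values of ι, so a |r| ≤ y, while r² + y² ≥ 1.
  good-lower : ∀ {M a c} → Good M a → 0ℚ < c → c ≤ a → a ≤ 1ℚ →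
               ∀ j → suc j ℕ.< M → ½ * c ≤ ι (suc j) a
  good-lower {M} {a} {c} good 0<c c≤a a≤1 j j<M with ℚ.≤-total (½ * c) (ι (suc j) a)
  ... | inj₁ h = h
  ... | inj₂ h = contradiction chain (<⇒≱ (ℚ.<-≤-trans small c²≤a²))
    where
    y = ι (suc j) a
    r = ρ (suc j) a
    0≤c = ℚ.<⇒≤ 0<c
    0≤a = ℚ.≤-trans 0≤c c≤a
    0≤ι : ∀ j → j ℕ.≤ M → 0ℚ ≤ ι j a
    0≤ι zero    _   = ℚ.≤-refl
    0≤ι (suc j) j<M = ℚ.<⇒≤ (good j j<M)
    0≤y = 0≤ι (suc j) (ℕ.<⇒≤ j<M)
    up : 0ℚ ≤ y + a * r
    up = ℚ.<⇒≤ (good (suc j) j<M)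
    down : 0ℚ ≤ y - a * r
    down = subst (0ℚ ≤_) (solve 3 (λ a r i → i :+ (a :* a) :* i :=
        (i :+ a :* r) :- a :* (r :+ (:- (a :* i)))) refl a (ρ j a) (ι j a))
      (ℚ.+-mono-≤ (0≤ι j (ℕ.≤-trans (ℕ.n≤1+n j) (ℕ.<⇒≤ j<M)))
        (*-nonNeg (square-≥0 a) (0≤ι j (ℕ.≤-trans (ℕ.n≤1+n j) (ℕ.<⇒≤ j<M)))))
    c²≤a² : c * c ≤ a * a
    c²≤a² = *-mono 0≤c 0≤a c≤a c≤a
    a²≤1 : a * a ≤ 1ℚ
    a²≤1 = *-mono {a} {1ℚ} {a} {1ℚ} 0≤a (ℚ.nonNegative⁻¹ 1ℚ) a≤1 a≤1
    -- From `a² r² ≤ y²`, `a ≤ 1` and `r² + y² ≥ 1` one gets `a² ≤ a² (r² + y²) ≤ 2 y²`, which is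
    -- impossible when `y` is at most half of `c ≤ a`.
    chain : a * a ≤ y * y + y * y
    chain = ℚ.≤-trans (subst (_≤ (a * a) * (r * r + y * y)) (ℚ.*-identityʳ (a * a))
        (*-monoˡ (square-≥0 a) (1≤ρ²+ι² (suc j) a)))
      (0≤-⇒≤ (subst (0ℚ ≤_)
        (solve 3 (λ a r y → (y :- a :* r) :* (y :+ a :* r) :+ (con 1ℚ :- a :* a) :* (y :* y) :=
          (y :* y :+ y :* y) :- (a :* a) :* (r :* r :+ y :* y)) refl a r y)
        (ℚ.+-mono-≤ (*-nonNeg down up) (*-nonNeg (≤⇒0≤- a²≤1) (square-≥0 y)))))
    small : y * y + y * y < c * c
    small = ℚ.≤-<-trans (ℚ.+-mono-≤ y²≤ y²≤) (subst (_< c * c)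
        (solve 1 (λ c → con ½ :* (c :* c) := (con ½ :* c) :* (con ½ :* c) :+ (con ½ :* c) :*
            (con ½ :* c)) refl c)
        (½*< (*-pos 0<c 0<c)))
      where
      y²≤ : y * y ≤ (½ * c) * (½ * c)
      y²≤ = *-mono 0≤y (ℚ.<⇒≤ (0<½* 0<c)) h h

  record Bracket (M : ℕ) : Set where
    field
      lo hi : ℚ
      lo≤hi : lo ≤ hi
      good  : Good M lo
      bad   : Bad M hi

  open Bracket

  width : ∀ {M} → Bracket M → ℚ
  width B = hi B - lo B

  midpoint : ∀ a b → a ≤ b → a ≤ ½ * (a + b) × ½ * (a + b) ≤ b
  midpoint a b a≤b = 0≤-⇒≤ (subst (0ℚ ≤_)
      (solve 2 (λ a b → con ½ :* (b :- a) := con ½ :* (a :+ b) :- a) refl a b) h) ,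
    0≤-⇒≤ (subst (0ℚ ≤_)
      (solve 2 (λ a b → con ½ :* (b :- a) := b :- con ½ :* (a :+ b)) refl a b) h)
    where
    h : 0ℚ ≤ ½ * (b - a)
    h = *-nonNeg (ℚ.<⇒≤ 0<½) (≤⇒0≤- a≤b)

  record Halved {M} (B : Bracket M) : Set where
    field
      half  : Bracket M
      lo-↑  : lo B ≤ lo half
      hi-↓  : hi half ≤ hi B
      width-½ : width half ≡ ½ * width B

  halve : ∀ {M} (B : Bracket M) → Halved B
  halve {M} B = cases (good-or-bad M m)
    where
    m = ½ * (lo B + hi B)
    mid = midpoint (lo B) (hi B) (lo≤hi B)
    cases : Good M m ⊎ Bad M m → Halved B
    cases (inj₁ g) = record
      { half = record { lo = m ; hi = hi B ; lo≤hi = proj₂ mid ; good = g ; bad = bad B }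
      ; lo-↑ = proj₁ mid ; hi-↓ = ℚ.≤-refl
      ; width-½ = solve 2 (λ a b → b :- con ½ :* (a :+ b) := con ½ :* (b :- a)) refl (lo B) (hi B) }
    cases (inj₂ b) = record
      { half = record { lo = lo B ; hi = m ; lo≤hi = proj₁ mid ; good = good B ; bad = b }
      ; lo-↑ = ℚ.≤-refl ; hi-↓ = proj₂ mid
      ; width-½ = solve 2 (λ a b → con ½ :* (a :+ b) :- a := con ½ :* (b :- a)) refl (lo B) (hi B) }

  module Bisection {M} (B₀ : Bracket M) (width₀≤1 : width B₀ ≤ 1ℚ) where

    bracket : ℕ → Bracket M
    bracket zero    = B₀
    bracket (suc n) = Halved.half (halve (bracket n))

    lower upper : ℕ → ℚ
    lower n = lo (bracket n)
    upper n = hi (bracket n)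

    lower-mono′ : ∀ {m n} → m ℕ.≤′ n → lower m ≤ lower n
    lower-mono′ ℕ.≤′-refl     = ℚ.≤-refl
    lower-mono′ {n = suc n} (ℕ.≤′-step h) = ℚ.≤-trans (lower-mono′ h)
        (Halved.lo-↑ (halve (bracket n)))

    upper-mono′ : ∀ {m n} → m ℕ.≤′ n → upper n ≤ upper m
    upper-mono′ ℕ.≤′-refl     = ℚ.≤-refl
    upper-mono′ {n = suc n} (ℕ.≤′-step h) = ℚ.≤-trans (Halved.hi-↓ (halve (bracket n)))
        (upper-mono′ h)

    lower-mono : ∀ {m n} → m ℕ.≤ n → lower m ≤ lower n
    lower-mono m≤n = lower-mono′ (ℕ.≤⇒≤′ m≤n)

    upper-mono : ∀ {m n} → m ℕ.≤ n → upper n ≤ upper m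
    upper-mono m≤n = upper-mono′ (ℕ.≤⇒≤′ m≤n)

    0≤width : ∀ n → 0ℚ ≤ width (bracket n)
    0≤width n = ≤⇒0≤- (lo≤hi (bracket n))

    -- The width halves at every stage; the weaker rate `1 / (n + 1)` already gives convergence and
    -- follows from `n + 2 ≤ 2 (n + 1)`.
    width-bound : ∀ n → nat (suc n) * width (bracket n) ≤ 1ℚ
    width-bound zero    = subst (_≤ 1ℚ) (sym (ℚ.*-identityˡ (width B₀))) width₀≤1
    width-bound (suc n) = ℚ.≤-trans (subst₂ _≤_
        (sym (cong₂ _*_ (nat-suc (suc n)) (Halved.width-½ (halve (bracket n)))))
        (solve 2 (λ k w → (k :+ k) :* (con ½ :* w) := k :* w) refl (nat (suc n)) w)
        (*-monoʳ (*-nonNeg (ℚ.<⇒≤ 0<½) (0≤width n)) (ℚ.+-monoˡ-≤ (nat (suc n)) (1≤nat-suc n))))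
      (width-bound n)
      where
      w = width (bracket n)

    width-small : ∀ ε → 0ℚ < ε → ∃[ N ] (∀ n → N ℕ.≤ n → width (bracket n) < ε)
    width-small ε 0<ε = d , λ n d≤n → ℚ.≰⇒> λ ε≤w →
      <⇒≱ (big n d≤n) (ℚ.≤-trans (*-monoˡ (0≤nat (suc n)) ε≤w) (width-bound n))
      where
      d = proj₁ (archimedean 0<ε)
      big : ∀ n → d ℕ.≤ n → 1ℚ < nat (suc n) * ε
      big n d≤n = ℚ.<-≤-trans (subst (_< ε + 1ℚ) (ℚ.+-identityˡ 1ℚ) (ℚ.+-monoˡ-< 1ℚ 0<ε))
        (subst (ε + 1ℚ ≤_) (trans (solve 2 (λ e n → e :+ n :* e := (con 1ℚ :+ n) :* e) refl ε
            (nat n))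
            (cong (_* ε) (sym (nat-suc n))))
          (ℚ.+-monoʳ-≤ ε (ℚ.≤-trans (proj₂ (archimedean 0<ε))
              (*-monoʳ (ℚ.<⇒≤ 0<ε) (nat-mono-≤ d≤n)))))

    bracketed-cauchy : ∀ x → (∀ N n → N ℕ.≤ n → lower N ≤ x n × x n ≤ upper N) → Cauchy x
    bracketed-cauchy x between ε 0<ε =
      N , λ (m , n) N≤ → ℚ.≤-<-trans (close (ℕ.m≤n⊓o⇒m≤n m n N≤) (ℕ.m≤n⊓o⇒m≤o m n N≤))
        (proj₂ (width-small ε 0<ε) N ℕ.≤-refl)
      where
      N = proj₁ (width-small ε 0<ε)
      difference : ∀ {m n} → N ℕ.≤ m → N ℕ.≤ n → x m - x n ≤ width (bracket N)
      difference {m} {n} N≤m N≤n =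
        ℚ.+-mono-≤ (proj₂ (between N m N≤m)) (ℚ.neg-antimono-≤ (proj₁ (between N n N≤n)))
      close : ∀ {m n} → N ℕ.≤ m → N ℕ.≤ n → ∣ x m - x n ∣ ≤ width (bracket N)
      close {m} {n} N≤m N≤n = cases (ℚ.∣p∣≡p∨∣p∣≡-p (x m - x n))
        where
        cases : ∣ x m - x n ∣ ≡ x m - x n ⊎ ∣ x m - x n ∣ ≡ - (x m - x n) → ∣ x m - x n ∣ ≤ width
            (bracket N)
        cases (inj₁ e) = subst (_≤ width (bracket N)) (sym e) (difference N≤m N≤n)
        cases (inj₂ e) = subst (_≤ width (bracket N))
            (sym (trans e (swap-difference (x m) (x n)))) (difference N≤n N≤m)

    abstract
      lower-cauchy : Cauchy lower
      lower-cauchy = bracketed-cauchy lower λ N n N≤n →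
        lower-mono N≤n , ℚ.≤-trans (lo≤hi (bracket n)) (upper-mono N≤n)

      upper-cauchy : Cauchy upper
      upper-cauchy = bracketed-cauchy upper λ N n N≤n →
        ℚ.≤-trans (lower-mono N≤n) (lo≤hi (bracket n)) , upper-mono N≤n

    -- Two sequences for one real number: every term of the first is good, every term of the second
    -- is bad.
    τ τ′ : ℝ
    τ  = mkℝ lower lower-cauchy
    τ′ = mkℝ upper upper-cauchy

    τ≈τ′ : τ ≈ᴿ τ′
    τ≈τ′ = mk≈ λ ε 0<ε → let (N , small) = width-small ε 0<ε in N , λ n N≤n →
      subst (_< ε) (sym (trans (∣∣-sym (lower n) (upper n)) (ℚ.0≤p⇒∣p∣≡p (0≤width n))))
          (small n N≤n)

  ρᴿ ιᴿ : ℕ → ℝ → ℝ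
  ρᴿ zero    t = fromℚᴿ 1ℚ
  ρᴿ (suc j) t = ρᴿ j t +ᴿ (-ᴿ (t *ᴿ ιᴿ j t))
  ιᴿ zero    t = fromℚᴿ 0ℚ
  ιᴿ (suc j) t = ιᴿ j t +ᴿ t *ᴿ ρᴿ j t

  seq-ρᴿ : ∀ j t n → seq (ρᴿ j t) n ≡ ρ j (seq t n)
  seq-ιᴿ : ∀ j t n → seq (ιᴿ j t) n ≡ ι j (seq t n)
  seq-ρᴿ zero    t n = refl
  seq-ρᴿ (suc j) t n = cong₂ (λ a b → a + - (seq t n * b)) (seq-ρᴿ j t n) (seq-ιᴿ j t n)
  seq-ιᴿ zero    t n = refl
  seq-ιᴿ (suc j) t n = cong₂ (λ a b → a + seq t n * b) (seq-ιᴿ j t n) (seq-ρᴿ j t n)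

  ρᴿ-cong : ∀ j {s t} → s ≈ᴿ t → ρᴿ j s ≈ᴿ ρᴿ j t
  ιᴿ-cong : ∀ j {s t} → s ≈ᴿ t → ιᴿ j s ≈ᴿ ιᴿ j t
  ρᴿ-cong zero    s≈t = ℝ-ring.refl
  ρᴿ-cong (suc j) s≈t = ℝ-ring.+-cong (ρᴿ-cong j s≈t)
      (ℝ-ring.-‿cong (ℝ-ring.*-cong s≈t (ιᴿ-cong j s≈t)))
  ιᴿ-cong zero    s≈t = ℝ-ring.refl
  ιᴿ-cong (suc j) s≈t = ℝ-ring.+-cong (ιᴿ-cong j s≈t) (ℝ-ring.*-cong s≈t (ρᴿ-cong j s≈t))

  ^-ρι : ∀ j t → (fromℚᴿ 1ℚ +i t) ^ j ℂ.≈ ρᴿ j t +i ιᴿ j t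
  ^-ρι zero    t = ℂ.refl
  ^-ρι (suc j) t = ℂ.trans (ℂ.*-congˡ (^-ρι j t))
    (pointwise (λ n → solve 3 (λ t r i → con 1ℚ :* r :+ (:- (t :* i)) := r :+ (:- (t :* i)))
        refl (seq t n) (seq (ρᴿ j t) n) (seq (ιᴿ j t) n)) ,ᵢ
     pointwise (λ n → solve 3 (λ t r i → con 1ℚ :* i :+ t :* r := i :+ t :* r)
        refl (seq t n) (seq (ρᴿ j t) n) (seq (ιᴿ j t) n)))

  ^-ρι-conjugate : ∀ j t → (fromℚᴿ 1ℚ +i (-ᴿ t)) ^ j ℂ.≈ ρᴿ j t +i (-ᴿ (ιᴿ j t))
  ^-ρι-conjugate zero    t = ℝ-ring.refl ,ᵢ pointwise λ _ → refl
  ^-ρι-conjugate (suc j) t = ℂ.trans (ℂ.*-congˡ (^-ρι-conjugate j t))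
    (pointwise (λ n → solve 3 (λ t r i → con 1ℚ :* r :+ (:- ((:- t) :* (:- i))) := r :+
        (:- (t :* i)))
        refl (seq t n) (seq (ρᴿ j t) n) (seq (ιᴿ j t) n)) ,ᵢ
     pointwise (λ n → solve 3 (λ t r i → con 1ℚ :* (:- i) :+ (:- t) :* r := :- (i :+ t :* r))
        refl (seq t n) (seq (ρᴿ j t) n) (seq (ιᴿ j t) n)))

  -- The first t > 0 at which (1 + i t)ᴹ is real: there (1 + i t) / (1 - i t) has order M.
  module RootOfOrder (M : ℕ) (3<M : 3 ℕ.< M) where

    instance
      M≢0 : ℕ.NonZero M
      M≢0 = ℕ.>-nonZero (ℕ.<-trans ℕ.z<s 3<M)

    K : ℕ
    K = ℕ.pred M

    suc-K : suc K ≡ M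
    suc-K = ℕ.suc-pred M

    K<M : K ℕ.< M
    K<M = ℕ.≤-reflexive suc-K

    abstract
      t₀ : ℚ
      t₀ = recip (nat M)

      Mt₀≡1 : nat M * t₀ ≡ 1ℚ
      Mt₀≡1 = *-recip {nat M} λ e → ℕ.≢-nonZero⁻¹ M (ℤ.+-injective (cong ℚ.↥_ e))

    0<t₀ : 0ℚ < t₀
    0<t₀ = ℚ.*-cancelˡ-<-nonNeg (nat M) {{ℚ.nonNegative (0≤nat M)}}
      (subst₂ _<_ (sym (ℚ.*-zeroʳ (nat M))) (sym Mt₀≡1) (ℚ.positive⁻¹ 1ℚ))

    t₀≤1 : t₀ ≤ 1ℚ
    t₀≤1 = subst₂ _≤_ (ℚ.*-identityˡ t₀) Mt₀≡1
      (*-monoʳ (ℚ.<⇒≤ 0<t₀) (nat-mono-≤ (ℕ.≤-trans (s≤s z≤n) 3<M)))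

    B₀ : Bracket M
    B₀ = record
      { lo = t₀ ; hi = 1ℚ ; lo≤hi = t₀≤1
      ; good = good-start {M} Mt₀≡1 0<t₀
      -- At `t = 1` the fourth power `(1 + i)⁴ = -4` has imaginary part 0; this is why `M` must
      -- exceed 3.
      ; bad = 3 , 3<M , ℚ.≤-refl
      }

    open Bisection B₀ (0≤-⇒≤ (subst (0ℚ ≤_)
      (solve 1 (λ t → t := con 1ℚ :- (con 1ℚ :- t)) refl t₀) (ℚ.<⇒≤ 0<t₀)))

    c : ℚ
    c = ½ * t₀

    0<c : 0ℚ < c
    0<c = 0<½* 0<t₀

    ι-lower : ∀ j → suc j ℕ.< M → ∀ n → c ≤ ι (suc j) (lower n)
    ι-lower j j<M n = good-lower (good (bracket n)) 0<t₀ (lower-mono {0} {n} z≤n)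
      (ℚ.≤-trans (lo≤hi (bracket n)) (upper-mono {0} {n} z≤n)) j j<M

    ι-difference : ∀ j → Vanishes id λ n → ι j (lower n) - ι j (upper n)
    ι-difference j = vanishes-cong (λ n → cong₂ _-_ (seq-ιᴿ j τ n) (seq-ιᴿ j τ′ n))
      (difference-vanishes (ιᴿ-cong j τ≈τ′))

    -- The imaginary parts of the lower powers stay above `c` along `lower`, and the two sequences
    -- approach each other, so along `upper` these parts are eventually positive too. Only the power
    -- `M` can then be responsible for badness.
    ι-upper : ∀ k → k ℕ.< M → ∃[ N ] (∀ n → N ℕ.≤ n → ∀ j → j ℕ.< k → 0ℚ < ι (suc j) (upper n))
    ι-upper zero    _   = 0 , λ _ _ j ()
    ι-upper (suc k) k<M = combine (ι-upper k (ℕ.<-trans (ℕ.n<1+n k) k<M))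
        (ι-difference (suc k) c 0<c)
      where
      combine : ∃[ N ] (∀ n → N ℕ.≤ n → ∀ j → j ℕ.< k → 0ℚ < ι (suc j) (upper n)) →
                ∃[ N ] (∀ n → N ℕ.≤ n → ∣ ι (suc k) (lower n) - ι (suc k) (upper n) ∣ < c) →
                ∃[ N ] (∀ n → N ℕ.≤ n → ∀ j → j ℕ.< suc k → 0ℚ < ι (suc j) (upper n))
      combine (N , below) (N′ , near) = N ℕ.⊔ N′ , result
        where
        result : ∀ n → N ℕ.⊔ N′ ℕ.≤ n → ∀ j → j ℕ.< suc k → 0ℚ < ι (suc j) (upper n)
        result n b≤n j (s≤s j≤k) = cases (ℕ.m≤n⇒m<n∨m≡n j≤k)
          where
          at-k : 0ℚ < ι (suc k) (upper n)
          at-k = +-cancelʳ-< c (ℚ.≤-<-trans (ℚ.≤-reflexive (ℚ.+-identityˡ c))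
            (ℚ.≤-<-trans (ι-lower k k<M n) (∣-∣<⇒<+ (near n (ℕ.m⊔n≤o⇒n≤o N N′ b≤n)))))
          cases : j ℕ.< k ⊎ j ≡ k → 0ℚ < ι (suc j) (upper n)
          cases (inj₁ j<k) = below n (ℕ.m⊔n≤o⇒m≤o N N′ b≤n) j j<k
          cases (inj₂ j≡k) = subst (λ j → 0ℚ < ι (suc j) (upper n)) (sym j≡k) at-k

    -- The value is positive along `lower` and eventually at most 0 along `upper`, so it is
    -- dominated by their difference, which vanishes.
    ιᴿ-M≈0 : ιᴿ M τ ≈ᴿ fromℚᴿ 0ℚ
    ιᴿ-M≈0 = mk≈ (vanishes-cong
      (λ n → sym (trans (ℚ.+-identityʳ _) (seq-ιᴿ M τ n)))
      (dominated (ι-upper K K<M)))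
      where
      dominated : ∃[ N ] (∀ n → N ℕ.≤ n → ∀ j → j ℕ.< K → 0ℚ < ι (suc j) (upper n)) →
                  Vanishes id (λ n → ι M (lower n))
      dominated (N , above) = vanishes-dominated N dominate (ι-difference M)
        where
        ι-M≤0 : ∀ n → N ℕ.≤ n → Bad M (upper n) → ι M (upper n) ≤ 0ℚ
        ι-M≤0 n N≤n (j , j<M , ≤0) = cases (ℕ.m≤n⇒m<n∨m≡n (ℕ.<⇒≤pred j<M))
          where
          cases : j ℕ.< K ⊎ j ≡ K → ι M (upper n) ≤ 0ℚ
          cases (inj₁ j<K) = contradiction ≤0 (<⇒≱ (above n N≤n j j<K))
          cases (inj₂ j≡K) = subst (λ k → ι k (upper n) ≤ 0ℚ) (trans (cong suc j≡K) suc-K) ≤0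
        dominate : ∀ n → N ℕ.≤ n → ∣ ι M (lower n) ∣ ≤ ∣ ι M (lower n) - ι M (upper n) ∣
        dominate n N≤n = ℚ.≤-trans (ℚ.≤-reflexive (ℚ.0≤p⇒∣p∣≡p
            (ℚ.<⇒≤ (subst (λ k → 0ℚ < ι k (lower n)) suc-K (good (bracket n) K K<M)))))
          (ℚ.≤-trans (subst (_≤ ι M (lower n) - ι M (upper n)) (ℚ.+-identityʳ (ι M (lower n)))
            (ℚ.+-monoʳ-≤ (ι M (lower n)) (ℚ.neg-antimono-≤ (ι-M≤0 n N≤n (bad (bracket n))))))
            (a≤∣a∣ _))

    ιᴿ≉0 : ∀ j → suc j ℕ.< M → ¬ ιᴿ (suc j) τ ≈ᴿ fromℚᴿ 0ℚ
    ιᴿ≉0 j j<M = ¬null (c , 0<c , 0 , λ n _ → subst (λ q → c ≤ ∣ q ∣) (sym (seq-ιᴿ (suc j) τ n))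
      (ℚ.≤-trans (ι-lower j j<M n) (a≤∣a∣ _)))

    w w̄ : ℂ
    w = fromℚᴿ 1ℚ +i τ
    w̄ = fromℚᴿ 1ℚ +i (-ᴿ τ)

    w̄-inverse : Inv w̄
    w̄-inverse = re-inverse w̄ (1ℚ , ℚ.positive⁻¹ 1ℚ , 0 , λ _ _ → ℚ.≤-refl)

    w^M≈w̄^M : w ^ M ℂ.≈ w̄ ^ M
    w^M≈w̄^M = ℂ.trans (^-ρι M τ) (ℂ.trans
      (ℝ-ring.refl ,ᵢ ℝ-ring.trans ιᴿ-M≈0 (ℝ-ring.trans (pointwise λ _ → refl)
        (ℝ-ring.-‿cong (ℝ-ring.sym ιᴿ-M≈0))))
      (ℂ.sym (^-ρι-conjugate M τ)))

    self-negative : ∀ {y} → y ≈ᴿ (-ᴿ y) → y ≈ᴿ fromℚᴿ 0ℚ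
    self-negative {y} e = ℝ-ring.trans (pointwise λ n → solve 1 (λ y → y := con ½ :* (y :+ y))
        refl (seq y n))
      (ℝ-ring.trans (ℝ-ring.*-congˡ {fromℚᴿ ½} (ℝ-ring.trans (ℝ-ring.+-congʳ e)
          (ℝ-ring.-‿inverseˡ y)))
        (ℝ-ring.zeroʳ (fromℚᴿ ½)))

    w^≉w̄^ : ∀ j → suc j ℕ.< M → ¬ w ^ suc j ℂ.≈ w̄ ^ suc j
    w^≉w̄^ j j<M e = ιᴿ≉0 j j<M (self-negative (im-≈ (ℂ.trans (ℂ.sym (^-ρι (suc j) τ))
      (ℂ.trans e (^-ρι-conjugate (suc j) τ)))))

    root : ∃[ u ] Primitive u M
    root = quotient-primitive {w} {w̄} {proj₁ w̄-inverse} {M} (proj₂ w̄-inverse) w^M≈w̄^M w^≉w̄^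

  -- The bisection wants an order above 3, so a root of order `4 * Q` is constructed and raised to
  -- the fourth power.
  primitive-root : ∀ Q → 0 ℕ.< Q → ∃[ z ] Primitive z Q
  primitive-root Q 0<Q =
    ∃-primitive-factor 4 Q (RootOfOrder.root (4 ℕ.* Q) (ℕ.*-monoʳ-≤ 4 0<Q))

-- The theorem over the complex numbers.

open Counting using (#𝒩≤)
open IntegerLattices
  using (dot; dot-comm; _◂_; extend-independent)
open VanishingSums
open ComplexNumbers
  using ( nat; recip; *-recip; ℂ-stableDomain; local; fromℚ-fromℤ; fromℚ-*; clear-denominator
        ; primitive-root)
open import Data.Fin.Base using (Fin; zero; suc)
open import Data.Integer.Base using (0ℤ) renaming (+_ to pos)
open import Data.List.Base using (upTo)
open import Data.List.Extrema.Nat using (xs≤max)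
open import Data.List.Membership.Propositional using (_∈_)
open import Data.List.Membership.Propositional.Properties using (∈-cartesianProductWith⁺)
open import Data.List.Relation.Unary.All as All using ()
open import Data.List.Relation.Unary.All.Properties using (all-filter)
open import Data.Nat.Base as ℕ using (ℕ; zero; suc; _+_; _*_; _∸_; _^_; _≤_; _<_)
open import Data.Nat.Combinatorics using (_C_)
open import Data.Nat.ListAction.Properties using (product≢0)
open import Data.Nat.Primality using (prime?; prime⇒nonZero)
import Data.Nat.Properties as ℕ
open import Data.Product.Base using (_×_; _,_; ∃-syntax; proj₁; proj₂)
import Data.Rational.Base as ℚ
open import Relation.Binary.PropositionalEquality as ≡ using (_≡_; _≢_)
open import Relation.Nullary using (¬_)

ℂ-cyclotomic : CyclotomicRing ℂ-commutativeRing
ℂ-cyclotomic = record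
  { domain = ℂ-stableDomain
  ; local = local
  ; ℕ-invertible = λ n → fromℚ (recip (nat (suc n))) ,
      ℂ.trans (ℂ.*-congʳ (ℂ.sym (fromℚ-fromℤ (pos (suc n)))))
        (ℂ.trans (ℂ.sym (fromℚ-* (nat (suc n)) (recip (nat (suc n)))))
          (ℂ.reflexive (≡.cong fromℚ (*-recip {nat (suc n)} λ ()))))
  ; primitive-root = primitive-root
  }

open Units ℂ-commutativeRing ℂ-cyclotomic
  using (module U; val-≈; ∑-cong; clear-denominators; two; InTorus; order; inTorus-cong;
    ^ᵘ-multiple; translate; monomialMap-ε◂; monomialMap-◂ε; ω·two^v∉coset)

primorial>0 : ∀ N → 0 < primorial N
primorial>0 N = ℕ.n≢0⇒n>0 (ℕ.≢-nonZero⁻¹ (primorial N)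
  {{product≢0 (All.map prime⇒nonZero (all-filter prime? (upTo (suc N))))}})

pointwise-^ : ∀ {n} (x : Point n) m i → GroupPower._^_ (𝔾ₘ^.group n) x m i ≡ x i U.^ m
pointwise-^ x zero    i = ≡.refl
pointwise-^ x (suc m) i = ≡.cong (x i U.∙_) (pointwise-^ x m i)

module _ {n L : ℕ} (V : System n L) where

  open System V

  module Exponent = ExponentTheorem ℂ-commutativeRing ℂ-cyclotomic 𝒩 (λ ℓ i → fromℚ (a ℓ i))
    (λ ℓ → clear-denominators 𝒩 (λ i → fromℚ (a ℓ i)) (λ i → ℚ.ℚ.denominator-1 (a ℓ i))
      (λ i → ℚ.↥ (a ℓ i)) (λ i → clear-denominator (a ℓ i)))

  variety-cong : ∀ {x y} → (∀ i → x i U.≈ y i) → variety V x → variety V y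
  variety-cong x≈y Vx ℓ = ℂ.trans (∑-cong 𝒩 λ i → ℂ.*-congˡ
    (val-≈ (U.character-cong (exponents i) λ j → U.sym (x≈y j)))) (Vx ℓ)

  distance²≤diameter² : ∀ {i c} → i ∈ 𝒩 → c ∈ 𝒩 → distance² i c ≤ diameter² V
  distance²≤diameter² i∈ c∈ = All.lookup (xs≤max 0 _) (∈-cartesianProductWith⁺ distance² i∈ c∈)

  module _ {r} (T : TorsionCoset n r) where

    open TorsionCoset T
    open Subtorus H using (E; rank)

    private
      orders = common-multiple n (λ i → proj₁ (torsion i)) (λ i → proj₁ (proj₂ (torsion i)))
      Q = proj₁ orders
      0<Q = proj₁ (proj₂ orders)

      ω^Q≈ε : ∀ i → ω i U.^ Q U.≈ U.ε
      ω^Q≈ε i = ^ᵘ-multiple {ω i} {proj₁ (torsion i)} {Q} (proj₂ (proj₂ orders) i)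
          (proj₂ (proj₂ (torsion i)))

    module _ (maximal : IsMaximalOn (variety V) T) where

      on-variety : ∀ t → variety V (λ i → ω i U.∙ U.monomialMap E t i)
      on-variety t = proj₁ maximal (U.monomialMap E t , (t , λ i → U.refl) , λ i → U.refl)

      -- Adding the row `v` gives a coset of dimension one more. It contains the old one, with new
      -- parameter `ε`, and also the translate by `ω` of the point with coordinates 2 to the power
      -- `v i`, where the character `x` shows that it is not in the old one.
      not-enlargeable : ∀ v x → (∀ j → dot (E j) x ≡ 0ℤ) → dot v x ≢ 0ℤ →
        ¬ (∀ t → variety V (λ i → ω i U.∙ U.monomialMap (v ◂ E) t i))
      not-enlargeable v x Ex≡0 vx≢0 on = proj₂ maximal (suc r , T⁺ , T⁺⊆V , T⊆T⁺ , T⁺⊈T)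
        where
        T⁺ : TorsionCoset n (suc r)
        T⁺ = record
          { H = record
            { E = v ◂ E
            ; rank = extend-independent rank (x , (λ j → ≡.trans (dot-comm x (E j)) (Ex≡0 j)) ,
                λ e → vx≢0 (≡.trans (dot-comm v x) e))
            }
          ; ω = ω ; torsion = torsion }
        T⁺⊆V : ∀ {y} → TorsionCoset.points T⁺ y → variety V y
        T⁺⊆V {y} (h , (t , h≈) , y≈) = variety-cong (translate (v ◂ E) ω y h t y≈ h≈) (on t)
        T⊆T⁺ : ∀ {y} → points y → TorsionCoset.points T⁺ y
        T⊆T⁺ (h , (t , h≈) , y≈) = h , (U.ε ◂ t , monomialMap-ε◂ E v t h h≈) , y≈
        two^v : Point n
        two^v i = two U.^ᶻ v i
        two^v∈T⁺ : TorsionCoset.points T⁺ (λ i → ω i U.∙ two^v i)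
        two^v∈T⁺ = two^v , (two ◂ (λ _ → U.ε) , monomialMap-◂ε E v two) , λ i → U.refl
            {ω i U.∙ two^v i}
        outside : ¬ points (λ i → ω i U.∙ two^v i)
        outside (h , h∈H , eq) = ω·two^v∉coset E v x Ex≡0 vx≢0 ω h h∈H eq
        T⁺⊈T : ¬ (∀ {y} → TorsionCoset.points T⁺ y → points y)
        T⁺⊈T T⁺⊆T = outside (T⁺⊆T two^v∈T⁺)

      exponent-exists : ∀ k → n ∸ r ≡ k → (k ≢ 0 → r < n) →
        ∃[ m ] 0 < m × m ^ 2 ≤ diameter² V ^ (2 * k) * k ^ k × IsExponent T (m * primorial (#𝒩 V))
      exponent-exists k n∸r≡k r<n =
        let (m , 0<m , m²≤ , ω^mP∈H) = Exponent.exponent E rank ω 0<Q ω^Q≈ε on-variety not-enlargeable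
              (diameter² V) distance²≤diameter² k n∸r≡k r<n
            (q , 0<q , ω^q∈H , least , divides-all) = order E rank ω 0<Q ω^Q≈ε
        in m , 0<m , m²≤ , ℕ.*-mono-≤ 0<m (primorial>0 (#𝒩 V)) , q ,
           (0<q , to q ω^q∈H , λ j 0<j ω^j∈H → least j 0<j (from j ω^j∈H)) ,
           divides-all (m * primorial (#𝒩 V)) ω^mP∈H
        where
        to : ∀ m → InTorus E (λ i → ω i U.^ m) →
             Subtorus.points H (GroupPower._^_ (𝔾ₘ^.group n) ω m)
        to m = inTorus-cong {E = E} λ i → U.reflexive (≡.sym (pointwise-^ ω m i))
        from : ∀ m → Subtorus.points H (GroupPower._^_ (𝔾ₘ^.group n) ω m) →
               InTorus E (λ i → ω i U.^ m)
        from m = inTorus-cong {E = E} λ i → U.reflexive (pointwise-^ ω m i)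

theorem8 : ∀ (n L : ℕ) (V : System n L) →
    #𝒩 V ≤ (n + totalDegree V) C totalDegree V ×
    (∀ (k : ℕ) → k ≤ n → (T : TorsionCoset n (n ∸ k)) → IsMaximalOn (variety V) T →
    ∃[ m ] 0 < m
    × m ^ 2 ≤ diameter² V ^ (2 * k) * k ^ k
    × IsExponent T (m * primorial (#𝒩 V)))
theorem8 n L V = #𝒩≤ V , λ k k≤n T maximal → exponent-exists V T maximal k (ℕ.m∸[m∸n]≡n k≤n)
  λ k≢0 → ℕ.∸-monoʳ-< (ℕ.n≢0⇒n>0 k≢0) k≤n
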